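{- Put $A(p)=\int_0^1\arctan^p(x)\,dx$ for $p\in\mathbb{N}$ and $t(\bar1)=\sum_{n\ge1}\frac{(-1)^n}{2n-1}=-\frac{\pi}{4}$; $t^{j}(\bar 1)$ denotes the $j$-th power $(t(\bar1))^j$. For all positive integers $n$ and $m$: \begin{align*} \int_0^1 x^{2n-2}\arctan^{2m}(x)\,dx={}&\frac{1+(-1)^n}{2n-1}t^{2m}(\bar 1)+\frac{(-1)^{n+m}(2m)!}{2^{2m}(2n-1)}T_n^{\{1\}_{2m-1},-1}\\ &-\frac{(-1)^{n}(2m)!}{2n-1}\sum_{u=0}^{m-1}\frac{(-1)^uT_n^{\{1\}_{2u}}}{(2m-2u)!\,2^{2u}}A(2m-2u)\\ &+\frac{(-1)^{n}(2m)!}{2n-1}\sum_{v=1}^{m-1}\frac{(-1)^{v}t^{2m-2v}(\bar 1)}{2^{2v}(2m-2v)!}\left(T_n^{\{1\}_{2v}}+T_n^{\{1\}_{2v-1},-1}\right)\\ &+\frac{(-1)^{n}(2m)!}{2n-1}\sum_{v=0}^{m-1}\frac{(-1)^{v}t^{2m-2v-1}(\bar 1)}{2^{2v+1}(2m-2v-1)!}\left(S_n^{\{1\}_{2v+1}}-S_n^{\{1\}_{2v},-1}\right), \end{align*} \begin{align*} \int_0^1 x^{2n-2}\arctan^{2m-1}(x)\,dx={}&-\frac{1+(-1)^n}{2n-1}t^{2m-1}(\bar 1)-\frac{(-1)^{n+m}(2m-1)!}{2^{2m-1}(2n-1)}S_n^{\{1\}_{2m-2},-1}\\ &-\frac{(-1)^{n}(2m-1)!}{2n-1}\sum_{u=0}^{m-1}\frac{(-1)^uT_n^{\{1\}_{2u}}}{(2m-2u-1)!\,2^{2u}}A(2m-2u-1)\\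 &+\frac{(-1)^{n}(2m-1)!}{2n-1}\sum_{v=1}^{m-1}\frac{(-1)^{v+1}t^{2m-2v-1}(\bar 1)}{2^{2v}(2m-2v-1)!}\left(T_n^{\{1\}_{2v}}+T_n^{\{1\}_{2v-1},-1}\right)\\ &+\frac{(-1)^{n}(2m-1)!}{2n-1}\sum_{v=1}^{m-1}\frac{(-1)^{v}t^{2m-2v}(\bar 1)}{2^{2v-1}(2m-2v)!}\left(S_n^{\{1\}_{2v-1}}-S_n^{\{1\}_{2v-2},-1}\right), \end{align*} \begin{align*} \int_0^1 x^{2n-1}\arctan^{2m}(x)\,dx={}&\frac{1-(-1)^n}{2n}t^{2m}(\bar 1)+\frac{(-1)^{n+m}(2m)!}{2^{2m}(2n)}S_{n}^{\{1\}_{2m-1},-1}\\ &+\frac{(-1)^{n}(2m)!}{2n}\sum_{u=0}^{m-1}\frac{(-1)^uT_{n}^{\{1\}_{2u+1}}}{(2m-2u-1)!\,2^{2u+1}}A(2m-2u-1)\\ &+\frac{(-1)^{n}(2m)!}{2n}\sum_{v=0}^{m-1}\frac{(-1)^{v}t^{2m-2v-1}(\bar 1)}{2^{2v+1}(2m-2v-1)!}\left(T_{n}^{\{1\}_{2v+1}}+T_{n}^{\{1\}_{2v},-1}\right)\\ &+\frac{(-1)^{n}(2m)!}{2n}\sum_{v=1}^{m-1}\frac{(-1)^{v+1}t^{2m-2v}(\bar 1)}{2^{2v}(2m-2v)!}\left(S_{n}^{\{1\}_{2v}}-S_{n}^{\{1\}_{2v-1},-1}\right), \end{align*} \begin{align*}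 \int_0^1 x^{2n-1}\arctan^{2m-1}(x)\,dx={}&-\frac{1-(-1)^n}{2n}t^{2m-1}(\bar 1)+\frac{(-1)^{n+m}(2m-1)!}{2^{2m-1}(2n)}T_{n}^{\{1\}_{2m-2},-1}\\ &-\frac{(-1)^{n}(2m-1)!}{2n}\sum_{u=1}^{m-1}\frac{(-1)^uT_{n}^{\{1\}_{2u-1}}}{(2m-2u)!\,2^{2u-1}}A(2m-2u)\\ &+\frac{(-1)^{n}(2m-1)!}{2n}\sum_{v=1}^{m-1}\frac{(-1)^{v}t^{2m-2v}(\bar 1)}{2^{2v-1}(2m-2v)!}\left(T_{n}^{\{1\}_{2v-1}}+T_{n}^{\{1\}_{2v-2},-1}\right)\\ &+\frac{(-1)^{n}(2m-1)!}{2n}\sum_{v=1}^{m-1}\frac{(-1)^{v}t^{2m-2v-1}(\bar 1)}{2^{2v}(2m-2v-1)!}\left(S_{n}^{\{1\}_{2v}}-S_{n}^{\{1\}_{2v-1},-1}\right). \end{align*}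
   Context: For $n\in\mathbb{N}$ and signs $\sigma_1,\dots,\sigma_r\in\{\pm1\}$ the alternating multiple $T$- and $S$-harmonic sums with all arguments equal to $1$, denoted $T_n^{\sigma_1,\dots,\sigma_r}$ and $S_n^{\sigma_1,\dots,\sigma_r}$, are given recursively as follows. For $r=0$ both equal $1$. For $r\ge1$: $$T_n^{\sigma_1,\dots,\sigma_r}=\begin{cases}2\sum_{j=1}^{n}\dfrac{\sigma_1^j\,T_j^{\sigma_2,\dots,\sigma_r}}{2j-1}, & r\text{ odd},\\[2mm] 2\sum_{j=1}^{n-1}\dfrac{\sigma_1^j\,T_j^{\sigma_2,\dots,\sigma_r}}{2j}, & r\text{ even},\end{cases}\qquad S_n^{\sigma_1,\dots,\sigma_r}=\begin{cases}2\sum_{j=1}^{n-1}\dfrac{\sigma_1^j\,S_j^{\sigma_2,\dots,\sigma_r}}{2j}, & r\text{ odd},\\[2mm] 2\sum_{j=1}^{n}\dfrac{\sigma_1^j\,S_j^{\sigma_2,\dots,\sigma_r}}{2j-1}, & r\text{ even}.\end{cases}$$ Empty sums are $0$. The notation $\{1\}_p$ in a superscript means $1$ repeated $p$ times, so e.g. $T_n^{\{1\}_{p},-1}$ has $p+1$ signs, the last of which is $-1$, and $T_n^{\{1\}_0}=1$. -}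

module Defs where

open import Level using (0ℓ)
open import Algebra.Bundles using (CommutativeRing; Semiring)
open import Data.Bool.Base using (Bool; true; false; not; if_then_else_)
open import Data.Integer.Base as ℤ using ()
import Data.Integer.Properties as ℤₚ
open import Data.List.Base using (List; []; _∷_; _++_; [_]; length; replicate; foldr; applyUpTo)
open import Data.Maybe.Base using (Maybe; just; nothing)
open import Data.Nat.Base as ℕ using (ℕ; zero; suc)
import Data.Nat.Properties as ℕₚ
open import Data.Product.Base using (∃; _×_; _,_; proj₁; proj₂)
open import Data.Rational.Base as ℚ using (ℚ; 0ℚ; 1ℚ; ½)
import Data.Rational.Properties as ℚₚ
import Data.Rational.Unnormalised.Base as ℚᵘ
import Data.Rational.Unnormalised.Properties as ℚᵘₚ
open import Data.Rational.Solver
open import Data.Sign.Base as Sign using (Sign)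
open import Data.Sum.Base using (inj₁; inj₂)
open import Relation.Binary.PropositionalEquality as ≡ using (_≡_; refl; cong; cong₂; subst; subst₂)
open import Relation.Nullary using (yes; no; contradiction)
open import Relation.Binary.Bundles using (Poset)
import Algebra.Definitions.RawSemiring as RawSemiring
import Algebra.Solver.Ring as RingSolver
import Algebra.Solver.Ring.AlmostCommutativeRing as ACR
import Relation.Binary.Reasoning.PartialOrder as PosetReasoning

module Rational where
  open import Data.Rational.Base
  open import Data.Rational.Properties
  open +-*-Solver

  1/2-pos : 0ℚ < ½
  1/2-pos = positive⁻¹ ½

  0<1 : 0ℚ < 1ℚ
  0<1 = positive⁻¹ 1ℚ

  0≤1 : 0ℚ ≤ 1ℚ
  0≤1 = <⇒≤ 0<1

  *-pos : ∀ {p q} → 0ℚ < p → 0ℚ < q → 0ℚ < p * q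
  *-pos {p} {q} 0<p 0<q = positive⁻¹ (p * q) {{pos*pos⇒pos p {{positive 0<p}} q {{positive 0<q}}}}

  *-nonNeg : ∀ {p q} → 0ℚ ≤ p → 0ℚ ≤ q → 0ℚ ≤ p * q
  *-nonNeg {p} {q} 0≤p 0≤q = nonNegative⁻¹ (p * q) {{nonNeg*nonNeg⇒nonNeg p {{nonNegative 0≤p}} q {{nonNegative 0≤q}}}}

  +-pos : ∀ {p q} → 0ℚ < p → 0ℚ < q → 0ℚ < p + q
  +-pos 0<p 0<q = +-mono-< 0<p 0<q

  +-nonNeg : ∀ {p q} → 0ℚ ≤ p → 0ℚ ≤ q → 0ℚ ≤ p + q
  +-nonNeg 0≤p 0≤q = +-mono-≤ 0≤p 0≤q

  *-monoˡ : ∀ {r p q} → 0ℚ ≤ r → p ≤ q → r * p ≤ r * q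
  *-monoˡ {r} 0≤r p≤q = *-monoˡ-≤-nonNeg r {{nonNegative 0≤r}} p≤q

  *-monoʳ : ∀ {r p q} → 0ℚ ≤ r → p ≤ q → p * r ≤ q * r
  *-monoʳ {r} 0≤r p≤q = *-monoʳ-≤-nonNeg r {{nonNegative 0≤r}} p≤q

  *-mono : ∀ {p q r s} → 0ℚ ≤ p → 0ℚ ≤ s → p ≤ q → r ≤ s → p * r ≤ q * s
  *-mono 0≤p 0≤s p≤q r≤s = ≤-trans (*-monoˡ 0≤p r≤s) (*-monoʳ 0≤s p≤q)

  diff-nonNeg : ∀ {p q} → p ≤ q → 0ℚ ≤ q - p
  diff-nonNeg {p} {q} p≤q = subst (_≤ q - p) (+-inverseʳ p) (+-monoˡ-≤ (- p) p≤q)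

  nonNeg-diff : ∀ {p q} → 0ℚ ≤ q - p → p ≤ q
  nonNeg-diff {p} {q} h =
    subst₂ _≤_ (+-identityˡ p) (solve 2 (λ p q → (q :- p) :+ p := q) refl p q) (+-monoˡ-≤ p h)

  half-pos : ∀ {ε} → 0ℚ < ε → 0ℚ < ½ * ε
  half-pos = *-pos 1/2-pos

  half+half : ∀ ε → ½ * ε + ½ * ε ≡ ε
  half+half = solve 1 (λ ε → con ½ :* ε :+ con ½ :* ε := ε) refl

  p≤∣p∣ : ∀ p → p ≤ ∣ p ∣
  p≤∣p∣ p with ≤-total 0ℚ p
  ... | inj₁ 0≤p = ≤-reflexive (≡.sym (0≤p⇒∣p∣≡p 0≤p))
  ... | inj₂ p≤0 = ≤-trans p≤0 (0≤∣p∣ p)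

  -p≤∣p∣ : ∀ p → - p ≤ ∣ p ∣
  -p≤∣p∣ p = subst (- p ≤_) (∣-p∣≡∣p∣ p) (p≤∣p∣ (- p))

  ∣p∣≤ : ∀ {p q} → p ≤ q → - p ≤ q → ∣ p ∣ ≤ q
  ∣p∣≤ {p} p≤q -p≤q with ∣p∣≡p∨∣p∣≡-p p
  ... | inj₁ e = subst (_≤ _) (≡.sym e) p≤q
  ... | inj₂ e = subst (_≤ _) (≡.sym e) -p≤q

  dist-sym : ∀ p q → ∣ p - q ∣ ≡ ∣ q - p ∣
  dist-sym p q = ≡.trans (≡.sym (∣-p∣≡∣p∣ (p - q))) (cong ∣_∣ (solve 2 (λ p q → :- (p :- q) := q :- p) refl p q))

  dist-refl : ∀ p → ∣ p - p ∣ ≡ 0ℚ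
  dist-refl p = cong ∣_∣ (+-inverseʳ p)

  dist-triangle : ∀ p q r → ∣ p - r ∣ ≤ ∣ p - q ∣ + ∣ q - r ∣
  dist-triangle p q r = subst (λ z → ∣ z ∣ ≤ ∣ p - q ∣ + ∣ q - r ∣)
    (solve 3 (λ p q r → (p :- q) :+ (q :- r) := p :- r) refl p q r)
    (∣p+q∣≤∣p∣+∣q∣ (p - q) (q - r))

  dist-halves : ∀ {p q r ε} → ∣ p - q ∣ ≤ ½ * ε → ∣ q - r ∣ ≤ ½ * ε → ∣ p - r ∣ ≤ ε
  dist-halves {p} {q} {r} {ε} h₁ h₂ =
    ≤-trans (dist-triangle p q r) (subst (∣ p - q ∣ + ∣ q - r ∣ ≤_) (half+half ε) (+-mono-≤ h₁ h₂))

  dist-+ : ∀ {p q r s ε} → ∣ p - q ∣ ≤ ½ * ε → ∣ r - s ∣ ≤ ½ * ε → ∣ (p + r) - (q + s) ∣ ≤ ε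
  dist-+ {p} {q} {r} {s} {ε} h₁ h₂ = subst (λ z → ∣ z ∣ ≤ ε)
    (solve 4 (λ p q r s → (p :- q) :+ (r :- s) := (p :+ r) :- (q :+ s)) refl p q r s)
    (≤-trans (∣p+q∣≤∣p∣+∣q∣ (p - q) (r - s))
      (subst (∣ p - q ∣ + ∣ r - s ∣ ≤_) (half+half ε) (+-mono-≤ h₁ h₂)))

  dist-neg : ∀ p q → ∣ - p - - q ∣ ≡ ∣ p - q ∣
  dist-neg p q = ≡.trans (cong ∣_∣ (solve 2 (λ p q → :- p :- :- q := :- (p :- q)) refl p q)) (∣-p∣≡∣p∣ (p - q))

  dist-neg≤ : ∀ p q {ε} → ∣ p - q ∣ ≤ ε → ∣ - p - - q ∣ ≤ ε
  dist-neg≤ p q {ε} h = subst (_≤ ε) (≡.sym (dist-neg p q)) h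

  dist-* : ∀ {p q r s B C δ} → 0ℚ ≤ δ → ∣ p ∣ ≤ B → ∣ s ∣ ≤ C → ∣ p - q ∣ ≤ δ → ∣ r - s ∣ ≤ δ →
           ∣ p * r - q * s ∣ ≤ (B + C) * δ
  dist-* {p} {q} {r} {s} {B} {C} {δ} 0≤δ hB hC h₁ h₂ =
    subst₂ _≤_
      (cong ∣_∣ (solve 4 (λ p q r s → p :* (r :- s) :+ s :* (p :- q) := p :* r :- q :* s) refl p q r s))
      (≡.sym (*-distribʳ-+ δ B C))
      (≤-trans (∣p+q∣≤∣p∣+∣q∣ (p * (r - s)) (s * (p - q)))
        (+-mono-≤
          (subst (_≤ B * δ) (≡.sym (∣p*q∣≡∣p∣*∣q∣ p (r - s))) (*-mono (0≤∣p∣ p) 0≤δ hB h₂))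
          (subst (_≤ C * δ) (≡.sym (∣p*q∣≡∣p∣*∣q∣ s (p - q))) (*-mono (0≤∣p∣ s) 0≤δ hC h₁))))

  dist-∣∣ : ∀ p q → ∣ ∣ p ∣ - ∣ q ∣ ∣ ≤ ∣ p - q ∣
  dist-∣∣ p q = ∣p∣≤ (half p q) (subst₂ _≤_ (solve 2 (λ p q → q :- p := :- (p :- q)) refl ∣ p ∣ ∣ q ∣) (dist-sym q p) (half q p))
    where
    half : ∀ p q → ∣ p ∣ - ∣ q ∣ ≤ ∣ p - q ∣
    half p q = subst (∣ p ∣ - ∣ q ∣ ≤_) (solve 2 (λ a b → (a :+ b) :- b := a) refl ∣ p - q ∣ ∣ q ∣)
      (+-monoˡ-≤ (- ∣ q ∣) (subst (λ z → ∣ z ∣ ≤ ∣ p - q ∣ + ∣ q ∣)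
        (solve 2 (λ p q → (p :- q) :+ q := p) refl p q) (∣p+q∣≤∣p∣+∣q∣ (p - q) q)))

  q≤p+q : ∀ {p} q → 0ℚ ≤ p → q ≤ p + q
  q≤p+q {p} q 0≤p = subst (_≤ p + q) (+-identityˡ q) (+-monoˡ-≤ q 0≤p)

  ∣p∣≤∣q∣+r : ∀ p q {r} → ∣ p - q ∣ ≤ r → ∣ p ∣ ≤ ∣ q ∣ + r
  ∣p∣≤∣q∣+r p q {r} h = ≤-trans
    (subst (λ z → ∣ z ∣ ≤ ∣ q ∣ + ∣ p - q ∣) (solve 2 (λ p q → q :+ (p :- q) := p) refl p q) (∣p+q∣≤∣p∣+∣q∣ q (p - q)))
    (+-monoʳ-≤ ∣ q ∣ h)

  recip : ∀ p → 0ℚ < p → ℚ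
  recip p 0<p = (1/ p) {{pos⇒nonZero p {{positive 0<p}}}}

  recip-pos : ∀ {p} (0<p : 0ℚ < p) → 0ℚ < recip p 0<p
  recip-pos {p} 0<p = positive⁻¹ (recip p 0<p) {{1/pos⇒pos p {{positive 0<p}}}}

  recip-inverse : ∀ {p} (0<p : 0ℚ < p) → p * recip p 0<p ≡ 1ℚ
  recip-inverse {p} 0<p = *-inverseʳ p {{pos⇒nonZero p {{positive 0<p}}}}

  shrink : ∀ {ε B} → 0ℚ < ε → 0ℚ < B → ∃ λ δ → 0ℚ < δ × B * δ ≡ ε
  shrink {ε} {B} 0<ε 0<B = recip B 0<B * ε , *-pos (recip-pos 0<B) 0<ε ,
    ≡.trans (≡.sym (*-assoc B (recip B 0<B) ε)) (≡.trans (cong (_* ε) (recip-inverse 0<B)) (*-identityˡ ε))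

  -- A total reciprocal, equal to 0 outside the positive rationals.
  invℚ : ℚ → ℚ
  invℚ p with 0ℚ <? p
  ... | yes 0<p = recip p 0<p
  ... | no  _   = 0ℚ

  invℚ-inverse : ∀ {p} → 0ℚ < p → p * invℚ p ≡ 1ℚ
  invℚ-inverse {p} 0<p with 0ℚ <? p
  ... | yes h = recip-inverse h
  ... | no ¬h = contradiction 0<p ¬h

  invℚ-pos : ∀ {p} → 0ℚ < p → 0ℚ < invℚ p
  invℚ-pos {p} 0<p with 0ℚ <? p
  ... | yes h = recip-pos h
  ... | no ¬h = contradiction 0<p ¬h

  invℚ-antimono : ∀ {p q} → 0ℚ < p → p ≤ q → invℚ q ≤ invℚ p
  invℚ-antimono {p} {q} 0<p p≤q =
    subst₂ _≤_
      (≡.trans (cong (_* invℚ q) (≡.trans (*-comm (invℚ p) p) (invℚ-inverse 0<p))) (*-identityˡ _))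
      (≡.trans (*-assoc (invℚ p) q (invℚ q)) (≡.trans (cong (invℚ p *_) (invℚ-inverse 0<q)) (*-identityʳ _)))
      (*-monoʳ (<⇒≤ (invℚ-pos 0<q)) (*-monoˡ (<⇒≤ (invℚ-pos 0<p)) p≤q))
    where
    0<q : 0ℚ < q
    0<q = <-≤-trans 0<p p≤q

  invℚ-diff : ∀ {p q} → 0ℚ < p → 0ℚ < q → invℚ p - invℚ q ≡ (invℚ p * invℚ q) * (q - p)
  invℚ-diff {p} {q} 0<p 0<q = ≡.trans
    (cong₂ (λ x y → x - y)
      (≡.sym (≡.trans (cong (invℚ p *_) (invℚ-inverse 0<q)) (*-identityʳ (invℚ p))))
      (≡.sym (≡.trans (cong (_* invℚ q) (invℚ-inverse 0<p)) (*-identityˡ (invℚ q)))))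
    (solve 4 (λ p q i j → i :* (q :* j) :- p :* i :* j := (i :* j) :* (q :- p)) refl p q (invℚ p) (invℚ q))

  dist-invℚ : ∀ {p q η δ} → 0ℚ < η → 0ℚ ≤ δ → η ≤ p → η ≤ q → ∣ p - q ∣ ≤ δ →
              ∣ invℚ p - invℚ q ∣ ≤ (invℚ η * invℚ η) * δ
  dist-invℚ {p} {q} {η} {δ} 0<η 0≤δ η≤p η≤q d = subst (_≤ (invℚ η * invℚ η) * δ) (≡.sym eq)
    (*-mono (*-nonNeg (nn p η≤p) (nn q η≤q)) 0≤δ
      (*-mono (nn p η≤p) (<⇒≤ (invℚ-pos 0<η)) (invℚ-antimono 0<η η≤p) (invℚ-antimono 0<η η≤q)) d)
    where
    nn : ∀ p → η ≤ p → 0ℚ ≤ invℚ p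
    nn p h = <⇒≤ (invℚ-pos (<-≤-trans 0<η h))
    eq : ∣ invℚ p - invℚ q ∣ ≡ (invℚ p * invℚ q) * ∣ p - q ∣
    eq = ≡.trans (cong ∣_∣ (invℚ-diff (<-≤-trans 0<η η≤p) (<-≤-trans 0<η η≤q)))
      (≡.trans (∣p*q∣≡∣p∣*∣q∣ (invℚ p * invℚ q) (q - p))
        (cong₂ _*_ (0≤p⇒∣p∣≡p (*-nonNeg (nn p η≤p) (nn q η≤q))) (dist-sym q p)))

  p≤q⇒p≤q+r : ∀ {p q r} → 0ℚ ≤ r → p ≤ q → p ≤ q + r
  p≤q⇒p≤q+r {p} {q} {r} 0≤r h = subst (_≤ q + r) (+-identityʳ p) (+-mono-≤ h 0≤r)

  dist⇒≤ : ∀ p q {ε} → ∣ p - q ∣ ≤ ε → p ≤ q + ε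
  dist⇒≤ p q {ε} h = subst (_≤ q + ε) (solve 2 (λ p q → q :+ (p :- q) := p) refl p q)
    (+-monoʳ-≤ q (≤-trans (p≤∣p∣ (p - q)) h))

  ≤⇒dist : ∀ p q {ε} → p ≤ q + ε → q ≤ p + ε → ∣ p - q ∣ ≤ ε
  ≤⇒dist p q {ε} h k = ∣p∣≤
    (subst (p - q ≤_) (solve 2 (λ q ε → (q :+ ε) :- q := ε) refl q ε) (+-monoˡ-≤ (- q) h))
    (subst₂ _≤_ (solve 2 (λ p q → q :- p := :- (p :- q)) refl p q)
      (solve 2 (λ q ε → (q :+ ε) :- q := ε) refl p ε) (+-monoˡ-≤ (- p) k))

  ≤-halves : ∀ {p q r ε} → p ≤ q + ½ * ε → q ≤ r + ½ * ε → p ≤ r + ε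
  ≤-halves {p} {q} {r} {ε} h k = ≤-trans h
    (subst (q + ½ * ε ≤_) (≡.trans (+-assoc r (½ * ε) (½ * ε)) (cong (r +_) (half+half ε))) (+-monoˡ-≤ (½ * ε) k))

  ≤-halves-+ : ∀ {p q r s ε} → p ≤ q + ½ * ε → r ≤ s + ½ * ε → p + r ≤ (q + s) + ε
  ≤-halves-+ {p} {q} {r} {s} {ε} h k = subst (p + r ≤_)
    (solve 3 (λ q s ε → (q :+ con ½ :* ε) :+ (s :+ con ½ :* ε) := (q :+ s) :+ ε) refl q s ε) (+-mono-≤ h k)

  *-≤-+ : ∀ {p q r B δ} → 0ℚ ≤ r → r ≤ B → 0ℚ ≤ δ → p ≤ q + δ → r * p ≤ r * q + B * δ
  *-≤-+ {p} {q} {r} {B} {δ} 0≤r r≤B 0≤δ h = ≤-trans (*-monoˡ 0≤r h)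
    (subst (_≤ r * q + B * δ) (≡.sym (*-distribˡ-+ r q δ)) (+-monoʳ-≤ (r * q) (*-monoʳ 0≤δ r≤B)))

  ≤-closure : ∀ {p q} → (∀ ε → 0ℚ < ε → p ≤ q + ε) → p ≤ q
  ≤-closure {p} {q} h with p ≤? q
  ... | yes p≤q = p≤q
  ... | no  p≰q = contradiction (<-≤-trans lt (h (½ * (p - q)) (half-pos 0<d))) (<-irrefl refl)
    where
    0<d : 0ℚ < p - q
    0<d = subst (_< p - q) (+-inverseʳ q) (+-monoˡ-< (- q) (≰⇒> p≰q))
    lt : q + ½ * (p - q) < p
    lt = subst₂ _<_ (+-identityʳ (q + ½ * (p - q)))
      (solve 2 (λ p q → (q :+ con ½ :* (p :- q)) :+ con ½ :* (p :- q) := p) refl p q)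
      (+-monoʳ-< (q + ½ * (p - q)) (half-pos 0<d))

  between-rational : ∀ a b k u → 0ℚ ≤ k * u → k * u ≤ 1ℚ →
    ∣ a - (a + k * (u * (b - a))) ∣ + ∣ (a + k * (u * (b - a))) - b ∣ ≤ ∣ a - b ∣
  between-rational a b k u 0≤s s≤1 = ≤-reflexive (≡.trans (cong₂ _+_
      (≡.trans (cong ∣_∣ (solve 4 (λ a b k u → a :- (a :+ k :* (u :* (b :- a))) := (k :* u) :* (a :- b)) refl a b k u))
        (≡.trans (∣p*q∣≡∣p∣*∣q∣ (k * u) (a - b)) (cong (_* ∣ a - b ∣) (0≤p⇒∣p∣≡p 0≤s))))
      (≡.trans (cong ∣_∣ (solve 4 (λ a b k u → (a :+ k :* (u :* (b :- a))) :- b := (con 1ℚ :- k :* u) :* (a :- b)) refl a b k u))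
        (≡.trans (∣p*q∣≡∣p∣*∣q∣ (1ℚ - k * u) (a - b)) (cong (_* ∣ a - b ∣) (0≤p⇒∣p∣≡p (diff-nonNeg s≤1))))))
    (solve 2 (λ s d → s :* d :+ (con 1ℚ :- s) :* d := d) refl (k * u) ∣ a - b ∣))

  unique-inverse : ∀ {p u v w} → u * p ≡ 1ℚ → (u * v) * w ≡ 1ℚ → p ≡ v * w
  unique-inverse {p} {u} {v} {w} h k = ≡.trans (≡.sym (*-identityʳ p)) (≡.trans (cong (p *_) (≡.sym k))
    (≡.trans (solve 4 (λ p u v w → p :* (u :* v :* w) := (u :* p) :* (v :* w)) refl p u v w)
      (≡.trans (cong (_* (v * w)) h) (*-identityˡ (v * w)))))

  square-nonNeg : ∀ p → 0ℚ ≤ p * p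
  square-nonNeg p with ≤-total 0ℚ p
  ... | inj₁ 0≤p = *-nonNeg 0≤p 0≤p
  ... | inj₂ p≤0 = subst (0ℚ ≤_) (solve 1 (λ p → :- p :* :- p := p :* p) refl p)
                     (*-nonNeg (neg-antimono-≤ p≤0) (neg-antimono-≤ p≤0))

  1≤1+square : ∀ p → 1ℚ ≤ 1ℚ + p * p
  1≤1+square p = p≤q⇒p≤q+r (square-nonNeg p) ≤-refl

  1+square-pos : ∀ p → 0ℚ < 1ℚ + p * p
  1+square-pos p = <-≤-trans 0<1 (1≤1+square p)

  ratio≤1 : ∀ {p q r} → 0ℚ < p → 0ℚ < q → ∣ r ∣ ≤ p * q → ∣ (invℚ p * invℚ q) * r ∣ ≤ 1ℚ
  ratio≤1 {p} {q} {r} 0<p 0<q h = subst₂ _≤_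
    (≡.sym (≡.trans (∣p*q∣≡∣p∣*∣q∣ (invℚ p * invℚ q) r) (cong (_* ∣ r ∣) (0≤p⇒∣p∣≡p 0≤ij))))
    (≡.trans (solve 4 (λ p q i j → i :* j :* (p :* q) := (p :* i) :* (q :* j)) refl p q (invℚ p) (invℚ q))
      (≡.trans (cong₂ _*_ (invℚ-inverse 0<p) (invℚ-inverse 0<q)) (*-identityˡ 1ℚ)))
    (*-monoˡ 0≤ij h)
    where
    0≤ij : 0ℚ ≤ invℚ p * invℚ q
    0≤ij = *-nonNeg (<⇒≤ (invℚ-pos 0<p)) (<⇒≤ (invℚ-pos 0<q))

  ∣p*q∣≤∣q∣ : ∀ {p} q → ∣ p ∣ ≤ 1ℚ → ∣ p * q ∣ ≤ ∣ q ∣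
  ∣p*q∣≤∣q∣ {p} q h = subst₂ _≤_ (≡.sym (∣p*q∣≡∣p∣*∣q∣ p q)) (*-identityˡ ∣ q ∣) (*-monoʳ (0≤∣p∣ q) h)

  kernel-lipschitz : ∀ p q → ∣ invℚ (1ℚ + p * p) - invℚ (1ℚ + q * q) ∣ ≤ ∣ p - q ∣
  kernel-lipschitz p q = subst (λ z → ∣ z ∣ ≤ ∣ p - q ∣) (≡.sym eq)
    (∣p*q∣≤∣q∣ (p - q) (ratio≤1 (1+square-pos p) (1+square-pos q) (∣p∣≤
      (nonNeg-diff (subst (0ℚ ≤_)
        (solve 2 (λ p q → (p :+ con ½) :* (p :+ con ½) :+ (q :+ con ½) :* (q :+ con ½) :+ (p :* q :* (p :* q) :+ con ½)
          := (con 1ℚ :+ p :* p) :* (con 1ℚ :+ q :* q) :- (:- (p :+ q))) refl p q)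
        (+-nonNeg (+-nonNeg (square-nonNeg (p + ½)) (square-nonNeg (q + ½))) (+-nonNeg (square-nonNeg (p * q)) (<⇒≤ 1/2-pos)))))
      (nonNeg-diff (subst (0ℚ ≤_)
        (solve 2 (λ p q → (p :- con ½) :* (p :- con ½) :+ (q :- con ½) :* (q :- con ½) :+ (p :* q :* (p :* q) :+ con ½)
          := (con 1ℚ :+ p :* p) :* (con 1ℚ :+ q :* q) :- (:- :- (p :+ q))) refl p q)
        (+-nonNeg (+-nonNeg (square-nonNeg (p - ½)) (square-nonNeg (q - ½))) (+-nonNeg (square-nonNeg (p * q)) (<⇒≤ 1/2-pos))))))))
    where
    i j : ℚ
    i = invℚ (1ℚ + p * p)
    j = invℚ (1ℚ + q * q)
    eq : i - j ≡ ((i * j) * (- (p + q))) * (p - q)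
    eq = ≡.trans (invℚ-diff (1+square-pos p) (1+square-pos q))
      (solve 4 (λ p q i j → (i :* j) :* ((con 1ℚ :+ q :* q) :- (con 1ℚ :+ p :* p)) := ((i :* j) :* (:- (p :+ q))) :* (p :- q)) refl p q i j)

  kernel-scaled-lipschitz : ∀ p q c →
    ∣ p * invℚ (1ℚ + (c * p) * (c * p)) - q * invℚ (1ℚ + (c * q) * (c * q)) ∣ ≤ ∣ p - q ∣
  kernel-scaled-lipschitz p q c = subst (λ z → ∣ z ∣ ≤ ∣ p - q ∣) (≡.sym eq)
    (∣p*q∣≤∣q∣ (p - q) (ratio≤1 (1+square-pos u) (1+square-pos v) (∣p∣≤
      (nonNeg-diff (subst (0ℚ ≤_)
        (solve 2 (λ u v → (con ½ :* ((u :+ v) :* (u :+ v)) :+ con ½ :* (u :* u)) :+ (con ½ :* (v :* v) :+ u :* v :* (u :* v))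
          := (con 1ℚ :+ u :* u) :* (con 1ℚ :+ v :* v) :- (con 1ℚ :- u :* v)) refl u v)
        (+-nonNeg (+-nonNeg (half (u + v)) (half u)) (+-nonNeg (half v) (square-nonNeg (u * v))))))
      (nonNeg-diff (subst (0ℚ ≤_)
        (solve 2 (λ u v → ((con ½ :* ((u :- v) :* (u :- v)) :+ con ½ :* (u :* u)) :+ (con ½ :* (v :* v) :+ u :* v :* (u :* v))) :+ (con 1ℚ :+ con 1ℚ)
          := (con 1ℚ :+ u :* u) :* (con 1ℚ :+ v :* v) :- (:- (con 1ℚ :- u :* v))) refl u v)
        (+-nonNeg (+-nonNeg (+-nonNeg (half (u - v)) (half u)) (+-nonNeg (half v) (square-nonNeg (u * v)))) (+-nonNeg 0≤1 0≤1)))))))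
    where
    u v i j : ℚ
    u = c * p
    v = c * q
    i = invℚ (1ℚ + u * u)
    j = invℚ (1ℚ + v * v)
    half : ∀ r → 0ℚ ≤ ½ * (r * r)
    half r = *-nonNeg (<⇒≤ 1/2-pos) (square-nonNeg r)
    eq : p * i - q * j ≡ ((i * j) * (1ℚ - u * v)) * (p - q)
    eq = ≡.trans (cong₂ (λ x y → p * x - q * y)
        (≡.sym (≡.trans (cong (i *_) (invℚ-inverse (1+square-pos v))) (*-identityʳ i)))
        (≡.sym (≡.trans (cong (_* j) (invℚ-inverse (1+square-pos u))) (*-identityˡ j))))
      (solve 5 (λ p q c i j →
          p :* (i :* ((con 1ℚ :+ (c :* q) :* (c :* q)) :* j)) :- q :* ((con 1ℚ :+ (c :* p) :* (c :* p)) :* i :* j)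
          := ((i :* j) :* (con 1ℚ :- (c :* p) :* (c :* q))) :* (p :- q)) refl p q c i j)

  kernel-term-lipschitz : ∀ x y k w → 0ℚ ≤ w →
    let h = w * (x - 0ℚ); h′ = w * (y - 0ℚ); z = 0ℚ + k * h; z′ = 0ℚ + k * h′ in
    ∣ h * invℚ (1ℚ + z * z) - h′ * invℚ (1ℚ + z′ * z′) ∣ ≤ w * ∣ x - y ∣
  kernel-term-lipschitz x y k w 0≤w = subst₂ _≤_
    (cong₂ (λ z z′ → ∣ h * invℚ (1ℚ + z * z) - h′ * invℚ (1ℚ + z′ * z′) ∣) (≡.sym (+-identityˡ (k * h))) (≡.sym (+-identityˡ (k * h′))))
    (≡.trans (cong ∣_∣ (solve 3 (λ w x y → w :* (x :- con 0ℚ) :- w :* (y :- con 0ℚ) := w :* (x :- y)) refl w x y))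
      (≡.trans (∣p*q∣≡∣p∣*∣q∣ w (x - y)) (cong (_* ∣ x - y ∣) (0≤p⇒∣p∣≡p 0≤w))))
    (kernel-scaled-lipschitz h h′ k)
    where
    h h′ : ℚ
    h  = w * (x - 0ℚ)
    h′ = w * (y - 0ℚ)

open Rational

Eventually : (ℕ → Set) → Set
Eventually P = ∃ λ N → ∀ n → N ℕ.≤ n → P n

both : ∀ {P Q R : ℕ → Set} → (∀ n → P n → Q n → R n) → Eventually P → Eventually Q → Eventually R
both f (M , p) (N , q) = M ℕ.⊔ N , λ n h →
  f n (p n (ℕₚ.≤-trans (ℕₚ.m≤m⊔n M N) h)) (q n (ℕₚ.≤-trans (ℕₚ.m≤n⊔m M N) h))

always : ∀ {P : ℕ → Set} → (∀ n → P n) → Eventually P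
always p = 0 , λ n _ → p n

later : ∀ {P Q : ℕ → Set} → (∀ n → P n → Q n) → Eventually P → Eventually Q
later f (N , p) = N , λ n h → f n (p n h)

-- A real number is a Cauchy sequence of rationals; equality is _≃_ below.
-- Copatterns and no-eta-equality keep x + y, x * y, ... from unfolding,
-- so that implicit arguments can be inferred from them.

record ℝ : Set where
  no-eta-equality
  field
    seq    : ℕ → ℚ
    cauchy : ∀ ε → 0ℚ ℚ.< ε → ∃ λ N → ∀ m n → N ℕ.≤ m → N ℕ.≤ n → ℚ.∣ seq m ℚ.- seq n ∣ ℚ.≤ ε

open ℝ public

infix 4 _≃_ _≤_ _<_

record _≃_ (x y : ℝ) : Set where
  constructor mk≃
  field get≃ : ∀ ε → 0ℚ ℚ.< ε → Eventually λ n → ℚ.∣ seq x n ℚ.- seq y n ∣ ℚ.≤ ε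

record _≤_ (x y : ℝ) : Set where
  constructor mk≤
  field get≤ : ∀ ε → 0ℚ ℚ.< ε → Eventually λ n → seq x n ℚ.≤ seq y n ℚ.+ ε

record _<_ (x y : ℝ) : Set where
  constructor mk<
  field get< : ∃ λ ε → 0ℚ ℚ.< ε × Eventually λ n → seq x n ℚ.+ ε ℚ.≤ seq y n

open _≃_ public
open _≤_ public
open _<_ public

fromℚ : ℚ → ℝ
seq    (fromℚ q) n = q
cauchy (fromℚ q) ε 0<ε = 0 , λ _ _ _ _ → subst (ℚ._≤ ε) (≡.sym (dist-refl q)) (ℚₚ.<⇒≤ 0<ε)

0ℝ 1ℝ : ℝ
0ℝ = fromℚ 0ℚ
1ℝ = fromℚ 1ℚ

bothCauchy : ∀ {P Q R : ℕ → ℕ → Set} → (∀ m n → P m n → Q m n → R m n) →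
  (∃ λ N → ∀ m n → N ℕ.≤ m → N ℕ.≤ n → P m n) →
  (∃ λ N → ∀ m n → N ℕ.≤ m → N ℕ.≤ n → Q m n) →
  ∃ λ N → ∀ m n → N ℕ.≤ m → N ℕ.≤ n → R m n
bothCauchy f (M , p) (N , q) = M ℕ.⊔ N , λ m n h k →
  f m n (p m n (ℕₚ.≤-trans (ℕₚ.m≤m⊔n M N) h) (ℕₚ.≤-trans (ℕₚ.m≤m⊔n M N) k))
        (q m n (ℕₚ.≤-trans (ℕₚ.m≤n⊔m M N) h) (ℕₚ.≤-trans (ℕₚ.m≤n⊔m M N) k))

bounded : ∀ x → ∃ λ B → 0ℚ ℚ.< B × Eventually λ n → ℚ.∣ seq x n ∣ ℚ.≤ B
bounded x = let N , c = cauchy x 1ℚ 0<1 in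
  ℚ.∣ seq x N ∣ ℚ.+ 1ℚ , ℚₚ.<-≤-trans 0<1 (q≤p+q 1ℚ (ℚₚ.0≤∣p∣ (seq x N))) , N ,
  λ n h → ∣p∣≤∣q∣+r (seq x n) (seq x N) (c n N h ℕₚ.≤-refl)

infix  8 -_ ∣_∣
infixl 7 _*_
infixl 6 _+_ _-_

_+_ : ℝ → ℝ → ℝ
seq    (x + y) n = seq x n ℚ.+ seq y n
cauchy (x + y) ε 0<ε =
  bothCauchy (λ m n → dist-+ {seq x m} {seq x n} {seq y m} {seq y n} {ε})
    (cauchy x (½ ℚ.* ε) (half-pos 0<ε)) (cauchy y (½ ℚ.* ε) (half-pos 0<ε))

-_ : ℝ → ℝ
seq    (- x) n = ℚ.- seq x n
cauchy (- x) ε 0<ε = let N , h = cauchy x ε 0<ε in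
  N , λ m n i j → dist-neg≤ (seq x m) (seq x n) (h m n i j)

_-_ : ℝ → ℝ → ℝ
x - y = x + (- y)

_*_ : ℝ → ℝ → ℝ
seq    (x * y) n = seq x n ℚ.* seq y n
cauchy (x * y) ε 0<ε =
  let B , 0<B , M , b = bounded x
      C , 0<C , N , c = bounded y
      δ , 0<δ , eq    = shrink 0<ε (+-pos 0<B 0<C)
      K , d           = cauchy x δ 0<δ
      L , e           = cauchy y δ 0<δ
  in bothCauchy {P = λ m n → ℚ.∣ seq x m ∣ ℚ.≤ B × ℚ.∣ seq x m ℚ.- seq x n ∣ ℚ.≤ δ}
                {Q = λ m n → ℚ.∣ seq y n ∣ ℚ.≤ C × ℚ.∣ seq y m ℚ.- seq y n ∣ ℚ.≤ δ}
       (λ m n p q → subst (ℚ.∣ seq x m ℚ.* seq y m ℚ.- seq x n ℚ.* seq y n ∣ ℚ.≤_) eq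
         (dist-* {seq x m} {seq x n} {seq y m} {seq y n} (ℚₚ.<⇒≤ 0<δ) (proj₁ p) (proj₁ q) (proj₂ p) (proj₂ q)))
       (bothCauchy (λ m n → _,_) (M , λ m n h k → b m h) (K , d))
       (bothCauchy (λ m n → _,_) (N , λ m n h k → c n k) (L , e))

∣_∣ : ℝ → ℝ
seq    ∣ x ∣ n = ℚ.∣ seq x n ∣
cauchy ∣ x ∣ ε 0<ε = let N , h = cauchy x ε 0<ε in
  N , λ m n i j → ℚₚ.≤-trans (dist-∣∣ (seq x m) (seq x n)) (h m n i j)

inv : ∀ x → 0ℝ < x → ℝ
seq    (inv x _) n = invℚ (seq x n)
cauchy (inv x (mk< (η , 0<η , K , x≥η))) ε 0<ε =
  let δ , 0<δ , eq = shrink 0<ε (*-pos (invℚ-pos 0<η) (invℚ-pos 0<η))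
      N , d        = cauchy x δ 0<δ
  in bothCauchy {P = λ m n → η ℚ.≤ seq x m × η ℚ.≤ seq x n}
       (λ m n p h → subst (ℚ.∣ invℚ (seq x m) ℚ.- invℚ (seq x n) ∣ ℚ.≤_) eq
         (dist-invℚ {seq x m} {seq x n} 0<η (ℚₚ.<⇒≤ 0<δ) (proj₁ p) (proj₂ p) h))
       (K , λ m n h k → low m h , low n k) (N , d)
  where
  low : ∀ n → K ℕ.≤ n → η ℚ.≤ seq x n
  low n h = subst (ℚ._≤ seq x n) (ℚₚ.+-identityˡ η) (x≥η n h)

≃-pointwise : ∀ {x y} → (∀ n → seq x n ≡ seq y n) → x ≃ y
≃-pointwise {x} {y} h = mk≃ λ ε 0<ε → always λ n →
  subst (ℚ._≤ ε) (≡.sym (≡.trans (cong (λ p → ℚ.∣ p ℚ.- seq y n ∣) (h n)) (dist-refl (seq y n)))) (ℚₚ.<⇒≤ 0<ε)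

≃-refl : ∀ {x} → x ≃ x
≃-refl = ≃-pointwise λ n → refl

≃-sym : ∀ {x y} → x ≃ y → y ≃ x
≃-sym {x} {y} h = mk≃ λ ε 0<ε → later (λ n → subst (ℚ._≤ ε) (dist-sym (seq x n) (seq y n))) (get≃ h ε 0<ε)

≃-trans : ∀ {x y z} → x ≃ y → y ≃ z → x ≃ z
≃-trans {x} {y} {z} h k = mk≃ λ ε 0<ε → both (λ n → dist-halves {seq x n} {seq y n} {seq z n} {ε})
  (get≃ h (½ ℚ.* ε) (half-pos 0<ε)) (get≃ k (½ ℚ.* ε) (half-pos 0<ε))

+-cong : ∀ {x y u v} → x ≃ y → u ≃ v → x + u ≃ y + v
+-cong {x} {y} {u} {v} h k = mk≃ λ ε 0<ε → both (λ n → dist-+ {seq x n} {seq y n} {seq u n} {seq v n} {ε})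
  (get≃ h (½ ℚ.* ε) (half-pos 0<ε)) (get≃ k (½ ℚ.* ε) (half-pos 0<ε))

-‿cong : ∀ {x y} → x ≃ y → - x ≃ - y
-‿cong {x} {y} h = mk≃ λ ε 0<ε → later (λ n → dist-neg≤ (seq x n) (seq y n)) (get≃ h ε 0<ε)

*-cong : ∀ {x y u v} → x ≃ y → u ≃ v → x * u ≃ y * v
*-cong {x} {y} {u} {v} h k = mk≃ λ ε 0<ε →
  let B , 0<B , b = bounded x
      C , 0<C , c = bounded v
      δ , 0<δ , eq = shrink 0<ε (+-pos 0<B 0<C)
  in both {P = λ n → ℚ.∣ seq x n ∣ ℚ.≤ B × ℚ.∣ seq x n ℚ.- seq y n ∣ ℚ.≤ δ}
          {Q = λ n → ℚ.∣ seq v n ∣ ℚ.≤ C × ℚ.∣ seq u n ℚ.- seq v n ∣ ℚ.≤ δ}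
       (λ n p q → subst (ℚ.∣ seq x n ℚ.* seq u n ℚ.- seq y n ℚ.* seq v n ∣ ℚ.≤_) eq
         (dist-* {seq x n} {seq y n} {seq u n} {seq v n} (ℚₚ.<⇒≤ 0<δ) (proj₁ p) (proj₁ q) (proj₂ p) (proj₂ q)))
       (both (λ n → _,_) b (get≃ h δ 0<δ)) (both (λ n → _,_) c (get≃ k δ 0<δ))

∣∣-cong : ∀ {x y} → x ≃ y → ∣ x ∣ ≃ ∣ y ∣
∣∣-cong {x} {y} h = mk≃ λ ε 0<ε → later (λ n → ℚₚ.≤-trans (dist-∣∣ (seq x n) (seq y n))) (get≃ h ε 0<ε)

ℝ-commutativeRing : CommutativeRing 0ℓ 0ℓ
ℝ-commutativeRing = record
  { Carrier = ℝ ; _≈_ = _≃_ ; _+_ = _+_ ; _*_ = _*_ ; -_ = -_ ; 0# = 0ℝ ; 1# = 1ℝ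
  ; isCommutativeRing = record
    { isRing = record
      { +-isAbelianGroup = record
        { isGroup = record
          { isMonoid = record
            { isSemigroup = record
              { isMagma = record
                { isEquivalence = record { refl = ≃-refl ; sym = ≃-sym ; trans = ≃-trans }
                ; ∙-cong = +-cong }
              ; assoc = λ x y z → ≃-pointwise λ n → ℚₚ.+-assoc (seq x n) (seq y n) (seq z n) }
            ; identity = (λ x → ≃-pointwise λ n → ℚₚ.+-identityˡ (seq x n))
                       , (λ x → ≃-pointwise λ n → ℚₚ.+-identityʳ (seq x n)) }
          ; inverse = (λ x → ≃-pointwise λ n → ℚₚ.+-inverseˡ (seq x n))
                    , (λ x → ≃-pointwise λ n → ℚₚ.+-inverseʳ (seq x n))
          ; ⁻¹-cong = -‿cong }
        ; comm = λ x y → ≃-pointwise λ n → ℚₚ.+-comm (seq x n) (seq y n) }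
      ; *-cong = *-cong
      ; *-assoc = λ x y z → ≃-pointwise λ n → ℚₚ.*-assoc (seq x n) (seq y n) (seq z n)
      ; *-identity = (λ x → ≃-pointwise λ n → ℚₚ.*-identityˡ (seq x n))
                   , (λ x → ≃-pointwise λ n → ℚₚ.*-identityʳ (seq x n))
      ; distrib = (λ x y z → ≃-pointwise λ n → ℚₚ.*-distribˡ-+ (seq x n) (seq y n) (seq z n))
                , (λ x y z → ≃-pointwise λ n → ℚₚ.*-distribʳ-+ (seq x n) (seq y n) (seq z n)) }
    ; *-comm = λ x y → ≃-pointwise λ n → ℚₚ.*-comm (seq x n) (seq y n) } }

open CommutativeRing ℝ-commutativeRing public
  using (+-identityˡ; +-identityʳ; *-identityˡ; *-identityʳ; *-comm; *-assoc; *-congˡ; *-congʳ; +-congˡ; +-congʳ; zeroʳ; distribˡ)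

open RawSemiring (Semiring.rawSemiring (CommutativeRing.semiring ℝ-commutativeRing)) public using (_^_)
open RawSemiring ℚ.+-*-rawSemiring public using () renaming (_^_ to _^ℚ_)

fromℚ-≟ : ∀ p q → Maybe (fromℚ p ≃ fromℚ q)
fromℚ-≟ p q with p ℚₚ.≟ q
... | yes refl = just ≃-refl
... | no  _    = nothing

fromℚ-morphism : ℚ.+-*-rawRing ACR.-Raw-AlmostCommutative⟶ ACR.fromCommutativeRing ℝ-commutativeRing
fromℚ-morphism = record
  { ⟦_⟧ = fromℚ
  ; +-homo = λ p q → ≃-pointwise λ n → refl
  ; *-homo = λ p q → ≃-pointwise λ n → refl
  ; -‿homo = λ p → ≃-pointwise λ n → refl
  ; 0-homo = ≃-refl
  ; 1-homo = ≃-refl }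

module ℝ-Solver = RingSolver ℚ.+-*-rawRing (ACR.fromCommutativeRing ℝ-commutativeRing) fromℚ-morphism fromℚ-≟

≤-pointwise : ∀ {x y} → (∀ n → seq x n ℚ.≤ seq y n) → x ≤ y
≤-pointwise h = mk≤ λ ε 0<ε → always λ n → p≤q⇒p≤q+r (ℚₚ.<⇒≤ 0<ε) (h n)

≤-reflexive : ∀ {x y} → x ≃ y → x ≤ y
≤-reflexive {x} {y} h = mk≤ λ ε 0<ε → later (λ n → dist⇒≤ (seq x n) (seq y n)) (get≃ h ε 0<ε)

≤-refl : ∀ {x} → x ≤ x
≤-refl = ≤-pointwise λ n → ℚₚ.≤-refl

≤-trans : ∀ {x y z} → x ≤ y → y ≤ z → x ≤ z
≤-trans {x} {y} {z} h k = mk≤ λ ε 0<ε → both (λ n → ≤-halves {seq x n} {seq y n} {seq z n} {ε})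
  (get≤ h (½ ℚ.* ε) (half-pos 0<ε)) (get≤ k (½ ℚ.* ε) (half-pos 0<ε))

≤-antisym : ∀ {x y} → x ≤ y → y ≤ x → x ≃ y
≤-antisym {x} {y} h k = mk≃ λ ε 0<ε → both (λ n → ≤⇒dist (seq x n) (seq y n)) (get≤ h ε 0<ε) (get≤ k ε 0<ε)

≤-poset : Poset 0ℓ 0ℓ 0ℓ
≤-poset = record
  { Carrier = ℝ ; _≈_ = _≃_ ; _≤_ = _≤_
  ; isPartialOrder = record
    { isPreorder = record
      { isEquivalence = CommutativeRing.isEquivalence ℝ-commutativeRing
      ; reflexive = ≤-reflexive
      ; trans = ≤-trans }
    ; antisym = ≤-antisym } }

module ≤-Reasoning = PosetReasoning ≤-poset

+-mono-≤ : ∀ {x y u v} → x ≤ y → u ≤ v → x + u ≤ y + v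
+-mono-≤ {x} {y} {u} {v} h k = mk≤ λ ε 0<ε → both (λ n → ≤-halves-+ {seq x n} {seq y n} {seq u n} {seq v n} {ε})
  (get≤ h (½ ℚ.* ε) (half-pos 0<ε)) (get≤ k (½ ℚ.* ε) (half-pos 0<ε))

*-monoˡ-≤ : ∀ {x y z} → (∀ n → 0ℚ ℚ.≤ seq z n) → x ≤ y → z * x ≤ z * y
*-monoˡ-≤ {x} {y} {z} 0≤z h = mk≤ λ ε 0<ε →
  let B , 0<B , b  = bounded z
      δ , 0<δ , eq = shrink 0<ε 0<B
  in both (λ n p q → subst (λ e → seq z n ℚ.* seq x n ℚ.≤ seq z n ℚ.* seq y n ℚ.+ e) eq
           (*-≤-+ {seq x n} {seq y n} (0≤z n) (ℚₚ.≤-trans (p≤∣p∣ (seq z n)) p) (ℚₚ.<⇒≤ 0<δ) q)) b (get≤ h δ 0<δ)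

*-monoʳ-≤ : ∀ {x y z} → (∀ n → 0ℚ ℚ.≤ seq z n) → x ≤ y → x * z ≤ y * z
*-monoʳ-≤ {x} {y} {z} 0≤z h =
  ≤-trans (≤-reflexive (*-comm x z)) (≤-trans (*-monoˡ-≤ 0≤z h) (≤-reflexive (*-comm z y)))

∣∣-nonNeg : ∀ x n → 0ℚ ℚ.≤ seq ∣ x ∣ n
∣∣-nonNeg x n = ℚₚ.0≤∣p∣ (seq x n)

∣x+y∣≤∣x∣+∣y∣ : ∀ x y → ∣ x + y ∣ ≤ ∣ x ∣ + ∣ y ∣
∣x+y∣≤∣x∣+∣y∣ x y = ≤-pointwise λ n → ℚₚ.∣p+q∣≤∣p∣+∣q∣ (seq x n) (seq y n)

∣x*y∣≃∣x∣*∣y∣ : ∀ x y → ∣ x * y ∣ ≃ ∣ x ∣ * ∣ y ∣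
∣x*y∣≃∣x∣*∣y∣ x y = ≃-pointwise λ n → ℚₚ.∣p*q∣≡∣p∣*∣q∣ (seq x n) (seq y n)

∣-x∣≃∣x∣ : ∀ x → ∣ - x ∣ ≃ ∣ x ∣
∣-x∣≃∣x∣ x = ≃-pointwise λ n → ℚₚ.∣-p∣≡∣p∣ (seq x n)

∣x-y∣≃∣y-x∣ : ∀ x y → ∣ x - y ∣ ≃ ∣ y - x ∣
∣x-y∣≃∣y-x∣ x y = ≃-pointwise λ n → dist-sym (seq x n) (seq y n)

∣x-z∣≤∣x-y∣+∣y-z∣ : ∀ x y z → ∣ x - z ∣ ≤ ∣ x - y ∣ + ∣ y - z ∣
∣x-z∣≤∣x-y∣+∣y-z∣ x y z = ≤-pointwise λ n → dist-triangle (seq x n) (seq y n) (seq z n)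

fromℚ-nonNeg : ∀ {q} → 0ℚ ℚ.≤ q → ∀ n → 0ℚ ℚ.≤ seq (fromℚ q) n
fromℚ-nonNeg h n = h

fromℚ-cong : ∀ {p q} → p ≡ q → fromℚ p ≃ fromℚ q
fromℚ-cong refl = ≃-refl

fromℚ-+ : ∀ p q → fromℚ (p ℚ.+ q) ≃ fromℚ p + fromℚ q
fromℚ-+ p q = ≃-pointwise λ n → refl

fromℚ-* : ∀ p q → fromℚ (p ℚ.* q) ≃ fromℚ p * fromℚ q
fromℚ-* p q = ≃-pointwise λ n → refl

fromℚ-mono-≤ : ∀ {p q} → p ℚ.≤ q → fromℚ p ≤ fromℚ q
fromℚ-mono-≤ h = ≤-pointwise λ n → h

fromℚ-cancel-≤ : ∀ {p q} → fromℚ p ≤ fromℚ q → p ℚ.≤ q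
fromℚ-cancel-≤ h = ≤-closure λ ε 0<ε → let N , k = get≤ h ε 0<ε in k N ℕₚ.≤-refl

∣fromℚ∣≃ : ∀ {q} → 0ℚ ℚ.≤ q → ∣ fromℚ q ∣ ≃ fromℚ q
∣fromℚ∣≃ h = ≃-pointwise λ n → ℚₚ.0≤p⇒∣p∣≡p h

∣x∣≤fromℚ : ∀ x → ∃ λ B → 0ℚ ℚ.< B × ∣ x ∣ ≤ fromℚ B
∣x∣≤fromℚ x = let B , 0<B , b = bounded x in
  B , 0<B , mk≤ λ ε 0<ε → later (λ n h → p≤q⇒p≤q+r (ℚₚ.<⇒≤ 0<ε) h) b

≤-closed : ∀ {x y} → (∀ ε → 0ℚ ℚ.< ε → x ≤ y + fromℚ ε) → x ≤ y
≤-closed {x} {y} h = mk≤ λ ε 0<ε → later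
  (λ n k → subst (seq x n ℚ.≤_) (≡.trans (ℚₚ.+-assoc (seq y n) (½ ℚ.* ε) (½ ℚ.* ε)) (cong (seq y n ℚ.+_) (half+half ε))) k)
  (get≤ (h (½ ℚ.* ε) (half-pos 0<ε)) (½ ℚ.* ε) (half-pos 0<ε))

fromℕ : ℕ → ℚ
fromℕ n = ℤ.+ n ℚ./ 1

infixl 7 _/ₙ_

-- Division of a rational by a natural number, with q /ₙ 0 = 0.
_/ₙ_ : ℚ → ℕ → ℚ
q /ₙ zero  = 0ℚ
q /ₙ suc n = q ℚ.* (ℤ.+ 1 ℚ./ suc n)

module NaturalRational where
  open import Data.Integer.Base using (+_)

  toℚᵘ-/ : ∀ i n → ℚ.toℚᵘ (i ℚ./ suc n) ℚᵘ.≃ ℚᵘ.mkℚᵘ i n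
  toℚᵘ-/ i n = ℚₚ.toℚᵘ-fromℚᵘ (ℚᵘ.mkℚᵘ i n)

  fromℕ-+ : ∀ m n → fromℕ (m ℕ.+ n) ≡ fromℕ m ℚ.+ fromℕ n
  fromℕ-+ m n = ℚₚ.toℚᵘ-injective (ℚᵘₚ.≃-trans (toℚᵘ-/ (+ (m ℕ.+ n)) 0)
    (ℚᵘₚ.≃-trans (ℚᵘ.*≡* eq) (ℚᵘₚ.≃-sym (ℚᵘₚ.≃-trans (ℚₚ.toℚᵘ-homo-+ (fromℕ m) (fromℕ n))
      (ℚᵘₚ.+-cong (toℚᵘ-/ (+ m) 0) (toℚᵘ-/ (+ n) 0))))))
    where
    eq : + (m ℕ.+ n) ℤ.* + 1 ≡ (+ m ℤ.* + 1 ℤ.+ + n ℤ.* + 1) ℤ.* + 1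
    eq = cong (ℤ._* + 1) (≡.sym (cong₂ ℤ._+_ (ℤₚ.*-identityʳ (+ m)) (ℤₚ.*-identityʳ (+ n))))

  fromℕ-* : ∀ m n → fromℕ (m ℕ.* n) ≡ fromℕ m ℚ.* fromℕ n
  fromℕ-* m n = ℚₚ.toℚᵘ-injective (ℚᵘₚ.≃-trans (toℚᵘ-/ (+ (m ℕ.* n)) 0)
    (ℚᵘₚ.≃-trans (ℚᵘ.*≡* (cong (ℤ._* + 1) (ℤₚ.pos-* m n)))
      (ℚᵘₚ.≃-sym (ℚᵘₚ.≃-trans (ℚₚ.toℚᵘ-homo-* (fromℕ m) (fromℕ n))
        (ℚᵘₚ.*-cong (toℚᵘ-/ (+ m) 0) (toℚᵘ-/ (+ n) 0))))))

  fromℕ-suc : ∀ n → fromℕ (suc n) ≡ 1ℚ ℚ.+ fromℕ n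
  fromℕ-suc n = fromℕ-+ 1 n

  1/suc : ℕ → ℚ
  1/suc n = + 1 ℚ./ suc n

  1/suc-inverse : ∀ n → fromℕ (suc n) ℚ.* 1/suc n ≡ 1ℚ
  1/suc-inverse n = ℚₚ.toℚᵘ-injective (ℚᵘₚ.≃-trans (ℚₚ.toℚᵘ-homo-* (fromℕ (suc n)) (1/suc n))
    (ℚᵘₚ.≃-trans (ℚᵘₚ.*-cong (toℚᵘ-/ (+ suc n) 0) (toℚᵘ-/ (+ 1) n)) (ℚᵘ.*≡* eq)))
    where
    eq : (+ suc n ℤ.* + 1) ℤ.* + 1 ≡ + 1 ℤ.* + suc (n ℕ.+ 0)
    eq = ≡.trans (ℤₚ.*-identityʳ _) (≡.trans (ℤₚ.*-identityʳ _)
      (≡.trans (cong (λ k → + suc k) (≡.sym (ℕₚ.+-identityʳ n))) (≡.sym (ℤₚ.*-identityˡ _))))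

  fromℕ-nonNeg : ∀ n → 0ℚ ℚ.≤ fromℕ n
  fromℕ-nonNeg n = ℚₚ.nonNegative⁻¹ (fromℕ n) {{ℚₚ.normalize-nonNeg n 1}}

  1/suc-pos : ∀ n → 0ℚ ℚ.< 1/suc n
  1/suc-pos n = ℚₚ.positive⁻¹ (1/suc n) {{ℚₚ.normalize-pos 1 (suc n)}}

  fromℕ-mono : ∀ {m n} → m ℕ.≤ n → fromℕ m ℚ.≤ fromℕ n
  fromℕ-mono {m} {n} h = subst (fromℕ m ℚ.≤_)
    (≡.trans (≡.sym (fromℕ-+ m (n ℕ.∸ m))) (cong fromℕ (ℕₚ.m+[n∸m]≡n h)))
    (p≤q⇒p≤q+r (fromℕ-nonNeg (n ℕ.∸ m)) ℚₚ.≤-refl)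

  1/suc-antimono : ∀ {m n} → m ℕ.≤ n → 1/suc n ℚ.≤ 1/suc m
  1/suc-antimono {m} {n} h = subst₂ ℚ._≤_ e₁ e₂
    (*-monoʳ (ℚₚ.<⇒≤ (*-pos (1/suc-pos m) (1/suc-pos n))) (fromℕ-mono (ℕ.s≤s h)))
    where
    open +-*-Solver
    e₁ : fromℕ (suc m) ℚ.* (1/suc m ℚ.* 1/suc n) ≡ 1/suc n
    e₁ = ≡.trans (≡.sym (ℚₚ.*-assoc (fromℕ (suc m)) (1/suc m) (1/suc n)))
      (≡.trans (cong (ℚ._* 1/suc n) (1/suc-inverse m)) (ℚₚ.*-identityˡ (1/suc n)))
    e₂ : fromℕ (suc n) ℚ.* (1/suc m ℚ.* 1/suc n) ≡ 1/suc m
    e₂ = ≡.trans (solve 3 (λ a b c → a :* (b :* c) := b :* (a :* c)) refl (fromℕ (suc n)) (1/suc m) (1/suc n))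
      (≡.trans (cong (1/suc m ℚ.*_) (1/suc-inverse n)) (ℚₚ.*-identityʳ (1/suc m)))

  archimedean : ∀ ε → 0ℚ ℚ.< ε → ∃ λ N → ∀ n → N ℕ.≤ n → 1/suc n ℚ.≤ ε
  archimedean ε@(ℚ.mkℚ ℤ.+[1+ a ] d _) 0<ε = d , λ n h → ℚₚ.toℚᵘ-cancel-≤
    (ℚᵘₚ.≤-respˡ-≃ (ℚᵘₚ.≃-sym (toℚᵘ-/ (+ 1) n)) (ℚᵘ.*≤* (subst₂ ℤ._≤_ (ℤₚ.pos-* 1 (suc d)) (ℤₚ.pos-* (suc a) (suc n))
      (ℤ.+≤+ (subst (ℕ._≤ suc a ℕ.* suc n) (≡.sym (ℕₚ.*-identityˡ (suc d)))
        (ℕₚ.≤-trans (ℕ.s≤s h) (ℕₚ.m≤m+n (suc n) (a ℕ.* suc n))))))))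
  archimedean (ℚ.mkℚ ℤ.+0 _ _) (ℚ.*<* (ℤ.+<+ ()))
  archimedean (ℚ.mkℚ ℤ.-[1+ _ ] _ _) (ℚ.*<* ())

open NaturalRational

sumBelow : ∀ {A : Set} → (A → A → A) → A → ℕ → (ℕ → A) → A
sumBelow _∙_ ε n f = foldr _∙_ ε (applyUpTo f n)

sumFromTo : ∀ {A : Set} → (A → A → A) → A → ℕ → ℕ → (ℕ → A) → A
sumFromTo _∙_ ε lo hi f = sumBelow _∙_ ε (suc hi ℕ.∸ lo) (λ i → f (lo ℕ.+ i))

infix 5 Σ[_⋯_]_ Σℚ[_⋯_]_

-- Σ[ lo ⋯ hi ] f is the sum of f j over lo ≤ j ≤ hi.
Σ[_⋯_]_ : ℕ → ℕ → (ℕ → ℝ) → ℝ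
Σ[ lo ⋯ hi ] f = sumFromTo _+_ 0ℝ lo hi f

Σℚ[_⋯_]_ : ℕ → ℕ → (ℕ → ℚ) → ℚ
Σℚ[ lo ⋯ hi ] f = sumFromTo ℚ._+_ 0ℚ lo hi f

Σ< : ℕ → (ℕ → ℝ) → ℝ
Σ< = sumBelow _+_ 0ℝ

module SumProperties where
  open ℝ-Solver

  Σ<-cong : ∀ n {f g} → (∀ k → f k ≃ g k) → Σ< n f ≃ Σ< n g
  Σ<-cong zero    h = ≃-refl
  Σ<-cong (suc n) h = +-cong (h 0) (Σ<-cong n λ k → h (suc k))

  Σ<-const : ∀ n x → Σ< n (λ _ → x) ≃ fromℚ (fromℕ n) * x
  Σ<-const zero    x = solve 1 (λ x → con 0ℚ := con 0ℚ :* x) ≃-refl x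
  Σ<-const (suc n) x = ≃-trans (+-congˡ (Σ<-const n x)) (≃-trans
    (solve 2 (λ n x → x :+ n :* x := (con 1ℚ :+ n) :* x) ≃-refl (fromℚ (fromℕ n)) x)
    (*-congʳ (≃-trans (≃-sym (fromℚ-+ 1ℚ (fromℕ n))) (fromℚ-cong (≡.sym (fromℕ-suc n))))))

  Σ<-*ˡ : ∀ n c f → c * Σ< n f ≃ Σ< n (λ k → c * f k)
  Σ<-*ˡ zero    c f = zeroʳ c
  Σ<-*ˡ (suc n) c f = ≃-trans (distribˡ c (f 0) (Σ< n (λ k → f (suc k)))) (+-congˡ (Σ<-*ˡ n c λ k → f (suc k)))

  Σ<-- : ∀ n f g → Σ< n f - Σ< n g ≃ Σ< n (λ k → f k - g k)
  Σ<-- zero    f g = solve 0 (con 0ℚ :- con 0ℚ := con 0ℚ) ≃-refl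
  Σ<-- (suc n) f g = ≃-trans
    (solve 4 (λ a b c d → (a :+ b) :- (c :+ d) := (a :- c) :+ (b :- d)) ≃-refl (f 0) (Σ< n λ k → f (suc k)) (g 0) (Σ< n λ k → g (suc k)))
    (+-congˡ (Σ<-- n (λ k → f (suc k)) (λ k → g (suc k))))

  Σ<-split : ∀ m n f → Σ< (m ℕ.+ n) f ≃ Σ< m f + Σ< n (λ k → f (m ℕ.+ k))
  Σ<-split zero    n f = ≃-sym (+-identityˡ (Σ< n f))
  Σ<-split (suc m) n f = ≃-trans (+-congˡ (Σ<-split m n λ k → f (suc k)))
    (solve 3 (λ a b c → a :+ (b :+ c) := (a :+ b) :+ c) ≃-refl (f 0) (Σ< m λ k → f (suc k)) (Σ< n λ k → f (suc m ℕ.+ k)))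

  Σ<-blocks : ∀ n m f → Σ< (n ℕ.* m) f ≃ Σ< n (λ k → Σ< m (λ j → f (k ℕ.* m ℕ.+ j)))
  Σ<-blocks zero    m f = ≃-refl
  Σ<-blocks (suc n) m f = ≃-trans (Σ<-split m (n ℕ.* m) f) (+-congˡ
    (≃-trans (Σ<-blocks n m λ k → f (m ℕ.+ k)) (Σ<-cong n λ k → Σ<-cong m λ j → reindex k j)))
    where
    reindex : ∀ k j → f (m ℕ.+ (k ℕ.* m ℕ.+ j)) ≃ f (suc k ℕ.* m ℕ.+ j)
    reindex k j rewrite ℕₚ.+-assoc m (k ℕ.* m) j = ≃-refl

  ∣Σ<∣≤ : ∀ n f c → (∀ k → k ℕ.< n → ∣ f k ∣ ≤ c) → ∣ Σ< n f ∣ ≤ fromℚ (fromℕ n) * c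
  ∣Σ<∣≤ n f c h = ≤-trans (go n f h) (≤-reflexive (Σ<-const n c))
    where
    go : ∀ n f → (∀ k → k ℕ.< n → ∣ f k ∣ ≤ c) → ∣ Σ< n f ∣ ≤ Σ< n (λ _ → c)
    go zero    f h = ≤-reflexive (∣fromℚ∣≃ ℚₚ.≤-refl)
    go (suc n) f h = ≤-trans (∣x+y∣≤∣x∣+∣y∣ (f 0) (Σ< n λ k → f (suc k)))
      (+-mono-≤ (h 0 (ℕ.s≤s ℕ.z≤n)) (go n (λ k → f (suc k)) λ k k<n → h (suc k) (ℕ.s≤s k<n)))

open SumProperties

IsCauchy : (ℕ → ℝ) → Set
IsCauchy s = ∀ ε → 0ℚ ℚ.< ε → ∃ λ N → ∀ m n → N ℕ.≤ m → N ℕ.≤ n → ∣ s m - s n ∣ ≤ fromℚ ε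

approximant : ∀ x ε → 0ℚ ℚ.< ε → ∃ λ q → ∣ fromℚ q - x ∣ ≤ fromℚ ε
approximant x ε 0<ε = let N , c = cauchy x ε 0<ε in
  seq x N , mk≤ λ η 0<η → N , λ n h → p≤q⇒p≤q+r (ℚₚ.<⇒≤ 0<η) (c N n ℕₚ.≤-refl h)

seq-approximates : ∀ x ε → 0ℚ ℚ.< ε → Eventually λ k → ∣ x - fromℚ (seq x k) ∣ ≤ fromℚ ε
seq-approximates x ε 0<ε = let N , c = cauchy x ε 0<ε in
  N , λ k h → mk≤ λ η 0<η → N , λ n i → p≤q⇒p≤q+r (ℚₚ.<⇒≤ 0<η) (c n k i h)

∣∣-halves : ∀ {x y z ε} → ∣ x - y ∣ ≤ fromℚ (½ ℚ.* ε) → ∣ y - z ∣ ≤ fromℚ (½ ℚ.* ε) → ∣ x - z ∣ ≤ fromℚ ε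
∣∣-halves {x} {y} {z} {ε} h k = ≤-trans (∣x-z∣≤∣x-y∣+∣y-z∣ x y z) (≤-trans (+-mono-≤ h k)
  (≤-reflexive (≃-trans (≃-sym (fromℚ-+ (½ ℚ.* ε) (½ ℚ.* ε))) (fromℚ-cong (half+half ε)))))

diagonal : (ℕ → ℝ) → ℕ → ℚ
diagonal s n = proj₁ (approximant (s n) (1/suc n) (1/suc-pos n))

diagonal-close : ∀ s ε → 0ℚ ℚ.< ε → Eventually λ n → ∣ fromℚ (diagonal s n) - s n ∣ ≤ fromℚ ε
diagonal-close s ε 0<ε = let N , a = archimedean ε 0<ε in
  N , λ n h → ≤-trans (proj₂ (approximant (s n) (1/suc n) (1/suc-pos n))) (fromℚ-mono-≤ (a n h))

diagonal-close₂ : ∀ s → IsCauchy s → ∀ ε → 0ℚ ℚ.< ε →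
  ∃ λ N → ∀ m n → N ℕ.≤ m → N ℕ.≤ n → ∣ fromℚ (diagonal s m) - s n ∣ ≤ fromℚ ε
diagonal-close₂ s c ε 0<ε = let M , d = diagonal-close s (½ ℚ.* ε) (half-pos 0<ε) in
  bothCauchy (λ m n → ∣∣-halves) (M , λ m n h k → d m h) (c (½ ℚ.* ε) (half-pos 0<ε))

lim : ∀ s → IsCauchy s → ℝ
seq    (lim s c) = diagonal s
cauchy (lim s c) ε 0<ε =
  let N , d = diagonal-close₂ s c (½ ℚ.* ε) (half-pos 0<ε) in
  N , λ m n h k → fromℚ-cancel-≤ (≤-trans
    (≤-reflexive (≃-pointwise λ _ → refl))
    (∣∣-halves {fromℚ (diagonal s m)} {s n} {fromℚ (diagonal s n)} (d m n h k)
      (≤-trans (≤-reflexive (∣x-y∣≃∣y-x∣ (s n) (fromℚ (diagonal s n)))) (d n n k k))))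

lim-converges : ∀ s c ε → 0ℚ ℚ.< ε → Eventually λ n → ∣ lim s c - s n ∣ ≤ fromℚ ε
lim-converges s c ε 0<ε =
  let N , d = diagonal-close₂ s c (½ ℚ.* ε) (half-pos 0<ε)
      K , e = seq-approximates (lim s c) (½ ℚ.* ε) (half-pos 0<ε)
      k = N ℕ.⊔ K
  in N , λ n h → ∣∣-halves {y = fromℚ (diagonal s k)} (e k (ℕₚ.m≤n⊔m N K)) (d k n (ℕₚ.m≤m⊔n N K) h)

-- Between a x b says that x lies between a and b: on the line, this is
-- equality in the triangle inequality.  It makes sense for a ≤ b and for b ≤ a.
Between : ℝ → ℝ → ℝ → Set
Between a x b = ∣ a - x ∣ + ∣ x - b ∣ ≤ ∣ a - b ∣

UniformlyContinuous : ℝ → ℝ → (ℝ → ℝ) → Set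
UniformlyContinuous a b f = ∀ ε → 0ℚ ℚ.< ε → ∃ λ δ → 0ℚ ℚ.< δ ×
  (∀ x y → Between a x b → Between a y b → ∣ x - y ∣ ≤ fromℚ δ → ∣ f x - f y ∣ ≤ fromℚ ε)

mesh : ℝ → ℝ → ℕ → ℝ
mesh a b n = fromℚ (1ℚ /ₙ n) * (b - a)

-- The left Riemann sum over n intervals of equal length.
riemannSum : ℝ → ℝ → (ℝ → ℝ) → ℕ → ℝ
riemannSum a b f n = mesh a b n * Σ< n (λ k → f (a + fromℚ (fromℕ k) * mesh a b n))

module RiemannSums (a b : ℝ) (f : ℝ → ℝ) where
  open ℝ-Solver

  unit : ∀ n → 1ℚ /ₙ suc n ≡ 1/suc n
  unit n = ℚₚ.*-identityˡ (1/suc n)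

  unit-nonNeg : ∀ n → 0ℚ ℚ.≤ 1ℚ /ₙ suc n
  unit-nonNeg n = subst (0ℚ ℚ.≤_) (≡.sym (unit n)) (ℚₚ.<⇒≤ (1/suc-pos n))

  unit-inverse : ∀ n → fromℕ (suc n) ℚ.* (1ℚ /ₙ suc n) ≡ 1ℚ
  unit-inverse n = ≡.trans (cong (fromℕ (suc n) ℚ.*_) (unit n)) (1/suc-inverse n)

  between : ∀ n k → k ℕ.≤ suc n → Between a (a + fromℚ (fromℕ k) * mesh a b (suc n)) b
  between n k h = ≤-pointwise λ i → between-rational (seq a i) (seq b i) (fromℕ k) (1ℚ /ₙ suc n)
    (*-nonNeg (fromℕ-nonNeg k) (unit-nonNeg n))
    (subst (fromℕ k ℚ.* (1ℚ /ₙ suc n) ℚ.≤_) (unit-inverse n) (*-monoʳ (unit-nonNeg n) (fromℕ-mono h)))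

  mesh-total : ∀ n → fromℚ (fromℕ (suc n)) * mesh a b (suc n) ≃ b - a
  mesh-total n = ≃-trans (≃-sym (*-assoc _ _ _)) (≃-trans
    (*-congʳ (≃-trans (≃-sym (fromℚ-* (fromℕ (suc n)) (1ℚ /ₙ suc n))) (fromℚ-cong (unit-inverse n)))) (*-identityˡ (b - a)))

  mesh-refine : ∀ n m → mesh a b (suc n) ≃ fromℚ (fromℕ (suc m)) * mesh a b (suc n ℕ.* suc m)
  mesh-refine n m = ≃-trans (*-congʳ (fromℚ-cong eq))
    (≃-trans (*-congʳ (fromℚ-* (fromℕ (suc m)) (1ℚ /ₙ (suc n ℕ.* suc m)))) (*-assoc _ _ _))
    where
    eq : 1ℚ /ₙ suc n ≡ fromℕ (suc m) ℚ.* (1ℚ /ₙ (suc n ℕ.* suc m))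
    eq = unique-inverse {1ℚ /ₙ suc n} {fromℕ (suc n)} {fromℕ (suc m)} {1ℚ /ₙ (suc n ℕ.* suc m)} (unit-inverse n) (≡.trans
      (cong (ℚ._* (1ℚ /ₙ (suc n ℕ.* suc m))) (≡.sym (fromℕ-* (suc n) (suc m)))) (unit-inverse (m ℕ.+ n ℕ.* suc m)))

  ∣mesh∣ : ∀ n → ∣ mesh a b (suc n) ∣ ≃ fromℚ (1ℚ /ₙ suc n) * ∣ b - a ∣
  ∣mesh∣ n = ≃-trans (∣x*y∣≃∣x∣*∣y∣ _ _) (*-congʳ (∣fromℚ∣≃ (unit-nonNeg n)))

  block-index : ∀ {n m k j} → k ℕ.< n → j ℕ.< m → k ℕ.* m ℕ.+ j ℕ.< n ℕ.* m
  block-index {n} {m} {k} {j} k<n j<m = ℕₚ.<-≤-trans (ℕₚ.+-monoʳ-< (k ℕ.* m) j<m)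
    (subst (ℕ._≤ n ℕ.* m) (ℕₚ.+-comm m (k ℕ.* m)) (ℕₚ.*-monoˡ-≤ m k<n))

  refine : ∀ {B ε δ} → ∣ b - a ∣ ≤ fromℚ B → 0ℚ ℚ.≤ ε →
    (∀ x y → Between a x b → Between a y b → ∣ x - y ∣ ≤ fromℚ δ → ∣ f x - f y ∣ ≤ fromℚ ε) →
    ∀ n m → B ℚ.* (1ℚ /ₙ suc n) ℚ.≤ δ →
    ∣ riemannSum a b f (suc n) - riemannSum a b f (suc n ℕ.* suc m) ∣ ≤ fromℚ (B ℚ.* ε)
  refine {B} {ε} {δ} b-a≤B 0≤ε uc n m small = begin
    ∣ riemannSum a b f N - riemannSum a b f (N ℕ.* M) ∣                          ≈⟨ ∣∣-cong difference ⟩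
    ∣ h′ * Σ< N (λ k → Σ< M λ j → F k - G (k ℕ.* M ℕ.+ j)) ∣                    ≈⟨ ∣x*y∣≃∣x∣*∣y∣ _ _ ⟩
    ∣ h′ ∣ * ∣ Σ< N (λ k → Σ< M λ j → F k - G (k ℕ.* M ℕ.+ j)) ∣                ≤⟨ *-monoˡ-≤ (∣∣-nonNeg h′)
      (∣Σ<∣≤ N (λ k → Σ< M λ j → F k - G (k ℕ.* M ℕ.+ j)) (fromℚ (fromℕ M) * fromℚ ε) λ k k<N →
        ∣Σ<∣≤ M (λ j → F k - G (k ℕ.* M ℕ.+ j)) (fromℚ ε) λ j j<M → close k j k<N j<M) ⟩
    ∣ h′ ∣ * (fromℚ (fromℕ N) * (fromℚ (fromℕ M) * fromℚ ε))                    ≈⟨ *-congʳ (∣mesh∣ (m ℕ.+ n ℕ.* M)) ⟩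
    (fromℚ w * ∣ b - a ∣) * (fromℚ (fromℕ N) * (fromℚ (fromℕ M) * fromℚ ε))     ≈⟨
      solve 5 (λ w d n m e → (w :* d) :* (n :* (m :* e)) := ((n :* m) :* w) :* (d :* e)) ≃-refl
        (fromℚ w) ∣ b - a ∣ (fromℚ (fromℕ N)) (fromℚ (fromℕ M)) (fromℚ ε) ⟩
    ((fromℚ (fromℕ N) * fromℚ (fromℕ M)) * fromℚ w) * (∣ b - a ∣ * fromℚ ε)     ≈⟨ *-congʳ total ⟩
    1ℝ * (∣ b - a ∣ * fromℚ ε)                                                  ≈⟨ *-identityˡ _ ⟩
    ∣ b - a ∣ * fromℚ ε                                                         ≤⟨ *-monoʳ-≤ (fromℚ-nonNeg 0≤ε) b-a≤B ⟩
    fromℚ B * fromℚ ε                                                           ≈⟨ fromℚ-* B ε ⟨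
    fromℚ (B ℚ.* ε)                                                             ∎
    where
    open ≤-Reasoning
    N M : ℕ
    N = suc n
    M = suc m
    w : ℚ
    w = 1ℚ /ₙ (N ℕ.* M)
    h h′ : ℝ
    h  = mesh a b N
    h′ = mesh a b (N ℕ.* M)
    F G : ℕ → ℝ
    F k = f (a + fromℚ (fromℕ k) * h)
    G i = f (a + fromℚ (fromℕ i) * h′)
    total : (fromℚ (fromℕ N) * fromℚ (fromℕ M)) * fromℚ w ≃ 1ℝ
    total = ≃-trans (≃-pointwise λ _ → refl)
      (fromℚ-cong (≡.trans (cong (ℚ._* w) (≡.sym (fromℕ-* N M))) (unit-inverse (m ℕ.+ n ℕ.* M))))
    difference : riemannSum a b f N - riemannSum a b f (N ℕ.* M) ≃
                 h′ * Σ< N (λ k → Σ< M λ j → F k - G (k ℕ.* M ℕ.+ j))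
    difference = ≃-trans (+-cong first (-‿cong (*-congˡ (Σ<-blocks N M G)))) (≃-trans
      (solve 3 (λ h x y → h :* x :- h :* y := h :* (x :- y)) ≃-refl h′ (Σ< N λ k → Σ< M λ _ → F k)
        (Σ< N λ k → Σ< M λ j → G (k ℕ.* M ℕ.+ j)))
      (*-congˡ (≃-trans (Σ<-- N (λ k → Σ< M λ _ → F k) (λ k → Σ< M λ j → G (k ℕ.* M ℕ.+ j)))
        (Σ<-cong N λ k → Σ<-- M (λ _ → F k) (λ j → G (k ℕ.* M ℕ.+ j))))))
      where
      first : h * Σ< N F ≃ h′ * Σ< N (λ k → Σ< M λ _ → F k)
      first = ≃-trans (*-congʳ (mesh-refine n m)) (≃-trans
        (solve 3 (λ m h s → (m :* h) :* s := h :* (m :* s)) ≃-refl (fromℚ (fromℕ M)) h′ (Σ< N F))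
        (*-congˡ (≃-trans (Σ<-*ˡ N (fromℚ (fromℕ M)) F) (Σ<-cong N λ k → ≃-sym (Σ<-const M (F k))))))
    close : ∀ k j → k ℕ.< N → j ℕ.< M → ∣ F k - G (k ℕ.* M ℕ.+ j) ∣ ≤ fromℚ ε
    close k j k<N j<M = uc _ _ (between n k (ℕₚ.<⇒≤ k<N))
      (between (m ℕ.+ n ℕ.* M) (k ℕ.* M ℕ.+ j) (ℕₚ.<⇒≤ (block-index k<N j<M))) (begin
        ∣ (a + K * h) - (a + fromℚ (fromℕ (k ℕ.* M ℕ.+ j)) * h′) ∣  ≈⟨ ∣∣-cong shift ⟩
        ∣ - (J * h′) ∣                                             ≈⟨ ∣-x∣≃∣x∣ (J * h′) ⟩
        ∣ J * h′ ∣                                                 ≈⟨ ∣x*y∣≃∣x∣*∣y∣ J h′ ⟩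
        ∣ J ∣ * ∣ h′ ∣                                             ≈⟨ *-congʳ (∣fromℚ∣≃ (fromℕ-nonNeg j)) ⟩
        J * ∣ h′ ∣                                                 ≤⟨ *-monoʳ-≤ (∣∣-nonNeg h′) (fromℚ-mono-≤ (fromℕ-mono (ℕₚ.<⇒≤ j<M))) ⟩
        fromℚ (fromℕ M) * ∣ h′ ∣                                   ≈⟨ *-congʳ (∣fromℚ∣≃ (fromℕ-nonNeg M)) ⟨
        ∣ fromℚ (fromℕ M) ∣ * ∣ h′ ∣                               ≈⟨ ∣x*y∣≃∣x∣*∣y∣ (fromℚ (fromℕ M)) h′ ⟨
        ∣ fromℚ (fromℕ M) * h′ ∣                                   ≈⟨ ∣∣-cong (mesh-refine n m) ⟨
        ∣ h ∣                                                      ≈⟨ ∣mesh∣ n ⟩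
        fromℚ (1ℚ /ₙ N) * ∣ b - a ∣                                ≤⟨ *-monoˡ-≤ (fromℚ-nonNeg (unit-nonNeg n)) b-a≤B ⟩
        fromℚ (1ℚ /ₙ N) * fromℚ B                                  ≈⟨ *-comm _ _ ⟩
        fromℚ B * fromℚ (1ℚ /ₙ N)                                  ≈⟨ fromℚ-* B (1ℚ /ₙ N) ⟨
        fromℚ (B ℚ.* (1ℚ /ₙ N))                                    ≤⟨ fromℚ-mono-≤ small ⟩
        fromℚ δ                                                    ∎)
      where
      K J : ℝ
      K = fromℚ (fromℕ k)
      J = fromℚ (fromℕ j)
      shift : (a + K * h) - (a + fromℚ (fromℕ (k ℕ.* M ℕ.+ j)) * h′) ≃ - (J * h′)
      shift = ≃-trans (+-cong (+-congˡ (*-congˡ (mesh-refine n m)))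
          (-‿cong (+-congˡ (*-congʳ (≃-trans (fromℚ-cong (≡.trans (fromℕ-+ (k ℕ.* M) j) (cong (ℚ._+ fromℕ j) (fromℕ-* k M))))
            (≃-trans (fromℚ-+ (fromℕ k ℚ.* fromℕ M) (fromℕ j)) (+-congʳ (fromℚ-* (fromℕ k) (fromℕ M)))))))))
        (solve 5 (λ a k m j h → (a :+ k :* (m :* h)) :- (a :+ (k :* m :+ j) :* h) := :- (j :* h)) ≃-refl
          a K (fromℚ (fromℕ M)) J h′)

  riemannSum-cauchy : UniformlyContinuous a b f → IsCauchy (λ n → riemannSum a b f (suc n))
  riemannSum-cauchy uc ε 0<ε =
    let B , 0<B , b-a≤B = ∣x∣≤fromℚ (b - a)
        η , 0<η , Bη≡   = shrink (half-pos 0<ε) 0<B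
        δ , 0<δ , ucδ   = uc η 0<η
        θ , 0<θ , Bθ≡   = shrink 0<δ 0<B
        K , fine        = archimedean θ 0<θ
        near : ∀ n m → K ℕ.≤ n → ∣ riemannSum a b f (suc n) - riemannSum a b f (suc n ℕ.* suc m) ∣ ≤ fromℚ (½ ℚ.* ε)
        near n m h = subst (λ e → ∣ riemannSum a b f (suc n) - riemannSum a b f (suc n ℕ.* suc m) ∣ ≤ fromℚ e) Bη≡
          (refine b-a≤B (ℚₚ.<⇒≤ 0<η) ucδ n m (subst (B ℚ.* (1ℚ /ₙ suc n) ℚ.≤_) Bθ≡
            (*-monoˡ (ℚₚ.<⇒≤ 0<B) (subst (ℚ._≤ θ) (≡.sym (unit n)) (fine n h)))))
    in K , λ m n h k → ∣∣-halves (near m n h)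
      (≤-trans (≤-reflexive (∣x-y∣≃∣y-x∣ _ _))
        (subst (λ i → ∣ riemannSum a b f (suc n) - riemannSum a b f i ∣ ≤ fromℚ (½ ℚ.* ε))
          (ℕₚ.*-comm (suc n) (suc m)) (near n m k)))

-- For a uniformly continuous integrand the Riemann integral is the limit of
-- these sums; the modulus of continuity is what makes the limit exist.
∫ : ∀ a b (f : ℝ → ℝ) → UniformlyContinuous a b f → ℝ
∫ a b f uc = lim (λ n → riemannSum a b f (suc n)) (RiemannSums.riemannSum-cauchy a b f uc)

1+t²-pos : ∀ t → 0ℝ < 1ℝ + t * t
1+t²-pos t = mk< (1ℚ , 0<1 , always λ n → 1≤1+square (seq t n))

arctan′ : ℝ → ℝ
arctan′ t = inv (1ℝ + t * t) (1+t²-pos t)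

arctan′-uniformlyContinuous : ∀ a b → UniformlyContinuous a b arctan′
arctan′-uniformlyContinuous a b ε 0<ε = ε , 0<ε , λ x y _ _ h →
  ≤-trans (≤-pointwise λ n → kernel-lipschitz (seq x n) (seq y n)) h

-- arctan x is the integral of dt/(1+t²) from 0 to x.
arctan : ℝ → ℝ
arctan x = ∫ 0ℝ x arctan′ (arctan′-uniformlyContinuous 0ℝ x)

∫-converges : ∀ a b f uc ε → 0ℚ ℚ.< ε → Eventually λ n → ∣ ∫ a b f uc - riemannSum a b f (suc n) ∣ ≤ fromℚ ε
∫-converges a b f uc = lim-converges (λ n → riemannSum a b f (suc n)) (RiemannSums.riemannSum-cauchy a b f uc)

arctan-lipschitz : ∀ x y → ∣ arctan x - arctan y ∣ ≤ ∣ x - y ∣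
arctan-lipschitz x y = ≤-closed λ ε 0<ε →
  let M , p = ∫-converges 0ℝ x arctan′ (arctan′-uniformlyContinuous 0ℝ x) (½ ℚ.* ε) (half-pos 0<ε)
      N , q = ∫-converges 0ℝ y arctan′ (arctan′-uniformlyContinuous 0ℝ y) (½ ℚ.* ε) (half-pos 0<ε)
      n     = M ℕ.⊔ N
  in begin
    ∣ arctan x - arctan y ∣                                                    ≤⟨ ∣x-z∣≤∣x-y∣+∣y-z∣ (arctan x) (R x n) (arctan y) ⟩
    ∣ arctan x - R x n ∣ + ∣ R x n - arctan y ∣                                ≤⟨ +-mono-≤ (p n (ℕₚ.m≤m⊔n M N))
      (≤-trans (∣x-z∣≤∣x-y∣+∣y-z∣ (R x n) (R y n) (arctan y)) (+-mono-≤ (sums n)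
        (≤-trans (≤-reflexive (∣x-y∣≃∣y-x∣ (R y n) (arctan y))) (q n (ℕₚ.m≤n⊔m M N))))) ⟩
    fromℚ (½ ℚ.* ε) + (∣ x - y ∣ + fromℚ (½ ℚ.* ε))                            ≈⟨
      solve 2 (λ h d → h :+ (d :+ h) := d :+ (h :+ h)) ≃-refl (fromℚ (½ ℚ.* ε)) ∣ x - y ∣ ⟩
    ∣ x - y ∣ + (fromℚ (½ ℚ.* ε) + fromℚ (½ ℚ.* ε))                            ≈⟨
      +-congˡ (≃-trans (≃-sym (fromℚ-+ (½ ℚ.* ε) (½ ℚ.* ε))) (fromℚ-cong (half+half ε))) ⟩
    ∣ x - y ∣ + fromℚ ε                                                        ∎
  where
  open ≤-Reasoning
  open ℝ-Solver
  R : ℝ → ℕ → ℝ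
  R z n = riemannSum 0ℝ z arctan′ (suc n)
  term : ℝ → ℕ → ℕ → ℝ
  term z n k = mesh 0ℝ z (suc n) * arctan′ (0ℝ + fromℚ (fromℕ k) * mesh 0ℝ z (suc n))
  w : ℕ → ℚ
  w n = 1ℚ /ₙ suc n
  0≤w : ∀ n → 0ℚ ℚ.≤ w n
  0≤w = RiemannSums.unit-nonNeg 0ℝ x arctan′
  sums : ∀ n → ∣ R x n - R y n ∣ ≤ ∣ x - y ∣
  sums n = begin
    ∣ R x n - R y n ∣                                              ≈⟨ ∣∣-cong (+-cong
      (Σ<-*ˡ (suc n) (mesh 0ℝ x (suc n)) λ k → arctan′ (0ℝ + fromℚ (fromℕ k) * mesh 0ℝ x (suc n)))
      (-‿cong (Σ<-*ˡ (suc n) (mesh 0ℝ y (suc n)) λ k → arctan′ (0ℝ + fromℚ (fromℕ k) * mesh 0ℝ y (suc n))))) ⟩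
    ∣ Σ< (suc n) (term x n) - Σ< (suc n) (term y n) ∣              ≈⟨ ∣∣-cong (Σ<-- (suc n) (term x n) (term y n)) ⟩
    ∣ Σ< (suc n) (λ k → term x n k - term y n k) ∣                 ≤⟨ ∣Σ<∣≤ (suc n) (λ k → term x n k - term y n k)
      (fromℚ (w n) * ∣ x - y ∣) (λ k _ → ≤-pointwise λ i → kernel-term-lipschitz (seq x i) (seq y i) (fromℕ k) (w n) (0≤w n)) ⟩
    fromℚ (fromℕ (suc n)) * (fromℚ (w n) * ∣ x - y ∣)              ≈⟨ *-assoc _ _ _ ⟨
    (fromℚ (fromℕ (suc n)) * fromℚ (w n)) * ∣ x - y ∣              ≈⟨ *-congʳ (≃-trans (≃-sym (fromℚ-* (fromℕ (suc n)) (w n)))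
      (fromℚ-cong (RiemannSums.unit-inverse 0ℝ x arctan′ n))) ⟩
    1ℝ * ∣ x - y ∣                                                 ≈⟨ *-identityˡ _ ⟩
    ∣ x - y ∣                                                      ∎

record BoundedLipschitz (f : ℝ → ℝ) : Set where
  field
    bound        : ℚ
    constant     : ℚ
    bound-pos    : 0ℚ ℚ.< bound
    constant-pos : 0ℚ ℚ.< constant
    bounds       : ∀ x → ∣ x ∣ ≤ 1ℝ → ∣ f x ∣ ≤ fromℚ bound
    lipschitz    : ∀ x y → ∣ x ∣ ≤ 1ℝ → ∣ y ∣ ≤ 1ℝ → ∣ f x - f y ∣ ≤ fromℚ constant * ∣ x - y ∣

open BoundedLipschitz

module BoundedLipschitzProperties where
  open ℝ-Solver
  open ≤-Reasoning

  1-boundedLipschitz : BoundedLipschitz λ _ → 1ℝ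
  1-boundedLipschitz = record
    { bound = 1ℚ ; constant = 1ℚ ; bound-pos = 0<1 ; constant-pos = 0<1
    ; bounds    = λ _ _ → ≤-reflexive (∣fromℚ∣≃ 0≤1)
    ; lipschitz = λ x y _ _ → ≤-trans (≤-pointwise {y = ∣ x - y ∣} λ n → ∣∣-nonNeg (x - y) n) (≤-reflexive (≃-sym (*-identityˡ _))) }

  id-boundedLipschitz : BoundedLipschitz λ x → x
  id-boundedLipschitz = record
    { bound = 1ℚ ; constant = 1ℚ ; bound-pos = 0<1 ; constant-pos = 0<1
    ; bounds    = λ _ h → h
    ; lipschitz = λ _ _ _ _ → ≤-reflexive (≃-sym (*-identityˡ _)) }

  arctan-boundedLipschitz : BoundedLipschitz arctan
  arctan-boundedLipschitz = record
    { bound = 1ℚ ℚ.+ B ; constant = 1ℚ ; bound-pos = +-pos 0<1 (proj₁ (proj₂ B₀)) ; constant-pos = 0<1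
    ; bounds    = λ x h → begin
        ∣ arctan x ∣                                           ≈⟨ ∣∣-cong (solve 2 (λ a b → a := (a :- b) :+ b) ≃-refl (arctan x) (arctan 0ℝ)) ⟩
        ∣ (arctan x - arctan 0ℝ) + arctan 0ℝ ∣                 ≤⟨ ∣x+y∣≤∣x∣+∣y∣ _ _ ⟩
        ∣ arctan x - arctan 0ℝ ∣ + ∣ arctan 0ℝ ∣               ≤⟨ +-mono-≤ (arctan-lipschitz x 0ℝ) (proj₂ (proj₂ B₀)) ⟩
        ∣ x - 0ℝ ∣ + fromℚ B                                   ≈⟨ +-congʳ (∣∣-cong (solve 1 (λ a → a :- con 0ℚ := a) ≃-refl x)) ⟩
        ∣ x ∣ + fromℚ B                                        ≤⟨ +-mono-≤ h ≤-refl ⟩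
        1ℝ + fromℚ B                                           ≈⟨ fromℚ-+ 1ℚ B ⟨
        fromℚ (1ℚ ℚ.+ B)                                       ∎
    ; lipschitz = λ x y _ _ → ≤-trans (arctan-lipschitz x y) (≤-reflexive (≃-sym (*-identityˡ _))) }
    where
    B₀ = ∣x∣≤fromℚ (arctan 0ℝ)
    B = proj₁ B₀

  *-boundedLipschitz : ∀ {f g} → BoundedLipschitz f → BoundedLipschitz g → BoundedLipschitz λ x → f x * g x
  *-boundedLipschitz {f} {g} p q = record
    { bound = C ℚ.* D ; constant = C ℚ.* L ℚ.+ D ℚ.* K
    ; bound-pos = *-pos (bound-pos p) (bound-pos q)
    ; constant-pos = +-pos (*-pos (bound-pos p) (constant-pos q)) (*-pos (bound-pos q) (constant-pos p))
    ; bounds = λ x h → begin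
        ∣ f x * g x ∣          ≈⟨ ∣x*y∣≃∣x∣*∣y∣ (f x) (g x) ⟩
        ∣ f x ∣ * ∣ g x ∣      ≤⟨ *-monoʳ-≤ (∣∣-nonNeg (g x)) (bounds p x h) ⟩
        fromℚ C * ∣ g x ∣      ≤⟨ *-monoˡ-≤ (fromℚ-nonNeg (ℚₚ.<⇒≤ (bound-pos p))) (bounds q x h) ⟩
        fromℚ C * fromℚ D      ≈⟨ fromℚ-* C D ⟨
        fromℚ (C ℚ.* D)        ∎
    ; lipschitz = λ x y h k → begin
        ∣ f x * g x - f y * g y ∣                                         ≈⟨ ∣∣-cong
          (solve 4 (λ a b c d → a :* b :- c :* d := a :* (b :- d) :+ d :* (a :- c)) ≃-refl (f x) (g x) (f y) (g y)) ⟩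
        ∣ f x * (g x - g y) + g y * (f x - f y) ∣                         ≤⟨ ∣x+y∣≤∣x∣+∣y∣ _ _ ⟩
        ∣ f x * (g x - g y) ∣ + ∣ g y * (f x - f y) ∣                     ≈⟨ +-cong (∣x*y∣≃∣x∣*∣y∣ _ _) (∣x*y∣≃∣x∣*∣y∣ _ _) ⟩
        ∣ f x ∣ * ∣ g x - g y ∣ + ∣ g y ∣ * ∣ f x - f y ∣                 ≤⟨ +-mono-≤
          (≤-trans (*-monoʳ-≤ (∣∣-nonNeg (g x - g y)) (bounds p x h)) (*-monoˡ-≤ (fromℚ-nonNeg (ℚₚ.<⇒≤ (bound-pos p))) (lipschitz q x y h k)))
          (≤-trans (*-monoʳ-≤ (∣∣-nonNeg (f x - f y)) (bounds q y k)) (*-monoˡ-≤ (fromℚ-nonNeg (ℚₚ.<⇒≤ (bound-pos q))) (lipschitz p x y h k))) ⟩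
        fromℚ C * (fromℚ L * ∣ x - y ∣) + fromℚ D * (fromℚ K * ∣ x - y ∣) ≈⟨
          solve 5 (λ c l d k z → c :* (l :* z) :+ d :* (k :* z) := (c :* l :+ d :* k) :* z) ≃-refl (fromℚ C) (fromℚ L) (fromℚ D) (fromℚ K) ∣ x - y ∣ ⟩
        (fromℚ C * fromℚ L + fromℚ D * fromℚ K) * ∣ x - y ∣               ≈⟨ *-congʳ (≃-pointwise λ _ → refl) ⟩
        fromℚ (C ℚ.* L ℚ.+ D ℚ.* K) * ∣ x - y ∣                           ∎ }
    where
    C D K L : ℚ
    C = bound p
    D = bound q
    K = constant p
    L = constant q

  ^-boundedLipschitz : ∀ {f} → BoundedLipschitz f → ∀ n → BoundedLipschitz λ x → f x ^ n
  ^-boundedLipschitz p zero    = 1-boundedLipschitz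
  ^-boundedLipschitz p (suc n) = *-boundedLipschitz p (^-boundedLipschitz p n)

  between⇒∣x∣≤1 : ∀ x → Between 0ℝ x 1ℝ → ∣ x ∣ ≤ 1ℝ
  between⇒∣x∣≤1 x h = begin
    ∣ x ∣                        ≈⟨ ∣-x∣≃∣x∣ x ⟨
    ∣ - x ∣                      ≈⟨ ∣∣-cong (solve 1 (λ x → :- x := con 0ℚ :- x) ≃-refl x) ⟩
    ∣ 0ℝ - x ∣                   ≈⟨ +-identityʳ _ ⟨
    ∣ 0ℝ - x ∣ + 0ℝ              ≤⟨ +-mono-≤ ≤-refl (≤-pointwise (∣∣-nonNeg (x - 1ℝ))) ⟩
    ∣ 0ℝ - x ∣ + ∣ x - 1ℝ ∣      ≤⟨ h ⟩
    ∣ 0ℝ - 1ℝ ∣                  ≈⟨ ∣∣-cong (+-identityˡ (- 1ℝ)) ⟩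
    ∣ - 1ℝ ∣                     ≈⟨ ∣-x∣≃∣x∣ 1ℝ ⟩
    ∣ 1ℝ ∣                       ≈⟨ ∣fromℚ∣≃ 0≤1 ⟩
    1ℝ                           ∎

  boundedLipschitz⇒uniformlyContinuous : ∀ {f} → BoundedLipschitz f → UniformlyContinuous 0ℝ 1ℝ f
  boundedLipschitz⇒uniformlyContinuous {f} p ε 0<ε =
    let δ , 0<δ , eq = shrink 0<ε (constant-pos p) in
    δ , 0<δ , λ x y h k close → begin
      ∣ f x - f y ∣                        ≤⟨ lipschitz p x y (between⇒∣x∣≤1 x h) (between⇒∣x∣≤1 y k) ⟩
      fromℚ (constant p) * ∣ x - y ∣       ≤⟨ *-monoˡ-≤ (fromℚ-nonNeg (ℚₚ.<⇒≤ (constant-pos p))) close ⟩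
      fromℚ (constant p) * fromℚ δ         ≈⟨ fromℚ-* (constant p) δ ⟨
      fromℚ (constant p ℚ.* δ)             ≈⟨ fromℚ-cong eq ⟩
      fromℚ ε                              ∎

open BoundedLipschitzProperties

arctan^-uniformlyContinuous : ∀ p → UniformlyContinuous 0ℝ 1ℝ (λ x → arctan x ^ p)
arctan^-uniformlyContinuous p = boundedLipschitz⇒uniformlyContinuous (^-boundedLipschitz arctan-boundedLipschitz p)

x^arctan^-uniformlyContinuous : ∀ k p → UniformlyContinuous 0ℝ 1ℝ (λ x → x ^ k * arctan x ^ p)
x^arctan^-uniformlyContinuous k p = boundedLipschitz⇒uniformlyContinuous
  (*-boundedLipschitz (^-boundedLipschitz id-boundedLipschitz k) (^-boundedLipschitz arctan-boundedLipschitz p))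

A : ℕ → ℝ
A p = ∫ 0ℝ 1ℝ (λ x → arctan x ^ p) (arctan^-uniformlyContinuous p)

sign : Sign → ℚ
sign Sign.+ = 1ℚ
sign Sign.- = ℚ.- 1ℚ

infix 9 -1^_

-1^_ : ℕ → ℚ
-1^ n = sign Sign.- ^ℚ n

isOdd : ℕ → Bool
isOdd zero    = false
isOdd (suc n) = not (isOdd n)

-- 2 Σ σʲ X(j)/(2j-1) over 1 ≤ j ≤ n.
oddDenominatorSum : Sign → (ℕ → ℚ) → ℕ → ℚ
oddDenominatorSum σ X n = fromℕ 2 ℚ.* (Σℚ[ 1 ⋯ n ] λ j → ((sign σ ^ℚ j) ℚ.* X j) /ₙ (2 ℕ.* j ℕ.∸ 1))

-- 2 Σ σʲ X(j)/(2j) over 1 ≤ j ≤ n-1.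
evenDenominatorSum : Sign → (ℕ → ℚ) → ℕ → ℚ
evenDenominatorSum σ X n = fromℕ 2 ℚ.* (Σℚ[ 1 ⋯ n ℕ.∸ 1 ] λ j → ((sign σ ^ℚ j) ℚ.* X j) /ₙ (2 ℕ.* j))

T : ℕ → List Sign → ℚ
T n []       = 1ℚ
T n (σ ∷ σs) = if isOdd (length (σ ∷ σs))
  then oddDenominatorSum σ (λ j → T j σs) n
  else evenDenominatorSum σ (λ j → T j σs) n

S : ℕ → List Sign → ℚ
S n []       = 1ℚ
S n (σ ∷ σs) = if isOdd (length (σ ∷ σs))
  then evenDenominatorSum σ (λ j → S j σs) n
  else oddDenominatorSum σ (λ j → S j σs) n

-- The superscripts {1}ₚ and {1}ₚ,-1.
ones ones,-1 : ℕ → List Sign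
ones    p = replicate p Sign.+
ones,-1 p = replicate p Sign.+ ++ [ Sign.- ]

t̄1-partialSum : ℕ → ℚ
t̄1-partialSum n = Σℚ[ 1 ⋯ n ] λ k → (-1^ k) /ₙ (2 ℕ.* k ℕ.∸ 1)

module AlternatingSeries where
  open +-*-Solver

  -- 1/(2n+1) - 1/(2n+3) + ..., with d terms.
  alternating : ℕ → ℕ → ℚ
  alternating zero    n = 0ℚ
  alternating (suc d) n = 1/suc (n ℕ.+ n) ℚ.- alternating d (suc n)

  alternating-bounds : ∀ d n → 0ℚ ℚ.≤ alternating d n × alternating d n ℚ.≤ 1/suc (n ℕ.+ n)
  alternating-bounds zero    n = ℚₚ.≤-refl , ℚₚ.<⇒≤ (1/suc-pos (n ℕ.+ n))
  alternating-bounds (suc d) n = let lo , hi = alternating-bounds d (suc n) in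
    diff-nonNeg (ℚₚ.≤-trans hi (1/suc-antimono (ℕₚ.+-mono-≤ (ℕₚ.n≤1+n n) (ℕₚ.n≤1+n n)))) ,
    nonNeg-diff (subst (0ℚ ℚ.≤_) (solve 2 (λ a b → b := a :- (a :- b)) refl (1/suc (n ℕ.+ n)) (alternating d (suc n))) lo)

  term : ℕ → ℚ
  term k = (-1^ k) /ₙ (2 ℕ.* k ℕ.∸ 1)

  term-suc : ∀ n → term (suc n) ≡ (-1^ suc n) ℚ.* 1/suc (n ℕ.+ n)
  term-suc n = cong ((-1^ suc n) /ₙ_) (≡.trans (cong (λ k → n ℕ.+ suc k) (ℕₚ.+-identityʳ n)) (ℕₚ.+-suc n n))

  block : ℕ → ℕ → ℚ
  block n d = sumBelow ℚ._+_ 0ℚ d (λ i → term (suc (n ℕ.+ i)))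

  sumBelow-cong : ∀ d {f g : ℕ → ℚ} → (∀ i → f i ≡ g i) → sumBelow ℚ._+_ 0ℚ d f ≡ sumBelow ℚ._+_ 0ℚ d g
  sumBelow-cong zero    h = refl
  sumBelow-cong (suc d) h = cong₂ ℚ._+_ (h 0) (sumBelow-cong d λ i → h (suc i))

  sumBelow-split : ∀ m d (f : ℕ → ℚ) →
    sumBelow ℚ._+_ 0ℚ (m ℕ.+ d) f ≡ sumBelow ℚ._+_ 0ℚ m f ℚ.+ sumBelow ℚ._+_ 0ℚ d (λ i → f (m ℕ.+ i))
  sumBelow-split zero    d f = ≡.sym (ℚₚ.+-identityˡ _)
  sumBelow-split (suc m) d f = ≡.trans (cong (f 0 ℚ.+_) (sumBelow-split m d λ i → f (suc i)))
    (≡.sym (ℚₚ.+-assoc (f 0) (sumBelow ℚ._+_ 0ℚ m λ i → f (suc i)) (sumBelow ℚ._+_ 0ℚ d λ i → f (suc m ℕ.+ i))))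

  block-alternating : ∀ n d → block n d ≡ (-1^ suc n) ℚ.* alternating d n
  block-alternating n zero    = ≡.sym (ℚₚ.*-zeroʳ (-1^ suc n))
  block-alternating n (suc d) = ≡.trans
    (cong₂ ℚ._+_ (≡.trans (cong (λ k → term (suc k)) (ℕₚ.+-identityʳ n)) (term-suc n))
      (≡.trans (sumBelow-cong d λ i → cong (λ k → term (suc k)) (ℕₚ.+-suc n i)) (block-alternating (suc n) d)))
    (solve 3 (λ c a b → c :* a :+ (:- con 1ℚ :* c) :* b := c :* (a :- b)) refl (-1^ suc n) (1/suc (n ℕ.+ n)) (alternating d (suc n)))

  ∣-1^n∣ : ∀ n → ℚ.∣ -1^ n ∣ ≡ 1ℚ
  ∣-1^n∣ zero    = refl
  ∣-1^n∣ (suc n) = ≡.trans (ℚₚ.∣p*q∣≡∣p∣*∣q∣ (ℚ.- 1ℚ) (-1^ n)) (≡.trans (ℚₚ.*-identityˡ ℚ.∣ -1^ n ∣) (∣-1^n∣ n))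

  tail : ∀ n d → ℚ.∣ t̄1-partialSum (n ℕ.+ d) ℚ.- t̄1-partialSum n ∣ ℚ.≤ 1/suc n
  tail n d = subst (ℚ._≤ 1/suc n) (≡.sym eq)
    (ℚₚ.≤-trans (proj₂ (alternating-bounds d n)) (1/suc-antimono (ℕₚ.m≤m+n n n)))
    where
    P : ℚ
    P = t̄1-partialSum n
    eq : ℚ.∣ t̄1-partialSum (n ℕ.+ d) ℚ.- P ∣ ≡ alternating d n
    eq = ≡.trans (cong ℚ.∣_∣ (≡.trans (cong (ℚ._- P) (sumBelow-split n d λ i → term (suc i)))
          (≡.trans (solve 2 (λ p b → (p :+ b) :- p := b) refl P (block n d)) (block-alternating n d))))
      (≡.trans (ℚₚ.∣p*q∣≡∣p∣*∣q∣ (-1^ suc n) (alternating d n))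
        (≡.trans (cong₂ ℚ._*_ (∣-1^n∣ (suc n)) (ℚₚ.0≤p⇒∣p∣≡p (proj₁ (alternating-bounds d n)))) (ℚₚ.*-identityˡ (alternating d n))))

  tail′ : ∀ {m n} → m ℕ.≤ n → ℚ.∣ t̄1-partialSum n ℚ.- t̄1-partialSum m ∣ ℚ.≤ 1/suc m
  tail′ {m} {n} h = subst (λ k → ℚ.∣ t̄1-partialSum k ℚ.- t̄1-partialSum m ∣ ℚ.≤ 1/suc m) (ℕₚ.m+[n∸m]≡n h) (tail m (n ℕ.∸ m))

  partialSum-cauchy : ∀ ε → 0ℚ ℚ.< ε → ∃ λ N → ∀ m n → N ℕ.≤ m → N ℕ.≤ n →
    ℚ.∣ t̄1-partialSum m ℚ.- t̄1-partialSum n ∣ ℚ.≤ ε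
  partialSum-cauchy ε 0<ε = let N , a = archimedean ε 0<ε in N , close N a
    where
    close : ∀ N → (∀ n → N ℕ.≤ n → 1/suc n ℚ.≤ ε) → ∀ m n → N ℕ.≤ m → N ℕ.≤ n →
      ℚ.∣ t̄1-partialSum m ℚ.- t̄1-partialSum n ∣ ℚ.≤ ε
    close N a m n h k with ℕₚ.≤-total m n
    ... | inj₁ m≤n = subst (ℚ._≤ ε) (dist-sym (t̄1-partialSum n) (t̄1-partialSum m)) (ℚₚ.≤-trans (tail′ m≤n) (a m h))
    ... | inj₂ n≤m = ℚₚ.≤-trans (tail′ n≤m) (a n k)

-- The sum of the series Σ (-1)ⁿ/(2n-1) over n ≥ 1: the real number given by
-- its Cauchy sequence of partial sums.
t̄1 : ℝ
seq    t̄1 = t̄1-partialSum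
cauchy t̄1 = AlternatingSeries.partialSum-cauchy

{-# OPTIONS --safe #-}

-- Integrating the derivative of xᵏ (1 + x²) arctanᵖ x over [0,1] gives, for p ≥ 1,
--   k I(k-1,p) + (k+2) I(k+1,p) + p I(k,p-1) = 2 arctanᵖ 1,   I(k,p) = ∫₀¹ xᵏ arctanᵖ x dx.
-- Solved for I(k+1,p) by summation over k, this expresses the moments of even degree 2n-2
-- through sums Σ_{k<n} /2k of those of odd degree with p lowered by one, and conversely through
-- sums Σ_{k≤n} /(2k-1).  Iterating the two summations on the constant 1 and on (-1)ⁿ produces
-- the T- and S-harmonic sums, so the four formulas follow together by induction on m.  Finally
-- arctan 1 = - t(1̄) by Leibniz's series.  The calculus rests on functions F with
-- |F y - F x - f x (y - x)| ≤ C (y - x)²: for these Riemann sums of f telescope.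

module Submission where

open import Algebra.Bundles using (CommutativeRing)
open import Data.Bool.Base using (true; false; not)
open import Data.Empty using (⊥-elim)
open import Data.List.Base using (List; []; _∷_; length)
open import Data.Nat.Base as ℕ using (ℕ; zero; suc; _!)
import Data.Nat.Properties as ℕₚ
open import Data.Product.Base using (_×_; _,_; proj₁; proj₂)
open import Data.Rational.Base as ℚ using (ℚ; 0ℚ; 1ℚ; ½)
import Data.Rational.Properties as ℚₚ
import Data.Rational.Solver as ℚ-Solver
open import Data.Sign.Base as Sign using (Sign)
open import Relation.Binary.PropositionalEquality as ≡ using (_≡_; refl; cong; cong₂; subst; subst₂)
import Defs

-- The first obstacle is the derivative of arctan. Writing arctan y - arctan x as an integral from x
-- to y would need additivity over intervals whose endpoints cannot be ordered constructively.
-- Instead the Riemann sums on [0,x] are rescaled to a fixed grid of points s in [0,1], with summand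
-- x/(1+(sx)²). The x-derivative of this summand, (1-(sx)²)/(1+(sx)²)², is symmetric in s and x. It
-- is therefore also the s-derivative of s/(1+(sx)²), and its mean over s is 1/(1+x²). The second
-- point is the normalisation (-1)ⁿ (k+1) I(k,p)/p!. It turns the recurrence into a difference
-- equation with a constant boundary term of alternating sign. The partial sums of these boundary
-- terms take only two values, whence the factors 1 + (-1)ⁿ and 1 - (-1)ⁿ. The constants A enter
-- only through the start of the even degrees, since at k = 0 the recurrence has no term of lower
-- degree.

2ℚ : ℚ
2ℚ = 1ℚ ℚ.+ 1ℚ

-- Second-order expansion of p/(1+(sp)²) over the rationals

module KernelExpansion where
  open import Data.Rational.Base
  open Defs.Rational
  open ℚ-Solver.+-*-Solver

  kernel : ℚ → ℚ → ℚ
  kernel s p = invℚ (1ℚ + (s * p) * (s * p))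

  -- With h(t) = t/(1+t²), the remainder h(v) - h(u) - h′(u)(v-u) is -(v-u)² times this polynomial,
  -- divided by (1+u²)²(1+v²).
  numerator : ℚ → ℚ → ℚ
  numerator u v = (2ℚ * u + v) - u * u * v

  -- The difference is a sum of squares: 2v² + v + 1 and 2v² - v + 1 are completed to squares, which
  -- produces the constant 3/4.
  ½numerator≤ : ∀ u v → ½ * numerator u v ≤ (1ℚ + u * u) * (1ℚ + v * v)
  ½numerator≤ u v = nonNeg-diff (subst (0ℚ ≤_)
    (solve 2 (λ u v →
       con ½ :* ((u :- con 1ℚ) :* (u :- con 1ℚ)
         :+ ((u :* u) :* (((v :+ con ½) :* (v :+ con ½) :+ v :* v) :+ con (½ * (½ + 1ℚ)))
         :+ (((v :- con ½) :* (v :- con ½) :+ v :* v) :+ con (½ * (½ + 1ℚ)))))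
       := (con 1ℚ :+ u :* u) :* (con 1ℚ :+ v :* v) :- con ½ :* ((con 2ℚ :* u :+ v) :- u :* u :* v)) refl u v)
    (*-nonNeg 0≤½ (+-nonNeg (square-nonNeg (u - 1ℚ)) (+-nonNeg
      (*-nonNeg (square-nonNeg u) (+-nonNeg (+-nonNeg (square-nonNeg (v + ½)) (square-nonNeg v)) 0≤¾))
      (+-nonNeg (+-nonNeg (square-nonNeg (v - ½)) (square-nonNeg v)) 0≤¾)))))
    where
    0≤½ : 0ℚ ≤ ½
    0≤½ = ℚₚ.<⇒≤ 1/2-pos
    0≤¾ : 0ℚ ≤ ½ * (½ + 1ℚ)
    0≤¾ = *-nonNeg 0≤½ (+-nonNeg 0≤½ 0≤1)

  -- `numerator` is odd under (u,v) ↦ (-u,-v) and the bound is even, so the one-sided estimate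
  -- suffices.
  ∣½numerator∣≤ : ∀ u v → ∣ ½ * numerator u v ∣ ≤ (1ℚ + u * u) * (1ℚ + v * v)
  ∣½numerator∣≤ u v = ∣p∣≤ (½numerator≤ u v) (subst₂ _≤_
    (solve 2 (λ u v → con ½ :* ((con 2ℚ :* (:- u) :+ (:- v)) :- (:- u) :* (:- u) :* (:- v))
       := :- (con ½ :* ((con 2ℚ :* u :+ v) :- u :* u :* v))) refl u v)
    (solve 2 (λ u v → (con 1ℚ :+ (:- u) :* (:- u)) :* (con 1ℚ :+ (:- v) :* (:- v))
       := (con 1ℚ :+ u :* u) :* (con 1ℚ :+ v :* v)) refl u v)
    (½numerator≤ (- u) (- v)))

  invℚ≤1 : ∀ {p} → 1ℚ ≤ p → ∣ invℚ p ∣ ≤ 1ℚ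
  invℚ≤1 1≤p = subst (_≤ 1ℚ) (≡.sym (ℚₚ.0≤p⇒∣p∣≡p (ℚₚ.<⇒≤ (invℚ-pos (ℚₚ.<-≤-trans 0<1 1≤p)))))
    (invℚ-antimono 0<1 1≤p)

  -- Taylor's formula for p ↦ p/(1+(sp)²). The constant is uniform in p and q because both i and (i
  -- j) times half the numerator have absolute value at most 1.
  kernel-expansion : ∀ s p q →
    ∣ (q * kernel s q - p * kernel s p) - ((1ℚ - (s * p) * (s * p)) * (kernel s p * kernel s p)) * (q - p) ∣
      ≤ ∣ (2ℚ * s) * ((q - p) * (q - p)) ∣
  kernel-expansion s p q = subst (λ z → ∣ z ∣ ≤ ∣ (2ℚ * s) * ((q - p) * (q - p)) ∣) (≡.sym eq)
    (subst (_≤ ∣ (2ℚ * s) * ((q - p) * (q - p)) ∣) (≡.sym (ℚₚ.∣-p∣≡∣p∣ (i * (((i * j) * (½ * numerator u v)) * ((2ℚ * s) * ((q - p) * (q - p)))))))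
      (ℚₚ.≤-trans (∣p*q∣≤∣q∣ _ (invℚ≤1 (1≤1+square u)))
        (∣p*q∣≤∣q∣ _ (ratio≤1 (1+square-pos u) (1+square-pos v) (∣½numerator∣≤ u v)))))
    where
    u v i j : ℚ
    u = s * p
    v = s * q
    i = kernel s p
    j = kernel s q
    e : i * (1ℚ + u * u) ≡ 1ℚ
    e = ≡.trans (ℚₚ.*-comm i (1ℚ + u * u)) (invℚ-inverse (1+square-pos u))
    f : j * (1ℚ + v * v) ≡ 1ℚ
    f = ≡.trans (ℚₚ.*-comm j (1ℚ + v * v)) (invℚ-inverse (1+square-pos v))
    -- The solver cannot see inside `invℚ`. Factors i(1+u²) = 1 and j(1+v²) = 1 are inserted until
    -- the claim is a polynomial identity in s, p, q, i, j.
    pad : ∀ x {y z} → y ≡ 1ℚ → z ≡ 1ℚ → x ≡ x * (y * z)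
    pad x refl refl = ≡.sym (ℚₚ.*-identityʳ x)
    eq : (q * j - p * i) - ((1ℚ - u * u) * (i * i)) * (q - p) ≡
         - (i * (((i * j) * (½ * numerator u v)) * ((2ℚ * s) * ((q - p) * (q - p)))))
    eq = ≡.trans
      (cong₂ _-_ (cong₂ _-_ (pad (q * j) e e) (pad (p * i) e f)) (pad (((1ℚ - u * u) * (i * i)) * (q - p)) {1ℚ} {j * (1ℚ + v * v)} refl f))
      (solve 5 (λ s p q i j → let u = s :* p ; v = s :* q ; U = con 1ℚ :+ u :* u ; V = con 1ℚ :+ v :* v in
        ((q :* j) :* ((i :* U) :* (i :* U)) :- (p :* i) :* ((i :* U) :* (j :* V)))
          :- (((con 1ℚ :- u :* u) :* (i :* i)) :* (q :- p)) :* (con 1ℚ :* (j :* V))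
        := :- (i :* (((i :* j) :* (con ½ :* ((con 2ℚ :* u :+ v) :- u :* u :* v))) :* ((con 2ℚ :* s) :* ((q :- p) :* (q :- p))))))
        refl s p q i j)

open import Defs
open Rational
open NaturalRational
open SumProperties
open BoundedLipschitz
open BoundedLipschitzProperties
open KernelExpansion using (kernel-expansion; invℚ≤1)

2ℝ : ℝ
2ℝ = fromℚ 2ℚ

close⇒≃ : ∀ {x y} → (∀ ε → 0ℚ ℚ.< ε → ∣ x - y ∣ ≤ fromℚ ε) → x ≃ y
close⇒≃ {x} {y} h = mk≃ λ ε 0<ε → later
  (λ n → subst (ℚ.∣ seq x n ℚ.- seq y n ∣ ℚ.≤_) (half+half ε))
  (get≤ (h (½ ℚ.* ε) (half-pos 0<ε)) (½ ℚ.* ε) (half-pos 0<ε))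

x≤∣x∣ : ∀ x → x ≤ ∣ x ∣
x≤∣x∣ x = ≤-pointwise λ n → p≤∣p∣ (seq x n)

∣x*x∣≃x*x : ∀ x → ∣ x * x ∣ ≃ x * x
∣x*x∣≃x*x x = ≃-pointwise λ n → ℚₚ.0≤p⇒∣p∣≡p (square-nonNeg (seq x n))

∣c*x∣≃c*∣x∣ : ∀ {c} x → 0ℚ ℚ.≤ c → ∣ fromℚ c * x ∣ ≃ fromℚ c * ∣ x ∣
∣c*x∣≃c*∣x∣ {c} x 0≤c = ≃-trans (∣x*y∣≃∣x∣*∣y∣ (fromℚ c) x) (*-congʳ (∣fromℚ∣≃ 0≤c))

∣∣-mono-* : ∀ {x y p} b → ∣ x ∣ ≤ fromℚ p → 0ℚ ℚ.≤ p → ∣ y ∣ ≤ b → ∣ x * y ∣ ≤ fromℚ p * b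
∣∣-mono-* {x} {y} b hx 0≤p hy = ≤-trans (≤-reflexive (∣x*y∣≃∣x∣*∣y∣ x y))
  (≤-trans (*-monoʳ-≤ (∣∣-nonNeg y) hx) (*-monoˡ-≤ (fromℚ-nonNeg 0≤p) hy))

-- Limits of real sequences

infix 4 _⟶_

_⟶_ : (ℕ → ℝ) → ℝ → Set
s ⟶ L = ∀ ε → 0ℚ ℚ.< ε → Eventually λ n → ∣ L - s n ∣ ≤ fromℚ ε

module Limits where
  open ℝ-Solver
  open ≤-Reasoning

  ⟶-unique : ∀ {s L M} → s ⟶ L → s ⟶ M → L ≃ M
  ⟶-unique {s} {L} {M} h k = close⇒≃ λ ε 0<ε →
    let N , p = both (λ n → ∣∣-halves {L} {s n} {M} {ε}) (h (½ ℚ.* ε) (half-pos 0<ε))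
                  (later (λ n → ≤-trans (≤-reflexive (∣x-y∣≃∣y-x∣ (s n) M))) (k (½ ℚ.* ε) (half-pos 0<ε)))
    in p N ℕₚ.≤-refl

  ⟶-resp : ∀ {s r L M} → (∀ n → s n ≃ r n) → L ≃ M → s ⟶ L → r ⟶ M
  ⟶-resp e d h ε 0<ε = later (λ n → ≤-trans (≤-reflexive (∣∣-cong (+-cong (≃-sym d) (-‿cong (≃-sym (e n))))))) (h ε 0<ε)

  ⟶-+ : ∀ {s r L M} → s ⟶ L → r ⟶ M → (λ n → s n + r n) ⟶ L + M
  ⟶-+ {s} {r} {L} {M} h k ε 0<ε = both
    (λ n p q → begin
      ∣ (L + M) - (s n + r n) ∣                     ≈⟨ ∣∣-cong (solve 4 (λ a b c d → (a :+ b) :- (c :+ d) := (a :- c) :+ (b :- d)) ≃-refl L M (s n) (r n)) ⟩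
      ∣ (L - s n) + (M - r n) ∣                     ≤⟨ ∣x+y∣≤∣x∣+∣y∣ _ _ ⟩
      ∣ L - s n ∣ + ∣ M - r n ∣                     ≤⟨ +-mono-≤ p q ⟩
      fromℚ (½ ℚ.* ε) + fromℚ (½ ℚ.* ε)             ≈⟨ fromℚ-+ _ _ ⟨
      fromℚ (½ ℚ.* ε ℚ.+ ½ ℚ.* ε)                   ≈⟨ fromℚ-cong (half+half ε) ⟩
      fromℚ ε                                       ∎)
    (h (½ ℚ.* ε) (half-pos 0<ε)) (k (½ ℚ.* ε) (half-pos 0<ε))

  ⟶-* : ∀ {s L} c → s ⟶ L → (λ n → c * s n) ⟶ c * L
  ⟶-* {s} {L} c h ε 0<ε =
    let B , 0<B , c≤B = ∣x∣≤fromℚ c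
        δ , 0<δ , eq  = shrink 0<ε 0<B
    in later (λ n p → begin
      ∣ c * L - c * s n ∣      ≈⟨ ∣∣-cong (solve 3 (λ c a b → c :* a :- c :* b := c :* (a :- b)) ≃-refl c L (s n)) ⟩
      ∣ c * (L - s n) ∣        ≤⟨ ∣∣-mono-* (fromℚ δ) c≤B (ℚₚ.<⇒≤ 0<B) p ⟩
      fromℚ B * fromℚ δ        ≈⟨ fromℚ-* B δ ⟨
      fromℚ (B ℚ.* δ)          ≈⟨ fromℚ-cong eq ⟩
      fromℚ ε                  ∎) (h δ 0<δ)

  ⟶-const : ∀ x → (λ _ → x) ⟶ x
  ⟶-const x ε 0<ε = always λ _ → ≤-trans
    (≤-reflexive (≃-trans (∣∣-cong (solve 1 (λ x → x :- x := con 0ℚ) ≃-refl x)) (∣fromℚ∣≃ ℚₚ.≤-refl)))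
    (fromℚ-mono-≤ (ℚₚ.<⇒≤ 0<ε))

  ⟶-neg : ∀ {s L} → s ⟶ L → (λ n → - s n) ⟶ - L
  ⟶-neg {s} {L} h ε 0<ε = later (λ n → ≤-trans (≤-reflexive (≃-trans
    (∣∣-cong (solve 2 (λ a b → :- a :- :- b := :- (a :- b)) ≃-refl L (s n))) (∣-x∣≃∣x∣ (L - s n))))) (h ε 0<ε)

  ⟶-rate : ∀ {s L} c → (∀ n → ∣ L - s n ∣ ≤ fromℚ (1/suc n) * c) → s ⟶ L
  ⟶-rate {s} {L} c h ε 0<ε =
    let B , 0<B , c≤B = ∣x∣≤fromℚ c
        δ , 0<δ , eq  = shrink 0<ε 0<B
        N , a         = archimedean δ 0<δ
    in N , λ n N≤n → begin
      ∣ L - s n ∣              ≤⟨ h n ⟩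
      fromℚ (1/suc n) * c      ≤⟨ *-monoˡ-≤ (fromℚ-nonNeg (ℚₚ.<⇒≤ (1/suc-pos n))) (≤-trans (x≤∣x∣ c) c≤B) ⟩
      fromℚ (1/suc n) * fromℚ B ≤⟨ *-monoʳ-≤ (fromℚ-nonNeg (ℚₚ.<⇒≤ 0<B)) (fromℚ-mono-≤ (a n N≤n)) ⟩
      fromℚ δ * fromℚ B        ≈⟨ *-comm _ _ ⟩
      fromℚ B * fromℚ δ        ≈⟨ fromℚ-* B δ ⟨
      fromℚ (B ℚ.* δ)          ≈⟨ fromℚ-cong eq ⟩
      fromℚ ε                  ∎

  -- Carries an estimate between Riemann sums over to their limits; used for the remainder of arctan
  -- and for the remainder of Leibniz's series.
  ⟶-∣∣-mono : ∀ {s r L M} → s ⟶ L → r ⟶ M → (∀ n → ∣ s n ∣ ≤ r n) → ∣ L ∣ ≤ M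
  ⟶-∣∣-mono {s} {r} {L} {M} h k s≤r = ≤-closed λ ε 0<ε →
    let N , p = both (λ n → _,_) (h (½ ℚ.* ε) (half-pos 0<ε)) (k (½ ℚ.* ε) (half-pos 0<ε))
        p₁ , p₂ = p N ℕₚ.≤-refl
    in begin
      ∣ L ∣                                     ≈⟨ ∣∣-cong (solve 2 (λ a b → a := (a :- b) :+ b) ≃-refl L (s N)) ⟩
      ∣ (L - s N) + s N ∣                       ≤⟨ ∣x+y∣≤∣x∣+∣y∣ _ _ ⟩
      ∣ L - s N ∣ + ∣ s N ∣                     ≤⟨ +-mono-≤ p₁ (≤-trans (s≤r N) (≤-reflexive
                                                    (solve 2 (λ a b → a := (a :- b) :+ b) ≃-refl (r N) M))) ⟩
      fromℚ (½ ℚ.* ε) + ((r N - M) + M)         ≤⟨ +-mono-≤ ≤-refl (+-mono-≤ (≤-trans (x≤∣x∣ (r N - M))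
                                                    (≤-trans (≤-reflexive (∣x-y∣≃∣y-x∣ (r N) M)) p₂)) ≤-refl) ⟩
      fromℚ (½ ℚ.* ε) + (fromℚ (½ ℚ.* ε) + M)   ≈⟨ solve 2 (λ h m → h :+ (h :+ m) := m :+ (h :+ h)) ≃-refl (fromℚ (½ ℚ.* ε)) M ⟩
      M + (fromℚ (½ ℚ.* ε) + fromℚ (½ ℚ.* ε))   ≈⟨ +-congˡ (≃-trans (≃-sym (fromℚ-+ _ _)) (fromℚ-cong (half+half ε))) ⟩
      M + fromℚ ε                               ∎

open Limits

-- Finite sums and Riemann sums on the unit grid

Σ<-+ : ∀ n f g → Σ< n (λ k → f k + g k) ≃ Σ< n f + Σ< n g
Σ<-+ zero    f g = ≃-sym (+-identityˡ 0ℝ)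
Σ<-+ (suc n) f g = ≃-trans (+-congˡ (Σ<-+ n (λ k → f (suc k)) (λ k → g (suc k))))
  (solve 4 (λ a b c d → (a :+ b) :+ (c :+ d) := (a :+ c) :+ (b :+ d)) ≃-refl
    (f 0) (g 0) (Σ< n λ k → f (suc k)) (Σ< n λ k → g (suc k)))
  where open ℝ-Solver

Σ<-telescope : ∀ n f → Σ< n (λ k → f (suc k) - f k) ≃ f n - f 0
Σ<-telescope zero    f = solve 1 (λ a → con 0ℚ := a :- a) ≃-refl (f 0)
  where open ℝ-Solver
Σ<-telescope (suc n) f = ≃-trans (+-congˡ (Σ<-telescope n λ k → f (suc k)))
  (solve 3 (λ a b c → (b :- a) :+ (c :- b) := c :- a) ≃-refl (f 0) (f 1) (f (suc n)))
  where open ℝ-Solver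

Σ<-∣∣ : ∀ n f → ∣ Σ< n f ∣ ≤ Σ< n (λ k → ∣ f k ∣)
Σ<-∣∣ zero    f = ≤-reflexive (∣fromℚ∣≃ ℚₚ.≤-refl)
Σ<-∣∣ (suc n) f = ≤-trans (∣x+y∣≤∣x∣+∣y∣ (f 0) (Σ< n λ k → f (suc k))) (+-mono-≤ ≤-refl (Σ<-∣∣ n λ k → f (suc k)))

Σ<-mono : ∀ n {f g} → (∀ k → k ℕ.< n → f k ≤ g k) → Σ< n f ≤ Σ< n g
Σ<-mono zero    h = ≤-refl
Σ<-mono (suc n) h = +-mono-≤ (h 0 (ℕ.s≤s ℕ.z≤n)) (Σ<-mono n λ k k<n → h (suc k) (ℕ.s≤s k<n))

module UnitGrid where
  open ℝ-Solver
  open ≤-Reasoning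

  width : ℕ → ℝ
  width n = mesh 0ℝ 1ℝ (suc n)

  point : ℕ → ℕ → ℝ
  point n k = 0ℝ + fromℚ (fromℕ k) * width n

  width≃ : ∀ n → width n ≃ fromℚ (1/suc n)
  width≃ n = ≃-pointwise λ _ → ≡.trans (ℚₚ.*-identityʳ (1ℚ ℚ.* 1/suc n)) (ℚₚ.*-identityˡ (1/suc n))

  n*width : ∀ n → fromℚ (fromℕ (suc n)) * width n ≃ 1ℝ
  n*width n = ≃-trans (RiemannSums.mesh-total 0ℝ 1ℝ (λ x → x) n) (≃-pointwise λ _ → refl)

  point-step : ∀ n k → point n (suc k) - point n k ≃ width n
  point-step n k = ≃-trans (+-congʳ (+-congˡ (*-congʳ (≃-trans (fromℚ-cong (fromℕ-suc k)) (fromℚ-+ 1ℚ (fromℕ k))))))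
    (solve 2 (λ k w → (con 0ℚ :+ (con 1ℚ :+ k) :* w) :- (con 0ℚ :+ k :* w) := w) ≃-refl (fromℚ (fromℕ k)) (width n))

  point-first : ∀ n → point n 0 ≃ 0ℝ
  point-first n = solve 1 (λ w → con 0ℚ :+ con 0ℚ :* w := con 0ℚ) ≃-refl (width n)

  point-last : ∀ n → point n (suc n) ≃ 1ℝ
  point-last n = ≃-trans (+-identityˡ _) (n*width n)

  ∣point∣≤1 : ∀ n k → k ℕ.≤ suc n → ∣ point n k ∣ ≤ 1ℝ
  ∣point∣≤1 n k h = between⇒∣x∣≤1 (point n k) (RiemannSums.between 0ℝ 1ℝ (λ x → x) n k h)

  width*Σ-const : ∀ n c → width n * Σ< (suc n) (λ _ → c) ≃ c
  width*Σ-const n c = ≃-trans (*-congˡ (Σ<-const (suc n) c)) (≃-trans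
    (solve 3 (λ w m c → w :* (m :* c) := (m :* w) :* c) ≃-refl (width n) (fromℚ (fromℕ (suc n))) c)
    (≃-trans (*-congʳ (n*width n)) (*-identityˡ c)))

  ∣width∣ : ∀ n → ∣ width n ∣ ≃ fromℚ (1/suc n)
  ∣width∣ n = ≃-trans (∣∣-cong (width≃ n)) (∣fromℚ∣≃ (ℚₚ.<⇒≤ (1/suc-pos n)))

  ∣width*Σ∣≤ : ∀ n f c → (∀ k → k ℕ.< suc n → ∣ f k ∣ ≤ c) → ∣ width n * Σ< (suc n) f ∣ ≤ c
  ∣width*Σ∣≤ n f c h = begin
    ∣ width n * Σ< (suc n) f ∣                          ≈⟨ ∣x*y∣≃∣x∣*∣y∣ _ _ ⟩
    ∣ width n ∣ * ∣ Σ< (suc n) f ∣                      ≤⟨ *-monoˡ-≤ (∣∣-nonNeg (width n)) (∣Σ<∣≤ (suc n) f c h) ⟩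
    ∣ width n ∣ * (fromℚ (fromℕ (suc n)) * c)           ≈⟨ *-cong (≃-trans (∣width∣ n) (≃-sym (width≃ n))) ≃-refl ⟩
    width n * (fromℚ (fromℕ (suc n)) * c)               ≈⟨ *-congˡ (Σ<-const (suc n) c) ⟨
    width n * Σ< (suc n) (λ _ → c)                      ≈⟨ width*Σ-const n c ⟩
    c                                                   ∎

  ∣0∣≤1 : ∣ 0ℝ ∣ ≤ 1ℝ
  ∣0∣≤1 = ≤-trans (≤-reflexive (∣fromℚ∣≃ ℚₚ.≤-refl)) (fromℚ-mono-≤ 0≤1)

  ∣1∣≤1 : ∣ 1ℝ ∣ ≤ 1ℝ
  ∣1∣≤1 = ≤-reflexive (∣fromℚ∣≃ 0≤1)

  -- The integral as a relation between integrand and value: integrands that arise by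
  -- differentiation need no modulus of continuity, and linearity is that of limits.
  record Integral (f : ℝ → ℝ) (L : ℝ) : Set where
    constructor mkIntegral
    field converges : (λ n → riemannSum 0ℝ 1ℝ f (suc n)) ⟶ L

  open Integral public

  -- Each of the n + 1 steps of width w costs at most c w², and (n + 1) w = 1 leaves c w. The rate
  -- is explicit because the derivative of arctan is estimated at finite n. Congruence of F is
  -- assumed since the grid ends are only `≃` to 0 and 1, and a function on ℝ need not respect `≃`.
  antiderivative-rate : ∀ (F f : ℝ → ℝ) c →
    (∀ x y → ∣ x ∣ ≤ 1ℝ → ∣ y ∣ ≤ 1ℝ → ∣ (F y - F x) - f x * (y - x) ∣ ≤ c * ((y - x) * (y - x))) →
    (∀ {x y} → ∣ x ∣ ≤ 1ℝ → ∣ y ∣ ≤ 1ℝ → x ≃ y → F x ≃ F y) →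
    ∀ n → ∣ (F 1ℝ - F 0ℝ) - riemannSum 0ℝ 1ℝ f (suc n) ∣ ≤ fromℚ (1/suc n) * c
  antiderivative-rate F f c quadratic F-cong n = begin
    ∣ (F 1ℝ - F 0ℝ) - w * Σ< N (λ k → f (p k)) ∣            ≈⟨ ∣∣-cong (≃-sym (+-congʳ (+-cong
      (F-cong (∣point∣≤1 n N ℕₚ.≤-refl) ∣1∣≤1 (point-last n)) (-‿cong (F-cong (∣point∣≤1 n 0 ℕ.z≤n) ∣0∣≤1 (point-first n)))))) ⟩
    ∣ (F (p N) - F (p 0)) - w * Σ< N (λ k → f (p k)) ∣      ≈⟨ ∣∣-cong (+-cong (≃-sym (Σ<-telescope N λ k → F (p k))) (-‿cong (Σ<-*ˡ N w λ k → f (p k)))) ⟩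
    ∣ Σ< N (λ k → F (p (suc k)) - F (p k)) - Σ< N (λ k → w * f (p k)) ∣  ≈⟨ ∣∣-cong (Σ<-- N (λ k → F (p (suc k)) - F (p k)) (λ k → w * f (p k))) ⟩
    ∣ Σ< N (λ k → (F (p (suc k)) - F (p k)) - w * f (p k)) ∣  ≤⟨ ∣Σ<∣≤ N _ (c * (w * w)) step ⟩
    fromℚ (fromℕ N) * (c * (w * w))                           ≈⟨ solve 3 (λ n c w → n :* (c :* (w :* w)) := (n :* w) :* (w :* c)) ≃-refl (fromℚ (fromℕ N)) c w ⟩
    (fromℚ (fromℕ N) * w) * (w * c)                           ≈⟨ *-cong (n*width n) (*-congʳ (width≃ n)) ⟩
    1ℝ * (fromℚ (1/suc n) * c)                                ≈⟨ *-identityˡ _ ⟩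
    fromℚ (1/suc n) * c                                       ∎
    where
    N : ℕ
    N = suc n
    w : ℝ
    w = width n
    p : ℕ → ℝ
    p = point n
    step : ∀ k → k ℕ.< N → ∣ (F (p (suc k)) - F (p k)) - w * f (p k) ∣ ≤ c * (w * w)
    step k k<N = begin
      ∣ (F (p (suc k)) - F (p k)) - w * f (p k) ∣                  ≈⟨ ∣∣-cong (+-congˡ (-‿cong (≃-trans (*-comm w (f (p k))) (*-congˡ (≃-sym (point-step n k)))))) ⟩
      ∣ (F (p (suc k)) - F (p k)) - f (p k) * (p (suc k) - p k) ∣  ≤⟨ quadratic (p k) (p (suc k)) (∣point∣≤1 n k (ℕₚ.<⇒≤ k<N)) (∣point∣≤1 n (suc k) k<N) ⟩
      c * ((p (suc k) - p k) * (p (suc k) - p k))                  ≈⟨ *-congˡ (*-cong (point-step n k) (point-step n k)) ⟩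
      c * (w * w)                                                  ∎

open UnitGrid

-- The derivative of arctan

module ArctanDerivative where
  open ℝ-Solver
  open ≤-Reasoning

  arctan′-cong : ∀ {x y} → x ≃ y → arctan′ x ≃ arctan′ y
  arctan′-cong {x} {y} h = mk≃ λ ε 0<ε → later (λ n → ℚₚ.≤-trans (kernel-lipschitz (seq x n) (seq y n))) (get≃ h ε 0<ε)

  arctan′-inverse : ∀ x → arctan′ x * (1ℝ + x * x) ≃ 1ℝ
  arctan′-inverse x = ≃-pointwise λ n → ≡.trans (ℚₚ.*-comm _ (1ℚ ℚ.+ seq x n ℚ.* seq x n)) (invℚ-inverse (1+square-pos (seq x n)))

  ∣arctan′∣≤1 : ∀ x → ∣ arctan′ x ∣ ≤ 1ℝ
  ∣arctan′∣≤1 x = ≤-pointwise λ n → invℚ≤1 (1≤1+square (seq x n))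

  -- x arctan′(s x) and s arctan′(s x) have this same derivative, in x and in s respectively.
  slope : ℝ → ℝ → ℝ
  slope s x = (1ℝ - (s * x) * (s * x)) * (arctan′ (s * x) * arctan′ (s * x))

  -- Allows an x-derivative taken at each fixed s to be summed over s as an s-derivative.
  slope-sym : ∀ s x → slope s x ≃ slope x s
  slope-sym s x = *-cong (+-congˡ (-‿cong (*-cong e e))) (*-cong (arctan′-cong e) (arctan′-cong e))
    where
    e : s * x ≃ x * s
    e = *-comm s x

  slope-remainder : ∀ s x y →
    ∣ (y * arctan′ (s * y) - x * arctan′ (s * x)) - slope s x * (y - x) ∣ ≤ (2ℝ * ∣ s ∣) * ((y - x) * (y - x))
  slope-remainder s x y = begin
    ∣ (y * arctan′ (s * y) - x * arctan′ (s * x)) - slope s x * (y - x) ∣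
      ≤⟨ ≤-pointwise (λ n → kernel-expansion (seq s n) (seq x n) (seq y n)) ⟩
    ∣ (2ℝ * s) * ((y - x) * (y - x)) ∣        ≈⟨ ∣x*y∣≃∣x∣*∣y∣ (2ℝ * s) ((y - x) * (y - x)) ⟩
    ∣ 2ℝ * s ∣ * ∣ (y - x) * (y - x) ∣        ≈⟨ *-cong (∣c*x∣≃c*∣x∣ s (+-nonNeg 0≤1 0≤1)) (∣x*x∣≃x*x (y - x)) ⟩
    (2ℝ * ∣ s ∣) * ((y - x) * (y - x))        ∎

  -- In the variable s, `slope x` is the derivative of s/(1+(xs)²), which runs from 0 at s = 0 to
  -- 1/(1+x²) at s = 1.
  slope-integral : ∀ x n → ∣ arctan′ x - riemannSum 0ℝ 1ℝ (slope x) (suc n) ∣ ≤ fromℚ (1/suc n) * (2ℝ * ∣ x ∣)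
  slope-integral x n = ≤-trans (≤-reflexive (∣∣-cong (+-congʳ ends)))
    (antiderivative-rate (λ s → s * arctan′ (x * s)) (slope x) (2ℝ * ∣ x ∣)
      (λ s t _ _ → slope-remainder x s t) (λ _ _ e → *-cong e (arctan′-cong (*-congˡ e))) n)
    where
    ends : arctan′ x ≃ 1ℝ * arctan′ (x * 1ℝ) - 0ℝ * arctan′ (x * 0ℝ)
    ends = ≃-trans (arctan′-cong (≃-sym (*-identityʳ x)))
      (solve 2 (λ a b → a := con 1ℚ :* a :- con 0ℚ :* b) ≃-refl (arctan′ (x * 1ℝ)) (arctan′ (x * 0ℝ)))

  -- Substitution t = s z. The points s no longer depend on z, so the sums for x and y can be
  -- compared term by term.
  riemannSum-rescale : ∀ z n → riemannSum 0ℝ z arctan′ (suc n) ≃ width n * Σ< (suc n) (λ k → z * arctan′ (point n k * z))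
  riemannSum-rescale z n = ≃-trans
    (*-cong (solve 2 (λ w z → w :* (z :- con 0ℚ) := (w :* (con 1ℚ :- con 0ℚ)) :* z) ≃-refl w z)
      (Σ<-cong (suc n) λ k → arctan′-cong (solve 3 (λ w k z →
        con 0ℚ :+ k :* (w :* (z :- con 0ℚ)) := (con 0ℚ :+ k :* (w :* (con 1ℚ :- con 0ℚ))) :* z) ≃-refl w (fromℚ (fromℕ k)) z)))
    (≃-trans (*-assoc (width n) z _) (*-congˡ (Σ<-*ˡ (suc n) z (λ k → arctan′ (point n k * z)))))
    where
    w : ℝ
    w = fromℚ (1ℚ /ₙ suc n)

  -- Differentiation under the sum. The first error collects the expansions of the summands in z at
  -- fixed s; the second is the defect of the Riemann sum of `slope x` and disappears in the limit.
  riemannSum-remainder : ∀ x y n →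
    ∣ (riemannSum 0ℝ y arctan′ (suc n) - riemannSum 0ℝ x arctan′ (suc n)) - arctan′ x * (y - x) ∣
      ≤ 2ℝ * ((y - x) * (y - x)) + fromℚ (1/suc n) * ((2ℝ * ∣ x ∣) * ∣ y - x ∣)
  riemannSum-remainder x y n = begin
    ∣ (riemannSum 0ℝ y arctan′ N - riemannSum 0ℝ x arctan′ N) - arctan′ x * d ∣
      ≈⟨ ∣∣-cong (+-congʳ (+-cong (riemannSum-rescale y n) (-‿cong (riemannSum-rescale x n)))) ⟩
    ∣ (w * Σ< N (φ y) - w * Σ< N (φ x)) - arctan′ x * d ∣
      ≈⟨ ∣∣-cong (solve 6 (λ w a b s t d → (w :* a :- w :* b) :- t :* d := w :* ((a :- b) :- d :* s) :+ (:- ((t :- w :* s) :* d)))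
          ≃-refl w (Σ< N (φ y)) (Σ< N (φ x)) (Σ< N σ) (arctan′ x) d) ⟩
    ∣ w * ((Σ< N (φ y) - Σ< N (φ x)) - d * Σ< N σ) + - ((arctan′ x - w * Σ< N σ) * d) ∣
      ≤⟨ ∣x+y∣≤∣x∣+∣y∣ _ _ ⟩
    ∣ w * ((Σ< N (φ y) - Σ< N (φ x)) - d * Σ< N σ) ∣ + ∣ - ((arctan′ x - w * Σ< N σ) * d) ∣
      ≤⟨ +-mono-≤ first second ⟩
    2ℝ * (d * d) + fromℚ (1/suc n) * ((2ℝ * ∣ x ∣) * ∣ d ∣) ∎
    where
    N : ℕ
    N = suc n
    d w : ℝ
    d = y - x
    w = width n
    φ : ℝ → ℕ → ℝ
    φ z k = z * arctan′ (point n k * z)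
    σ : ℕ → ℝ
    σ k = slope x (point n k)
    merge : (Σ< N (φ y) - Σ< N (φ x)) - d * Σ< N σ ≃ Σ< N (λ k → (φ y k - φ x k) - slope (point n k) x * d)
    merge = ≃-trans (+-cong (Σ<-- N (φ y) (φ x)) (-‿cong (≃-trans (Σ<-*ˡ N d σ)
        (Σ<-cong N λ k → ≃-trans (*-congˡ (slope-sym x (point n k))) (*-comm d (slope (point n k) x))))))
      (Σ<-- N (λ k → φ y k - φ x k) (λ k → slope (point n k) x * d))
    first : ∣ w * ((Σ< N (φ y) - Σ< N (φ x)) - d * Σ< N σ) ∣ ≤ 2ℝ * (d * d)
    first = ≤-trans (≤-reflexive (∣∣-cong (*-congˡ merge)))
      (∣width*Σ∣≤ n _ (2ℝ * (d * d)) λ k k<N → begin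
        ∣ (φ y k - φ x k) - slope (point n k) x * d ∣      ≤⟨ slope-remainder (point n k) x y ⟩
        (2ℝ * ∣ point n k ∣) * (d * d)                     ≤⟨ *-monoʳ-≤ (λ i → square-nonNeg (seq d i))
          (*-monoˡ-≤ (fromℚ-nonNeg (+-nonNeg 0≤1 0≤1)) (∣point∣≤1 n k (ℕₚ.<⇒≤ k<N))) ⟩
        (2ℝ * 1ℝ) * (d * d)                                ≈⟨ *-congʳ (*-identityʳ 2ℝ) ⟩
        2ℝ * (d * d)                                       ∎)
    second : ∣ - ((arctan′ x - w * Σ< N σ) * d) ∣ ≤ fromℚ (1/suc n) * ((2ℝ * ∣ x ∣) * ∣ d ∣)
    second = begin
      ∣ - ((arctan′ x - w * Σ< N σ) * d) ∣          ≈⟨ ∣-x∣≃∣x∣ _ ⟩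
      ∣ (arctan′ x - w * Σ< N σ) * d ∣              ≈⟨ ∣x*y∣≃∣x∣*∣y∣ _ _ ⟩
      ∣ arctan′ x - w * Σ< N σ ∣ * ∣ d ∣            ≤⟨ *-monoʳ-≤ (∣∣-nonNeg d) (slope-integral x n) ⟩
      (fromℚ (1/suc n) * (2ℝ * ∣ x ∣)) * ∣ d ∣      ≈⟨ *-assoc _ _ _ ⟩
      fromℚ (1/suc n) * ((2ℝ * ∣ x ∣) * ∣ d ∣)      ∎

  arctan-converges : ∀ x → (λ n → riemannSum 0ℝ x arctan′ (suc n)) ⟶ arctan x
  arctan-converges x = ∫-converges 0ℝ x arctan′ (arctan′-uniformlyContinuous 0ℝ x)

  arctan-remainder : ∀ x y → ∣ (arctan y - arctan x) - arctan′ x * (y - x) ∣ ≤ 2ℝ * ((y - x) * (y - x))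
  arctan-remainder x y = ⟶-∣∣-mono
    (⟶-+ (⟶-+ (arctan-converges y) (⟶-neg (arctan-converges x))) (⟶-const (- (arctan′ x * (y - x)))))
    (⟶-rate {λ n → 2ℝ * ((y - x) * (y - x)) + fromℚ (1/suc n) * c} c λ n → ≤-reflexive (≃-trans
      (∣∣-cong (solve 2 (λ a b → a :- (a :+ b) := :- b) ≃-refl (2ℝ * ((y - x) * (y - x))) (fromℚ (1/suc n) * c)))
      (≃-trans (∣-x∣≃∣x∣ (fromℚ (1/suc n) * c)) (≃-trans (∣c*x∣≃c*∣x∣ c (ℚₚ.<⇒≤ (1/suc-pos n))) (*-congˡ ∣c∣≃c)))))
    (riemannSum-remainder x y)
    where
    c : ℝ
    c = (2ℝ * ∣ x ∣) * ∣ y - x ∣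
    ∣c∣≃c : ∣ c ∣ ≃ c
    ∣c∣≃c = ≃-pointwise λ n → ℚₚ.0≤p⇒∣p∣≡p
      (*-nonNeg (*-nonNeg (+-nonNeg 0≤1 0≤1) (∣∣-nonNeg x n)) (∣∣-nonNeg (y - x) n))

  arctan-0 : arctan 0ℝ ≃ 0ℝ
  arctan-0 = ⟶-unique (arctan-converges 0ℝ) (⟶-resp (λ n → ≃-sym (vanish n)) ≃-refl (⟶-const 0ℝ))
    where
    vanish : ∀ n → riemannSum 0ℝ 0ℝ arctan′ (suc n) ≃ 0ℝ
    vanish n = solve 2 (λ w s → (w :* (con 0ℚ :- con 0ℚ)) :* s := con 0ℚ) ≃-refl
      (fromℚ (1ℚ /ₙ suc n)) (Σ< (suc n) (λ k → arctan′ (0ℝ + fromℚ (fromℕ k) * mesh 0ℝ 0ℝ (suc n))))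

open ArctanDerivative

-- Rules of differentiation and the fundamental theorem

module Calculus where
  open ℝ-Solver
  open ≤-Reasoning

  -- The bounds on F, on its increments and on f are the data from which the remainder of a product
  -- is estimated.
  record Derivative (F f : ℝ → ℝ) : Set where
    field
      boundedLipschitz : BoundedLipschitz F
      bound′           : ℚ
      remainder        : ℚ
      0≤bound′         : 0ℚ ℚ.≤ bound′
      0≤remainder      : 0ℚ ℚ.≤ remainder
      bounds′          : ∀ x → ∣ x ∣ ≤ 1ℝ → ∣ f x ∣ ≤ fromℚ bound′
      quadratic        : ∀ x y → ∣ x ∣ ≤ 1ℝ → ∣ y ∣ ≤ 1ℝ →
                         ∣ (F y - F x) - f x * (y - x) ∣ ≤ fromℚ remainder * ((y - x) * (y - x))

  open Derivative

  derivative-resp : ∀ {F f g} → (∀ x → f x ≃ g x) → Derivative F f → Derivative F g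
  derivative-resp e p = record
    { boundedLipschitz = boundedLipschitz p ; bound′ = bound′ p ; remainder = remainder p
    ; 0≤bound′ = 0≤bound′ p ; 0≤remainder = 0≤remainder p
    ; bounds′ = λ x h → ≤-trans (≤-reflexive (∣∣-cong (≃-sym (e x)))) (bounds′ p x h)
    ; quadratic = λ x y h k → ≤-trans (≤-reflexive (∣∣-cong (+-congˡ (-‿cong (*-congʳ (≃-sym (e x))))))) (quadratic p x y h k) }

  0≤c*square : ∀ {c} x → 0ℚ ℚ.≤ c → 0ℝ ≤ fromℚ c * (x * x)
  0≤c*square x 0≤c = ≤-pointwise λ n → *-nonNeg 0≤c (square-nonNeg (seq x n))

  1-derivative : Derivative (λ _ → 1ℝ) (λ _ → 0ℝ)
  1-derivative = record
    { boundedLipschitz = 1-boundedLipschitz ; bound′ = 0ℚ ; remainder = 0ℚ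
    ; 0≤bound′ = ℚₚ.≤-refl ; 0≤remainder = ℚₚ.≤-refl
    ; bounds′ = λ _ _ → ≤-reflexive (∣fromℚ∣≃ ℚₚ.≤-refl)
    ; quadratic = λ x y _ _ → ≤-trans (≤-reflexive (≃-trans
        (∣∣-cong (solve 1 (λ d → (con 1ℚ :- con 1ℚ) :- con 0ℚ :* d := con 0ℚ) ≃-refl (y - x))) (∣fromℚ∣≃ ℚₚ.≤-refl)))
        (0≤c*square (y - x) ℚₚ.≤-refl) }

  id-derivative : Derivative (λ x → x) (λ _ → 1ℝ)
  id-derivative = record
    { boundedLipschitz = id-boundedLipschitz ; bound′ = 1ℚ ; remainder = 0ℚ
    ; 0≤bound′ = 0≤1 ; 0≤remainder = ℚₚ.≤-refl
    ; bounds′ = λ _ _ → ≤-reflexive (∣fromℚ∣≃ 0≤1)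
    ; quadratic = λ x y _ _ → ≤-trans (≤-reflexive (≃-trans
        (∣∣-cong (solve 1 (λ d → d :- con 1ℚ :* d := con 0ℚ) ≃-refl (y - x))) (∣fromℚ∣≃ ℚₚ.≤-refl)))
        (0≤c*square (y - x) ℚₚ.≤-refl) }

  arctan-derivative : Derivative arctan arctan′
  arctan-derivative = record
    { boundedLipschitz = arctan-boundedLipschitz ; bound′ = 1ℚ ; remainder = 2ℚ
    ; 0≤bound′ = 0≤1 ; 0≤remainder = +-nonNeg 0≤1 0≤1
    ; bounds′ = λ x _ → ∣arctan′∣≤1 x
    ; quadratic = λ x y _ _ → arctan-remainder x y }

  *-derivative : ∀ {F f G g} → Derivative F f → Derivative G g → Derivative (λ x → F x * G x) (λ x → f x * G x + F x * g x)
  *-derivative {F} {f} {G} {g} p q = record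
    { boundedLipschitz = *-boundedLipschitz P Q
    ; bound′ = B′ ℚ.* D ℚ.+ B ℚ.* D′
    ; remainder = (D ℚ.* M ℚ.+ B ℚ.* N) ℚ.+ B′ ℚ.* L
    ; 0≤bound′ = +-nonNeg (*-nonNeg (0≤bound′ p) 0≤D) (*-nonNeg 0≤B (0≤bound′ q))
    ; 0≤remainder = +-nonNeg (+-nonNeg (*-nonNeg 0≤D (0≤remainder p)) (*-nonNeg 0≤B (0≤remainder q)))
                             (*-nonNeg (0≤bound′ p) (ℚₚ.<⇒≤ (constant-pos Q)))
    ; bounds′ = λ x h → begin
        ∣ f x * G x + F x * g x ∣              ≤⟨ ∣x+y∣≤∣x∣+∣y∣ _ _ ⟩
        ∣ f x * G x ∣ + ∣ F x * g x ∣          ≤⟨ +-mono-≤ (∣∣-mono-* (fromℚ D) (bounds′ p x h) (0≤bound′ p) (bounds Q x h))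
                                                          (∣∣-mono-* (fromℚ D′) (bounds P x h) 0≤B (bounds′ q x h)) ⟩
        fromℚ B′ * fromℚ D + fromℚ B * fromℚ D′ ≈⟨ ≃-pointwise (λ _ → refl) ⟩
        fromℚ (B′ ℚ.* D ℚ.+ B ℚ.* D′)          ∎
    ; quadratic = λ x y h k → let d = y - x in begin
        ∣ (F y * G y - F x * G x) - (f x * G x + F x * g x) * d ∣
          -- Two remainders and one cross term. The cross term is quadratic in d because G is
          -- Lipschitz.
          ≈⟨ ∣∣-cong (solve 7 (λ Fx Fy Gx Gy fx gx d →
               (Fy :* Gy :- Fx :* Gx) :- (fx :* Gx :+ Fx :* gx) :* d
               := (Gy :* ((Fy :- Fx) :- fx :* d) :+ Fx :* ((Gy :- Gx) :- gx :* d)) :+ fx :* (d :* (Gy :- Gx)))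
               ≃-refl (F x) (F y) (G x) (G y) (f x) (g x) d) ⟩
        ∣ (G y * ((F y - F x) - f x * d) + F x * ((G y - G x) - g x * d)) + f x * (d * (G y - G x)) ∣
          ≤⟨ ≤-trans (∣x+y∣≤∣x∣+∣y∣ _ _) (+-mono-≤ (∣x+y∣≤∣x∣+∣y∣ _ _) ≤-refl) ⟩
        (∣ G y * ((F y - F x) - f x * d) ∣ + ∣ F x * ((G y - G x) - g x * d) ∣) + ∣ f x * (d * (G y - G x)) ∣
          ≤⟨ +-mono-≤ (+-mono-≤
               (∣∣-mono-* (fromℚ M * (d * d)) (bounds Q y k) 0≤D (quadratic p x y h k))
               (∣∣-mono-* (fromℚ N * (d * d)) (bounds P x h) 0≤B (quadratic q x y h k)))
               (∣∣-mono-* (fromℚ L * (d * d)) (bounds′ p x h) (0≤bound′ p) (increment d (lipschitz Q y x k h))) ⟩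
        (fromℚ D * (fromℚ M * (d * d)) + fromℚ B * (fromℚ N * (d * d))) + fromℚ B′ * (fromℚ L * (d * d))
          ≈⟨ solve 7 (λ D M B N B′ L d →
               (D :* (M :* d) :+ B :* (N :* d)) :+ B′ :* (L :* d) := ((D :* M :+ B :* N) :+ B′ :* L) :* d)
               ≃-refl (fromℚ D) (fromℚ M) (fromℚ B) (fromℚ N) (fromℚ B′) (fromℚ L) (d * d) ⟩
        ((fromℚ D * fromℚ M + fromℚ B * fromℚ N) + fromℚ B′ * fromℚ L) * (d * d)
          ≈⟨ *-congʳ (≃-pointwise (λ _ → refl)) ⟩
        fromℚ ((D ℚ.* M ℚ.+ B ℚ.* N) ℚ.+ B′ ℚ.* L) * (d * d) ∎ }
    where
    P : BoundedLipschitz F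
    P = boundedLipschitz p
    Q : BoundedLipschitz G
    Q = boundedLipschitz q
    B B′ D D′ L M N : ℚ
    B  = bound P
    B′ = bound′ p
    D  = bound Q
    D′ = bound′ q
    L  = constant Q
    M  = remainder p
    N  = remainder q
    0≤B : 0ℚ ℚ.≤ B
    0≤B = ℚₚ.<⇒≤ (bound-pos P)
    0≤D : 0ℚ ℚ.≤ D
    0≤D = ℚₚ.<⇒≤ (bound-pos Q)
    increment : ∀ d {z} → ∣ z ∣ ≤ fromℚ L * ∣ d ∣ → ∣ d * z ∣ ≤ fromℚ L * (d * d)
    increment d {z} hz = begin
      ∣ d * z ∣                    ≈⟨ ∣x*y∣≃∣x∣*∣y∣ d z ⟩
      ∣ d ∣ * ∣ z ∣                ≤⟨ *-monoˡ-≤ (∣∣-nonNeg d) hz ⟩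
      ∣ d ∣ * (fromℚ L * ∣ d ∣)    ≈⟨ solve 2 (λ l d → d :* (l :* d) := l :* (d :* d)) ≃-refl (fromℚ L) ∣ d ∣ ⟩
      fromℚ L * (∣ d ∣ * ∣ d ∣)    ≈⟨ *-congˡ (≃-trans (≃-sym (∣x*y∣≃∣x∣*∣y∣ d d)) (∣x*x∣≃x*x d)) ⟩
      fromℚ L * (d * d)            ∎

  -- At n = 0 the truncated exponent `n ∸ 1` is 0, which is harmless under the coefficient 0.
  ^-derivative : ∀ {F f} → Derivative F f → ∀ n → Derivative (λ x → F x ^ n) (λ x → (fromℚ (fromℕ n) * F x ^ (n ℕ.∸ 1)) * f x)
  ^-derivative {F} {f} p zero = derivative-resp (λ x → solve 1 (λ a → con 0ℚ := (con 0ℚ :* con 1ℚ) :* a) ≃-refl (f x)) 1-derivative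
  ^-derivative {F} {f} p (suc n) = derivative-resp (power n) (*-derivative p (^-derivative p n))
    where
    power : ∀ n x → f x * F x ^ n + F x * ((fromℚ (fromℕ n) * F x ^ (n ℕ.∸ 1)) * f x) ≃ (fromℚ (fromℕ (suc n)) * F x ^ n) * f x
    power zero    x = solve 2 (λ F f → f :* con 1ℚ :+ F :* ((con 0ℚ :* con 1ℚ) :* f) := (con 1ℚ :* con 1ℚ) :* f) ≃-refl (F x) (f x)
    power (suc n) x = ≃-trans
      (solve 4 (λ F f z k → f :* (F :* z) :+ F :* ((k :* z) :* f) := ((con 1ℚ :+ k) :* (F :* z)) :* f) ≃-refl
        (F x) (f x) (F x ^ n) (fromℚ (fromℕ (suc n))))
      (*-congʳ (*-congʳ (≃-trans (≃-sym (fromℚ-+ 1ℚ (fromℕ (suc n)))) (fromℚ-cong (≡.sym (fromℕ-suc (suc n)))))))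

  fundamentalTheorem : ∀ {F f} → Derivative F f → Integral f (F 1ℝ - F 0ℝ)
  fundamentalTheorem {F} {f} p = mkIntegral (⟶-rate (fromℚ (remainder p)) (antiderivative-rate F f (fromℚ (remainder p)) (quadratic p) F-cong))
    where
    P : BoundedLipschitz F
    P = boundedLipschitz p
    -- F is an arbitrary function on representatives; its Lipschitz bound is what makes it respect
    -- `≃`.
    F-cong : ∀ {x y} → ∣ x ∣ ≤ 1ℝ → ∣ y ∣ ≤ 1ℝ → x ≃ y → F x ≃ F y
    F-cong {x} {y} h k e = close⇒≃ λ ε 0<ε → begin
      ∣ F x - F y ∣                     ≤⟨ lipschitz P x y h k ⟩
      fromℚ (constant P) * ∣ x - y ∣    ≈⟨ *-congˡ (∣∣-cong (≃-trans (+-congʳ e) (solve 1 (λ a → a :- a := con 0ℚ) ≃-refl y))) ⟩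
      fromℚ (constant P) * ∣ 0ℝ ∣       ≈⟨ ≃-trans (*-congˡ (∣fromℚ∣≃ ℚₚ.≤-refl)) (zeroʳ _) ⟩
      0ℝ                                ≤⟨ fromℚ-mono-≤ (ℚₚ.<⇒≤ 0<ε) ⟩
      fromℚ ε                           ∎

  riemannSum-cong : ∀ {f g} → (∀ x → f x ≃ g x) → ∀ n → riemannSum 0ℝ 1ℝ f (suc n) ≃ riemannSum 0ℝ 1ℝ g (suc n)
  riemannSum-cong e n = *-congˡ (Σ<-cong (suc n) λ k → e (point n k))

  integral-resp : ∀ {f g L M} → (∀ x → f x ≃ g x) → L ≃ M → Integral f L → Integral g M
  integral-resp e d h = mkIntegral (⟶-resp (riemannSum-cong e) d (converges h))

  integral-unique : ∀ {f g L M} → (∀ x → f x ≃ g x) → Integral f L → Integral g M → L ≃ M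
  integral-unique e h k = ⟶-unique (converges (integral-resp e ≃-refl h)) (converges k)

  integral-+ : ∀ {f g L M} → Integral f L → Integral g M → Integral (λ x → f x + g x) (L + M)
  integral-+ {f} {g} h k = mkIntegral (⟶-resp
    (λ n → ≃-trans (≃-sym (distribˡ (width n) _ _)) (*-congˡ (≃-sym (Σ<-+ (suc n) (λ i → f (point n i)) (λ i → g (point n i))))))
    ≃-refl (⟶-+ (converges h) (converges k)))

  integral-* : ∀ {f L} c → Integral f L → Integral (λ x → c * f x) (c * L)
  integral-* {f} c h = mkIntegral (⟶-resp
    (λ n → ≃-trans (solve 3 (λ c w s → c :* (w :* s) := w :* (c :* s)) ≃-refl c (width n) (Σ< (suc n) λ i → f (point n i)))
      (*-congˡ (Σ<-*ˡ (suc n) c λ i → f (point n i))))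
    ≃-refl (⟶-* c (converges h)))

  ∫-integral : ∀ f uc → Integral f (∫ 0ℝ 1ℝ f uc)
  ∫-integral f uc = mkIntegral (∫-converges 0ℝ 1ℝ f uc)

open Calculus

-- The moments of powers of arctan and their recurrence

integrand : ℕ → ℕ → ℝ → ℝ
integrand k p x = x ^ k * arctan x ^ p

-- Abstract, since deciding the conversion of two integrals by unfolding them is infeasible.
abstract
  I : ℕ → ℕ → ℝ
  I k p = ∫ 0ℝ 1ℝ (integrand k p) (x^arctan^-uniformlyContinuous k p)

  integral-I : ∀ k p → Integral (integrand k p) (I k p)
  integral-I k p = ∫-integral (integrand k p) (x^arctan^-uniformlyContinuous k p)

≡⇒≃ : ∀ {x y} → x ≡ y → x ≃ y
≡⇒≃ refl = ≃-refl

1^n≃1 : ∀ n → 1ℝ ^ n ≃ 1ℝ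
1^n≃1 zero    = ≃-refl
1^n≃1 (suc n) = ≃-trans (*-identityˡ _) (1^n≃1 n)

sumBelow-suc : ∀ n f → sumBelow ℚ._+_ 0ℚ (suc n) f ≡ sumBelow ℚ._+_ 0ℚ n f ℚ.+ f n
sumBelow-suc zero    f = ℚₚ.+-comm (f 0) 0ℚ
sumBelow-suc (suc n) f = ≡.trans (cong (f 0 ℚ.+_) (sumBelow-suc n λ i → f (suc i))) (≡.sym (ℚₚ.+-assoc (f 0) _ _))

module Integrals where
  open ℝ-Solver
  open ≤-Reasoning

  integrand-derivative : ∀ k p → Derivative (integrand k p) (λ x →
    ((fromℚ (fromℕ k) * x ^ (k ℕ.∸ 1)) * 1ℝ) * arctan x ^ p
      + x ^ k * ((fromℚ (fromℕ p) * arctan x ^ (p ℕ.∸ 1)) * arctan′ x))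
  integrand-derivative k p = *-derivative (^-derivative id-derivative k) (^-derivative arctan-derivative p)

  ∫≃I : ∀ {f} uc k p → (∀ x → f x ≃ integrand k p x) → ∫ 0ℝ 1ℝ f uc ≃ I k p
  ∫≃I {f} uc k p e = integral-unique e (∫-integral f uc) (integral-I k p)

  -- The derivative of x ↦ xᵏ (1 + x²) arctanᵖ⁺¹ x contains no factor 1/(1+x²).
  I-recurrence : ∀ k p → (fromℚ (fromℕ k) * I (k ℕ.∸ 1) (suc p) + fromℚ (fromℕ (suc (suc k))) * I (suc k) (suc p))
                           + fromℚ (fromℕ (suc p)) * I k p ≃ 2ℝ * arctan 1ℝ ^ suc p
  I-recurrence k p = integral-unique (λ x → ≃-sym (expand x))
    (integral-+ (integral-+ (integral-* _ (integral-I (k ℕ.∸ 1) (suc p))) (integral-* _ (integral-I (suc k) (suc p))))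
      (integral-* _ (integral-I k p)))
    (integral-resp (λ _ → ≃-refl) (≃-trans (+-cong (ends k) (ends (suc (suc k)))) double)
      (integral-+ (fundamentalTheorem (integrand-derivative k (suc p))) (fundamentalTheorem (integrand-derivative (suc (suc k)) (suc p)))))
    where
    a : ℝ
    a = arctan 1ℝ ^ suc p
    -- The positive power of arctan 0 = 0 removes the lower endpoint for every k, also for k = 0,
    -- where `0ℝ ^ k` is 1.
    ends : ∀ k → integrand k (suc p) 1ℝ - integrand k (suc p) 0ℝ ≃ a
    ends k = ≃-trans (+-cong (≃-trans (*-congʳ (1^n≃1 k)) (*-identityˡ a)) (-‿cong (*-congˡ (*-congʳ arctan-0))))
      (solve 3 (λ a b c → a :- b :* (con 0ℚ :* c) := a) ≃-refl a (0ℝ ^ k) (arctan 0ℝ ^ p))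
    double : a + a ≃ 2ℝ * a
    double = solve 1 (λ a → a :+ a := con 2ℚ :* a) ≃-refl a
    interchange : ∀ a b c d → (a + b) + (c + d) ≃ (a + c) + (b + d)
    interchange = solve 4 (λ a b c d → (a :+ b) :+ (c :+ d) := (a :+ c) :+ (b :+ d)) ≃-refl
    pull : ∀ a b c → ((a * b) * 1ℝ) * c ≃ a * (b * c)
    pull = solve 3 (λ a b c → ((a :* b) :* con 1ℚ) :* c := a :* (b :* c)) ≃-refl
    cancel : ∀ P x z w d → z * ((P * w) * d) + (x * (x * z)) * ((P * w) * d) ≃ (P * (z * w)) * (d * (1ℝ + x * x))
    cancel = solve 5 (λ P x z w d → z :* ((P :* w) :* d) :+ (x :* (x :* z)) :* ((P :* w) :* d)
      := (P :* (z :* w)) :* (d :* (con 1ℚ :+ x :* x))) ≃-refl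
    expand : ∀ x →
      (((fromℚ (fromℕ k) * x ^ (k ℕ.∸ 1)) * 1ℝ) * arctan x ^ suc p + x ^ k * ((fromℚ (fromℕ (suc p)) * arctan x ^ p) * arctan′ x))
      + (((fromℚ (fromℕ (suc (suc k))) * x ^ suc k) * 1ℝ) * arctan x ^ suc p
          + x ^ (suc (suc k)) * ((fromℚ (fromℕ (suc p)) * arctan x ^ p) * arctan′ x))
      ≃ (fromℚ (fromℕ k) * integrand (k ℕ.∸ 1) (suc p) x + fromℚ (fromℕ (suc (suc k))) * integrand (suc k) (suc p) x)
        + fromℚ (fromℕ (suc p)) * integrand k p x
    expand x = ≃-trans (interchange _ _ _ _) (+-cong (+-cong (pull (fromℚ (fromℕ k)) (x ^ (k ℕ.∸ 1)) (arctan x ^ suc p))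
        (pull (fromℚ (fromℕ (suc (suc k)))) (x ^ suc k) (arctan x ^ suc p)))
      (≃-trans (cancel (fromℚ (fromℕ (suc p))) x (x ^ k) (arctan x ^ p) (arctan′ x))
        (≃-trans (*-congˡ (arctan′-inverse x)) (*-identityʳ _))))

  -- Starts the induction at exponent 0 and integrates the terms of the geometric series.
  I-power : ∀ k → fromℚ (fromℕ (suc k)) * I k 0 ≃ 1ℝ
  I-power k = integral-unique (λ x → ≃-sym (expand x)) (integral-* _ (integral-I k 0))
    (integral-resp (λ _ → ≃-refl) ends (fundamentalTheorem (integrand-derivative (suc k) 0)))
    where
    ends : integrand (suc k) 0 1ℝ - integrand (suc k) 0 0ℝ ≃ 1ℝ
    ends = ≃-trans (+-congʳ (*-congʳ (1^n≃1 (suc k))))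
      (solve 1 (λ z → con 1ℚ :* con 1ℚ :- (con 0ℚ :* z) :* con 1ℚ := con 1ℚ) ≃-refl (0ℝ ^ k))
    expand : ∀ x → ((fromℚ (fromℕ (suc k)) * x ^ k) * 1ℝ) * 1ℝ + x ^ suc k * ((0ℝ * 1ℝ) * arctan′ x)
      ≃ fromℚ (fromℕ (suc k)) * integrand k 0 x
    expand x = solve 4 (λ K z w d → ((K :* z) :* con 1ℚ) :* con 1ℚ :+ w :* ((con 0ℚ :* con 1ℚ) :* d) := K :* (z :* con 1ℚ)) ≃-refl
      (fromℚ (fromℕ (suc k))) (x ^ k) (x ^ suc k) (arctan′ x)

  I-0 : ∀ p → I 0 p ≃ A p
  I-0 p = integral-unique (λ x → *-identityˡ (arctan x ^ p)) (integral-I 0 p)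
    (∫-integral (λ x → arctan x ^ p) (arctan^-uniformlyContinuous p))

open Integrals

-- Leibniz's series for arctan 1

module LeibnizSeries where
  open ℝ-Solver
  open ≤-Reasoning

  -- 1/(1+x²) minus the first N terms of its geometric series.
  geometricRemainder : ℕ → ℝ → ℝ
  geometricRemainder N x = fromℚ (-1^ N) * (x ^ (2 ℕ.* N) * arctan′ x)

  ^-2*suc : ∀ (x : ℝ) N → x ^ (2 ℕ.* suc N) ≃ (x * x) * x ^ (2 ℕ.* N)
  ^-2*suc x N = ≃-trans (≡⇒≃ (cong (x ^_) (ℕₚ.*-suc 2 N))) (≃-sym (*-assoc x x _))

  -1^-suc : ∀ N → fromℚ (-1^ suc N) ≃ - fromℚ (-1^ N)
  -1^-suc N = ≃-trans (fromℚ-* (ℚ.- 1ℚ) (-1^ N)) (solve 1 (λ s → con (ℚ.- 1ℚ) :* s := :- s) ≃-refl (fromℚ (-1^ N)))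

  -- The identity x² `arctan′` x = 1 - `arctan′` x splits off the next term of the geometric series.
  remainder-suc : ∀ N x → geometricRemainder (suc N) x ≃ geometricRemainder N x + fromℚ (-1^ suc N) * integrand (2 ℕ.* N) 0 x
  remainder-suc N x = ≃-trans (*-cong (-1^-suc N) (*-congʳ (^-2*suc x N))) (≃-trans
    (solve 4 (λ s x z d → :- s :* (((x :* x) :* z) :* d) := (s :* (z :* d) :+ :- s :* (z :* (d :* (con 1ℚ :+ x :* x))))) ≃-refl
      (fromℚ (-1^ N)) x (x ^ (2 ℕ.* N)) (arctan′ x))
    (+-congˡ (*-cong (≃-sym (-1^-suc N)) (*-congˡ (arctan′-inverse x)))))

  term : ℕ → ℚ
  term k = (-1^ k) /ₙ (2 ℕ.* k ℕ.∸ 1)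

  I-2N : ∀ N → I (2 ℕ.* N) 0 ≃ fromℚ (1/suc (2 ℕ.* N))
  I-2N N = ≃-trans (≃-sym (≃-trans (*-congʳ (≃-trans (≃-sym (fromℚ-* (fromℕ (suc (2 ℕ.* N))) (1/suc (2 ℕ.* N)))) (fromℚ-cong (1/suc-inverse (2 ℕ.* N))))) (*-identityˡ _)))
    (≃-trans (solve 3 (λ a b c → (a :* b) :* c := b :* (a :* c)) ≃-refl (fromℚ (fromℕ (suc (2 ℕ.* N)))) (fromℚ (1/suc (2 ℕ.* N))) (I (2 ℕ.* N) 0))
      (≃-trans (*-congˡ (I-power (2 ℕ.* N))) (*-identityʳ _)))

  2*suc∸1 : ∀ N → 2 ℕ.* suc N ℕ.∸ 1 ≡ suc (2 ℕ.* N)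
  2*suc∸1 N = cong (ℕ._∸ 1) (ℕₚ.*-suc 2 N)

  -- For N = 0 this is the definition of arctan 1. Each further term of the geometric series
  -- integrates to (-1)^(N+1)/(2N+1), the next term of the series for `t̄1`.
  remainder-integral : ∀ N → Integral (geometricRemainder N) (arctan 1ℝ + fromℚ (t̄1-partialSum N))
  remainder-integral zero = integral-resp
    (λ x → solve 1 (λ d → d := con 1ℚ :* (con 1ℚ :* d)) ≃-refl (arctan′ x)) (≃-sym (+-identityʳ _)) (mkIntegral (arctan-converges 1ℝ))
  remainder-integral (suc N) = integral-resp (λ x → ≃-sym (remainder-suc N x)) total
    (integral-+ (remainder-integral N) (integral-* (fromℚ (-1^ suc N)) (integral-I (2 ℕ.* N) 0)))
    where
    new : fromℚ (-1^ suc N) * I (2 ℕ.* N) 0 ≃ fromℚ (term (suc N))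
    new = ≃-trans (*-congˡ (I-2N N)) (≃-trans (≃-sym (fromℚ-* (-1^ suc N) (1/suc (2 ℕ.* N))))
      (fromℚ-cong (cong ((-1^ suc N) /ₙ_) (≡.sym (2*suc∸1 N)))))
    total : (arctan 1ℝ + fromℚ (t̄1-partialSum N)) + fromℚ (-1^ suc N) * I (2 ℕ.* N) 0 ≃ arctan 1ℝ + fromℚ (t̄1-partialSum (suc N))
    total = ≃-trans (+-congˡ new) (≃-trans (CommutativeRing.+-assoc ℝ-commutativeRing _ _ _) (+-congˡ
      (≃-trans (≃-sym (fromℚ-+ (t̄1-partialSum N) (term (suc N)))) (fromℚ-cong (≡.sym (sumBelow-suc N λ i → term (suc i)))))))

  ∣x^2N∣ : ∀ x N → ∣ x ^ (2 ℕ.* N) ∣ ≃ x ^ (2 ℕ.* N)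
  ∣x^2N∣ x zero    = ∣fromℚ∣≃ 0≤1
  ∣x^2N∣ x (suc N) = ≃-trans (∣∣-cong (^-2*suc x N)) (≃-trans (∣x*y∣≃∣x∣*∣y∣ (x * x) _)
    (≃-trans (*-cong (∣x*x∣≃x*x x) (∣x^2N∣ x N)) (≃-sym (^-2*suc x N))))

  remainder-bound : ∀ N x → ∣ geometricRemainder N x ∣ ≤ integrand (2 ℕ.* N) 0 x
  remainder-bound N x = begin
    ∣ geometricRemainder N x ∣                              ≈⟨ ∣x*y∣≃∣x∣*∣y∣ _ _ ⟩
    ∣ fromℚ (-1^ N) ∣ * ∣ x ^ (2 ℕ.* N) * arctan′ x ∣       ≈⟨ *-cong (≃-pointwise (λ _ → AlternatingSeries.∣-1^n∣ N)) (∣x*y∣≃∣x∣*∣y∣ _ _) ⟩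
    1ℝ * (∣ x ^ (2 ℕ.* N) ∣ * ∣ arctan′ x ∣)                ≈⟨ *-identityˡ _ ⟩
    ∣ x ^ (2 ℕ.* N) ∣ * ∣ arctan′ x ∣                       ≤⟨ *-monoˡ-≤ (∣∣-nonNeg (x ^ (2 ℕ.* N))) (∣arctan′∣≤1 x) ⟩
    ∣ x ^ (2 ℕ.* N) ∣ * 1ℝ                                  ≈⟨ *-congʳ (∣x^2N∣ x N) ⟩
    integrand (2 ℕ.* N) 0 x                                 ∎

  -- Because |`arctan′`| ≤ 1, the integrand is dominated by x^(2N), whose integral is 1/(2N+1).
  remainder-small : ∀ N → ∣ arctan 1ℝ + fromℚ (t̄1-partialSum N) ∣ ≤ fromℚ (1/suc N)
  remainder-small N = ≤-trans
    (⟶-∣∣-mono (converges (remainder-integral N)) (converges (integral-I (2 ℕ.* N) 0)) (λ n → begin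
      ∣ width n * Σ< (suc n) (λ k → geometricRemainder N (point n k)) ∣      ≈⟨ ∣x*y∣≃∣x∣*∣y∣ _ _ ⟩
      ∣ width n ∣ * ∣ Σ< (suc n) (λ k → geometricRemainder N (point n k)) ∣  ≤⟨ *-monoˡ-≤ (∣∣-nonNeg (width n)) (≤-trans
        (Σ<-∣∣ (suc n) λ k → geometricRemainder N (point n k)) (Σ<-mono (suc n) λ k _ → remainder-bound N (point n k))) ⟩
      ∣ width n ∣ * Σ< (suc n) (λ k → integrand (2 ℕ.* N) 0 (point n k))     ≈⟨ *-congʳ (≃-trans (∣width∣ n) (≃-sym (width≃ n))) ⟩
      width n * Σ< (suc n) (λ k → integrand (2 ℕ.* N) 0 (point n k))         ∎))
    (≤-trans (≤-reflexive (I-2N N)) (fromℚ-mono-≤ (1/suc-antimono (ℕₚ.m≤m+n N _))))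

  arctan-1 : arctan 1ℝ ≃ - t̄1
  arctan-1 = ⟶-unique {λ N → - fromℚ (t̄1-partialSum N)}
    (⟶-rate 1ℝ λ N → ≤-trans (≤-reflexive (∣∣-cong (+-congˡ (solve 1 (λ t → :- :- t := t) ≃-refl (fromℚ (t̄1-partialSum N))))))
      (≤-trans (remainder-small N) (≤-reflexive (≃-sym (*-identityʳ _)))))
    -- `t̄1` is represented by its own partial sums and hence is their limit.
    (⟶-neg {λ N → fromℚ (t̄1-partialSum N)} (seq-approximates t̄1))

open LeibnizSeries using (arctan-1)

-- Reciprocals of natural numbers and powers of -1

module Reciprocals where
  open ℚ-Solver.+-*-Solver

  recipℕ : ℕ → ℚ
  recipℕ n = 1ℚ /ₙ n

  recipℕ-suc : ∀ n → recipℕ (suc n) ≡ 1/suc n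
  recipℕ-suc n = ℚₚ.*-identityˡ (1/suc n)

  /ₙ-recipℕ : ∀ q n → q /ₙ n ≡ q ℚ.* recipℕ n
  /ₙ-recipℕ q zero    = ≡.sym (ℚₚ.*-zeroʳ q)
  /ₙ-recipℕ q (suc n) = cong (q ℚ.*_) (≡.sym (recipℕ-suc n))

  recipℕ-inverse : ∀ n .{{_ : ℕ.NonZero n}} → fromℕ n ℚ.* recipℕ n ≡ 1ℚ
  recipℕ-inverse (suc n) = ≡.trans (cong (fromℕ (suc n) ℚ.*_) (recipℕ-suc n)) (1/suc-inverse n)

  -- The convention q / 0 = 0 makes this hold for all m and n, so the denominators of the theorem
  -- can be split without side conditions.
  recipℕ-* : ∀ m n → recipℕ (m ℕ.* n) ≡ recipℕ m ℚ.* recipℕ n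
  recipℕ-* zero    n       = ≡.sym (ℚₚ.*-zeroˡ (recipℕ n))
  recipℕ-* (suc m) zero    = ≡.trans (cong recipℕ (ℕₚ.*-zeroʳ m)) (≡.sym (ℚₚ.*-zeroʳ (recipℕ (suc m))))
  recipℕ-* (suc m) (suc n) = unique-inverse {recipℕ (suc m ℕ.* suc n)} {fromℕ (suc m ℕ.* suc n)} {recipℕ (suc m)} {recipℕ (suc n)}
    (recipℕ-inverse (suc m ℕ.* suc n))
    (≡.trans (cong (λ z → (z ℚ.* recipℕ (suc m)) ℚ.* recipℕ (suc n)) (fromℕ-* (suc m) (suc n)))
      (≡.trans (solve 4 (λ a b c d → ((a :* b) :* c) :* d := (a :* c) :* (b :* d)) refl
        (fromℕ (suc m)) (fromℕ (suc n)) (recipℕ (suc m)) (recipℕ (suc n)))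
        (cong₂ ℚ._*_ (recipℕ-inverse (suc m)) (recipℕ-inverse (suc n)))))

  -1^n*-1^n : ∀ n → -1^ n ℚ.* -1^ n ≡ 1ℚ
  -1^n*-1^n zero    = refl
  -1^n*-1^n (suc n) = ≡.trans (solve 1 (λ s → (con (ℚ.- 1ℚ) :* s) :* (con (ℚ.- 1ℚ) :* s) := s :* s) refl (-1^ n)) (-1^n*-1^n n)

  -1^-suc : ∀ n → -1^ suc n ≡ ℚ.- -1^ n
  -1^-suc n = solve 1 (λ s → con (ℚ.- 1ℚ) :* s := :- s) refl (-1^ n)

  -1^-+ : ∀ m n → -1^ (m ℕ.+ n) ≡ -1^ m ℚ.* -1^ n
  -1^-+ zero    n = ≡.sym (ℚₚ.*-identityˡ (-1^ n))
  -1^-+ (suc m) n = ≡.trans (cong ((ℚ.- 1ℚ) ℚ.*_) (-1^-+ m n)) (≡.sym (ℚₚ.*-assoc (ℚ.- 1ℚ) (-1^ m) (-1^ n)))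

  -1^-2* : ∀ n → -1^ (2 ℕ.* n) ≡ 1ℚ
  -1^-2* n = ≡.trans (-1^-+ n (n ℕ.+ 0)) (≡.trans (cong (λ k → -1^ n ℚ.* -1^ k) (ℕₚ.+-identityʳ n)) (-1^n*-1^n n))

open Reciprocals

-- Harmonic sums as iterated weighted sums

weightedSum : (ℕ → ℚ) → ℕ → (ℕ → ℚ) → ℚ
weightedSum w n x = sumBelow ℚ._+_ 0ℚ n (λ i → w i ℚ.* x i)

module WeightedSums where
  open ℚ-Solver.+-*-Solver

  weightedSum-cong : ∀ w n {x y} → (∀ i → x i ≡ y i) → weightedSum w n x ≡ weightedSum w n y
  weightedSum-cong w zero    e = refl
  weightedSum-cong w (suc n) e = cong₂ ℚ._+_ (cong (w 0 ℚ.*_) (e 0)) (weightedSum-cong (λ i → w (suc i)) n λ i → e (suc i))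

  weightedSum-linear : ∀ w n c x y → weightedSum w n (λ i → x i ℚ.+ c ℚ.* y i) ≡ weightedSum w n x ℚ.+ c ℚ.* weightedSum w n y
  weightedSum-linear w zero    c x y = solve 1 (λ c → con 0ℚ := con 0ℚ :+ c :* con 0ℚ) refl c
  weightedSum-linear w (suc n) c x y = ≡.trans
    (cong ((w 0 ℚ.* (x 0 ℚ.+ c ℚ.* y 0)) ℚ.+_) (weightedSum-linear (λ i → w (suc i)) n c (λ i → x (suc i)) (λ i → y (suc i))))
    (solve 6 (λ w x y c p q → w :* (x :+ c :* y) :+ (p :+ c :* q) := (w :* x :+ p) :+ c :* (w :* y :+ q)) refl
      (w 0) (x 0) (y 0) c (weightedSum (λ i → w (suc i)) n λ i → x (suc i)) (weightedSum (λ i → w (suc i)) n λ i → y (suc i)))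

  weightedSum-scale : ∀ w n c x → weightedSum w n (λ i → c ℚ.* x i) ≡ c ℚ.* weightedSum w n x
  weightedSum-scale w zero    c x = ≡.sym (ℚₚ.*-zeroʳ c)
  weightedSum-scale w (suc n) c x = ≡.trans
    (cong ((w 0 ℚ.* (c ℚ.* x 0)) ℚ.+_) (weightedSum-scale (λ i → w (suc i)) n c λ i → x (suc i)))
    (solve 4 (λ w x c p → w :* (c :* x) :+ c :* p := c :* (w :* x :+ p)) refl
      (w 0) (x 0) c (weightedSum (λ i → w (suc i)) n λ i → x (suc i)))

open WeightedSums

-- The ratios of the harmonic sums of depth 2v and 2v + 1 to the functions of `Tower`: a factor 2
-- for each summation and a sign for each pair of them.
evenScale oddScale : ℕ → ℚ
evenScale v = -1^ v ℚ.* fromℕ (2 ℕ.^ (2 ℕ.* v))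
oddScale  v = -1^ v ℚ.* fromℕ (2 ℕ.^ (2 ℕ.* v ℕ.+ 1))

oddScale≡ : ∀ v → oddScale v ≡ fromℕ 2 ℚ.* evenScale v
oddScale≡ v = ≡.trans (cong (-1^ v ℚ.*_) (≡.trans (cong (λ k → fromℕ (2 ℕ.^ k)) (ℕₚ.+-comm (2 ℕ.* v) 1)) (fromℕ-* 2 (2 ℕ.^ (2 ℕ.* v)))))
  (solve 3 (λ s t b → s :* (t :* b) := t :* (s :* b)) refl (-1^ v) (fromℕ 2) (fromℕ (2 ℕ.^ (2 ℕ.* v))))
  where open ℚ-Solver.+-*-Solver

evenScale-suc : ∀ v → evenScale (suc v) ≡ ℚ.- (fromℕ 2 ℚ.* oddScale v)
evenScale-suc v = ≡.trans
  (cong (-1^ suc v ℚ.*_) (≡.trans (cong (λ k → fromℕ (2 ℕ.^ k)) (≡.trans (ℕₚ.*-suc 2 v) (cong suc (ℕₚ.+-comm 1 (2 ℕ.* v)))))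
    (fromℕ-* 2 (2 ℕ.^ (2 ℕ.* v ℕ.+ 1)))))
  (solve 3 (λ s t b → (con (ℚ.- 1ℚ) :* s) :* (t :* b) := :- (t :* (s :* b))) refl (-1^ v) (fromℕ 2) (fromℕ (2 ℕ.^ (2 ℕ.* v ℕ.+ 1))))
  where open ℚ-Solver.+-*-Solver

-- With n = j + 1 this is (-1)ⁿ. It is both the factor contributed by a last sign -1 and the
-- normalised moment with exponent 0; this coincidence brings the superscripts {1}_p,-1 into the
-- formulas.
alternation : ℕ → ℚ
alternation j = -1^ suc j

-- The multiple T-harmonic sums iterate P, Q = V, U and the S-harmonic sums P, Q = U, V,
-- where V x (n-1) = Σ_{k ≤ n} x (k-1) / (2k-1) and U x (n-1) = Σ_{k < n} x (k-1) / 2k.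
-- The powers of 2 are left out and each second application changes the sign.
module Tower (wP : ℕ → ℚ) (nP : ℕ → ℕ) (wQ : ℕ → ℚ) (nQ : ℕ → ℕ) where

  even odd : (ℕ → ℚ) → ℕ → ℕ → ℚ
  even x zero    j = x j
  even x (suc v) j = ℚ.- weightedSum wQ (nQ j) (odd x v)
  odd  x v       j = weightedSum wP (nP j) (even x v)

  -- Used with c = 1 and c = -1: the combinations of T-sums and of S-sums in the theorem become
  -- single towers over 1 + (-1)ⁿ and 1 - (-1)ⁿ.
  even-linear : ∀ c x y v j → even (λ i → x i ℚ.+ c ℚ.* y i) v j ≡ even x v j ℚ.+ c ℚ.* even y v j
  odd-linear  : ∀ c x y v j → odd (λ i → x i ℚ.+ c ℚ.* y i) v j ≡ odd x v j ℚ.+ c ℚ.* odd y v j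
  even-linear c x y zero    j = refl
  even-linear c x y (suc v) j = ≡.trans
    (cong ℚ.-_ (≡.trans (weightedSum-cong wQ (nQ j) (odd-linear c x y v)) (weightedSum-linear wQ (nQ j) c (odd x v) (odd y v))))
    (solve 3 (λ a c b → :- (a :+ c :* b) := :- a :+ c :* :- b) refl (weightedSum wQ (nQ j) (odd x v)) c (weightedSum wQ (nQ j) (odd y v)))
    where open ℚ-Solver.+-*-Solver
  odd-linear c x y v j = ≡.trans (weightedSum-cong wP (nP j) (even-linear c x y v)) (weightedSum-linear wP (nP j) c (even x v) (even y v))

  module Values (R : List Sign → ℕ → ℚ)
    (R-[] : ∀ j → R [] j ≡ 1ℚ)
    (R-P : ∀ σ σs j → isOdd (length σs) ≡ false →
      R (σ ∷ σs) j ≡ fromℕ 2 ℚ.* weightedSum wP (nP j) (λ i → (sign σ ^ℚ suc i) ℚ.* R σs i))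
    (R-Q : ∀ σ σs j → isOdd (length σs) ≡ true →
      R (σ ∷ σs) j ≡ fromℕ 2 ℚ.* weightedSum wQ (nQ j) (λ i → (sign σ ^ℚ suc i) ℚ.* R σs i))
    where
    open ℚ-Solver.+-*-Solver

    -- The recursion of T and S branches on the parity of the length, which does not compute for
    -- `ones p` with a variable p; it is therefore carried along.
    record EvenValue (σs : List Sign) (κ : ℚ) (x : ℕ → ℚ) (v : ℕ) : Set where
      constructor evenValue
      field
        parity : isOdd (length σs) ≡ false
        value  : ∀ j → R σs j ≡ κ ℚ.* even x v j

    record OddValue (σs : List Sign) (κ : ℚ) (x : ℕ → ℚ) (v : ℕ) : Set where
      constructor oddValue
      field
        parity : isOdd (length σs) ≡ true
        value  : ∀ j → R σs j ≡ κ ℚ.* odd x v j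

    1^n≡1 : ∀ n → 1ℚ ^ℚ n ≡ 1ℚ
    1^n≡1 zero    = refl
    1^n≡1 (suc n) = ≡.trans (ℚₚ.*-identityˡ (1ℚ ^ℚ n)) (1^n≡1 n)

    scaledSum : ∀ w n κ (y : ℕ → ℚ) {x : ℕ → ℚ} → (∀ i → x i ≡ κ ℚ.* y i) →
      fromℕ 2 ℚ.* weightedSum w n (λ i → (1ℚ ^ℚ suc i) ℚ.* x i) ≡ (fromℕ 2 ℚ.* κ) ℚ.* weightedSum w n y
    scaledSum w n κ y {x} e = ≡.trans (cong (fromℕ 2 ℚ.*_) (≡.trans
      (weightedSum-cong w n λ i → ≡.trans (cong (ℚ._* x i) (1^n≡1 (suc i))) (≡.trans (ℚₚ.*-identityˡ (x i)) (e i)))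
      (weightedSum-scale w n κ y))) (≡.sym (ℚₚ.*-assoc (fromℕ 2) κ _))

    prepend-even : ∀ {σs κ x v} → EvenValue σs κ x v → OddValue (Sign.+ ∷ σs) (fromℕ 2 ℚ.* κ) x v
    prepend-even {σs} {κ} {x} {v} (evenValue p e) = oddValue (cong not p) λ j →
      ≡.trans (R-P Sign.+ σs j p) (scaledSum wP (nP j) κ (even x v) e)

    prepend-odd : ∀ {σs κ x v} → OddValue σs κ x v → EvenValue (Sign.+ ∷ σs) (ℚ.- (fromℕ 2 ℚ.* κ)) x (suc v)
    prepend-odd {σs} {κ} {x} {v} (oddValue p e) = evenValue (cong not p) λ j →
      ≡.trans (≡.trans (R-Q Sign.+ σs j p) (scaledSum wQ (nQ j) κ (odd x v) e))
        (solve 2 (λ a b → a :* b := (:- a) :* (:- b)) refl (fromℕ 2 ℚ.* κ) (weightedSum wQ (nQ j) (odd x v)))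

    rescale-even : ∀ {σs κ κ′ x v} → κ ≡ κ′ → EvenValue σs κ x v → EvenValue σs κ′ x v
    rescale-even refl h = h

    rescale-odd : ∀ {σs κ κ′ x v} → κ ≡ κ′ → OddValue σs κ x v → OddValue σs κ′ x v
    rescale-odd refl h = h

    ones-even : ∀ v → EvenValue (ones (2 ℕ.* v)) (evenScale v) (λ _ → 1ℚ) v
    ones-odd  : ∀ v → OddValue (ones (2 ℕ.* v ℕ.+ 1)) (oddScale v) (λ _ → 1ℚ) v
    ones-even zero    = evenValue refl R-[]
    ones-even (suc v) = subst (λ k → EvenValue (ones k) (evenScale (suc v)) (λ _ → 1ℚ) (suc v))
      (≡.trans (cong suc (ℕₚ.+-comm (2 ℕ.* v) 1)) (≡.sym (ℕₚ.*-suc 2 v)))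
      (rescale-even (≡.sym (evenScale-suc v)) (prepend-odd (ones-odd v)))
    ones-odd v = subst (λ k → OddValue (ones k) (oddScale v) (λ _ → 1ℚ) v) (ℕₚ.+-comm 1 (2 ℕ.* v))
      (rescale-odd (≡.sym (oddScale≡ v)) (prepend-even (ones-even v)))

    -- The last sign is absorbed into the starting function `alternation`; all later summations
    -- carry the sign +. The list is one longer than its number of ones, so an even number of ones
    -- gives an odd depth.
    ones,-1-odd  : ∀ v → OddValue (ones,-1 (2 ℕ.* v)) (oddScale v) alternation v
    ones,-1-even : ∀ v → EvenValue (ones,-1 (2 ℕ.* v ℕ.+ 1)) (evenScale (suc v)) alternation (suc v)
    ones,-1-odd zero    = oddValue refl λ j → ≡.trans (R-P Sign.- [] j refl) (cong (fromℕ 2 ℚ.*_)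
      (weightedSum-cong wP (nP j) λ i → ≡.trans (cong ((-1^ suc i) ℚ.*_) (R-[] i)) (ℚₚ.*-identityʳ (-1^ suc i))))
    ones,-1-odd (suc v) = subst (λ k → OddValue (ones,-1 k) (oddScale (suc v)) alternation (suc v))
      (≡.trans (cong suc (ℕₚ.+-comm (2 ℕ.* v) 1)) (≡.sym (ℕₚ.*-suc 2 v)))
      (rescale-odd (≡.sym (oddScale≡ (suc v))) (prepend-even (ones,-1-even v)))
    ones,-1-even v = subst (λ k → EvenValue (ones,-1 k) (evenScale (suc v)) alternation (suc v)) (ℕₚ.+-comm 1 (2 ℕ.* v))
      (rescale-even (≡.sym (evenScale-suc v)) (prepend-odd (ones,-1-odd v)))

wU wV : ℕ → ℚ
wU i = 1/suc (suc (2 ℕ.* i))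
wV i = 1/suc (2 ℕ.* i)

module TTower = Tower wV suc wU (λ j → j)
module STower = Tower wU (λ j → j) wV suc

oddDenominatorSum≡ : ∀ σ X j → oddDenominatorSum σ X (suc j) ≡ fromℕ 2 ℚ.* weightedSum wV (suc j) (λ i → (sign σ ^ℚ suc i) ℚ.* X (suc i))
oddDenominatorSum≡ σ X j = cong (fromℕ 2 ℚ.*_) (AlternatingSeries.sumBelow-cong (suc j) λ i →
  ≡.trans (cong (((sign σ ^ℚ suc i) ℚ.* X (suc i)) /ₙ_) (cong (ℕ._∸ 1) (ℕₚ.*-suc 2 i))) (ℚₚ.*-comm ((sign σ ^ℚ suc i) ℚ.* X (suc i)) (wV i)))

evenDenominatorSum≡ : ∀ σ X j → evenDenominatorSum σ X (suc j) ≡ fromℕ 2 ℚ.* weightedSum wU j (λ i → (sign σ ^ℚ suc i) ℚ.* X (suc i))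
evenDenominatorSum≡ σ X j = cong (fromℕ 2 ℚ.*_) (AlternatingSeries.sumBelow-cong j λ i →
  ≡.trans (cong (((sign σ ^ℚ suc i) ℚ.* X (suc i)) /ₙ_) (ℕₚ.*-suc 2 i)) (ℚₚ.*-comm ((sign σ ^ℚ suc i) ℚ.* X (suc i)) (wU i)))

T-P : ∀ σ σs j → isOdd (length σs) ≡ false →
  T (suc j) (σ ∷ σs) ≡ fromℕ 2 ℚ.* weightedSum wV (suc j) (λ i → (sign σ ^ℚ suc i) ℚ.* T (suc i) σs)
T-P σ σs j p rewrite p = oddDenominatorSum≡ σ (λ i → T i σs) j

T-Q : ∀ σ σs j → isOdd (length σs) ≡ true →
  T (suc j) (σ ∷ σs) ≡ fromℕ 2 ℚ.* weightedSum wU j (λ i → (sign σ ^ℚ suc i) ℚ.* T (suc i) σs)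
T-Q σ σs j p rewrite p = evenDenominatorSum≡ σ (λ i → T i σs) j

S-P : ∀ σ σs j → isOdd (length σs) ≡ false →
  S (suc j) (σ ∷ σs) ≡ fromℕ 2 ℚ.* weightedSum wU j (λ i → (sign σ ^ℚ suc i) ℚ.* S (suc i) σs)
S-P σ σs j p rewrite p = evenDenominatorSum≡ σ (λ i → S i σs) j

S-Q : ∀ σ σs j → isOdd (length σs) ≡ true →
  S (suc j) (σ ∷ σs) ≡ fromℕ 2 ℚ.* weightedSum wV (suc j) (λ i → (sign σ ^ℚ suc i) ℚ.* S (suc i) σs)
S-Q σ σs j p rewrite p = oddDenominatorSum≡ σ (λ i → S i σs) j

module TValues = TTower.Values (λ σs j → T (suc j) σs) (λ _ → refl) T-P T-Q
module SValues = STower.Values (λ σs j → S (suc j) σs) (λ _ → refl) S-P S-Q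

-- Normalised moments and their summed recurrences

Σ<-suc : ∀ n f → Σ< (suc n) f ≃ Σ< n f + f n
Σ<-suc zero    f = ≃-trans (+-identityʳ (f 0)) (≃-sym (+-identityˡ (f 0)))
Σ<-suc (suc n) f = ≃-trans (+-congˡ (Σ<-suc n λ i → f (suc i))) (≃-sym (CommutativeRing.+-assoc ℝ-commutativeRing (f 0) _ _))

module Moments where
  open ℝ-Solver
  private module Q = ℚ-Solver.+-*-Solver

  -- The factor k + 1 matches the coefficients k + 1 and k + 3 of the two moments of equal exponent
  -- in the recurrence, and 1/p! absorbs the coefficient of the third. The parameter s is the sign
  -- (-1)ⁿ.
  M : ℕ → ℚ → ℕ → ℝ
  M k s p = fromℚ ((s ℚ.* fromℕ (suc k)) ℚ.* recipℕ (p !)) * I k p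

  -- D j and O j belong to n = j + 1: up to the factor (-1)ⁿ (degree + 1) / p! they are the
  -- moments of degree 2n - 2 and 2n - 1.
  D O : ℕ → ℕ → ℝ
  D j p = M (2 ℕ.* j) (alternation j) p
  O j p = M (suc (2 ℕ.* j)) (alternation j) p

  abstract
    -- The factor 1/p! of `M` reappears here as the factorials under A and t(1̄) in the theorem.
    -- Opaque, so that `A` and the powers of `t̄1` are not unfolded.
    α τ : ℕ → ℝ
    α p = fromℚ (recipℕ (p !)) * A p
    τ p = fromℚ (recipℕ (p !)) * t̄1 ^ p

    α≃ : ∀ p → α p ≃ fromℚ (recipℕ (p !)) * A p
    α≃ p = ≃-refl

    τ≃ : ∀ p → τ p ≃ fromℚ (recipℕ (p !)) * t̄1 ^ p
    τ≃ p = ≃-refl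

  recipℕ-! : ∀ p → fromℕ (suc p) ℚ.* recipℕ (suc p !) ≡ recipℕ (p !)
  recipℕ-! p = ≡.trans (cong (fromℕ (suc p) ℚ.*_) (recipℕ-* (suc p) (p !)))
    (≡.trans (≡.sym (ℚₚ.*-assoc (fromℕ (suc p)) (recipℕ (suc p)) (recipℕ (p !))))
      (≡.trans (cong (ℚ._* recipℕ (p !)) (recipℕ-inverse (suc p))) (ℚₚ.*-identityˡ (recipℕ (p !)))))

  arctan-1-power : ∀ p → arctan 1ℝ ^ p ≃ fromℚ (-1^ p) * t̄1 ^ p
  arctan-1-power zero    = ≃-sym (*-identityˡ 1ℝ)
  arctan-1-power (suc p) = ≃-trans (*-cong arctan-1 (arctan-1-power p)) (≃-trans
    (solve 3 (λ t s z → (:- t) :* (s :* z) := (con (ℚ.- 1ℚ) :* s) :* (t :* z)) ≃-refl t̄1 (fromℚ (-1^ p)) (t̄1 ^ p))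
    (*-congʳ (≃-sym (fromℚ-* (ℚ.- 1ℚ) (-1^ p)))))

  M-coefficient : ∀ s k p → fromℚ ((s ℚ.* fromℕ (suc k)) ℚ.* recipℕ (p !)) ≃ (fromℚ s * fromℚ (fromℕ (suc k))) * fromℚ (recipℕ (p !))
  M-coefficient s k p = ≃-pointwise λ _ → refl

  M-neg : ∀ k s p → M k (ℚ.- s) p ≃ - M k s p
  M-neg k s p = ≃-trans (*-congʳ (≃-pointwise λ _ → ℚ-neg s (fromℕ (suc k)) (recipℕ (p !))))
    (solve 2 (λ a b → (:- a) :* b := :- (a :* b)) ≃-refl (fromℚ ((s ℚ.* fromℕ (suc k)) ℚ.* recipℕ (p !))) (I k p))
    where
    ℚ-neg : ∀ s k r → ((ℚ.- s) ℚ.* k) ℚ.* r ≡ ℚ.- ((s ℚ.* k) ℚ.* r)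
    ℚ-neg = Q.solve 3 (λ s k r → ((Q.:- s) Q.:* k) Q.:* r Q.:= Q.:- ((s Q.:* k) Q.:* r)) refl

  -- The power of arctan 1 in the recurrence for I, in terms of t(1̄).
  boundary : ℚ → ℕ → ℝ
  boundary s p = fromℚ ((ℚ.- (2ℚ ℚ.* s)) ℚ.* -1^ suc p) * τ (suc p)

  private
    unweight : ∀ k s p → fromℚ (1/suc k) * M k s p ≃ (fromℚ s * fromℚ (recipℕ (p !))) * I k p
    unweight k s p = ≃-trans (*-congˡ (*-congʳ (M-coefficient s k p))) (≃-trans
      (solve 5 (λ w s k r i → w :* (((s :* k) :* r) :* i) := (k :* w) :* ((s :* r) :* i)) ≃-refl
        (fromℚ (1/suc k)) (fromℚ s) (fromℚ (fromℕ (suc k))) (fromℚ (recipℕ (p !))) (I k p))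
      (≃-trans (*-congʳ (≃-trans (≃-sym (fromℚ-* (fromℕ (suc k)) (1/suc k))) (fromℚ-cong (1/suc-inverse k)))) (*-identityˡ _)))

    boundary≃ : ∀ s p → boundary s p ≃ - ((fromℚ s * fromℚ (recipℕ (suc p !))) * (2ℝ * arctan 1ℝ ^ suc p))
    boundary≃ s p = ≃-sym (≃-trans (-‿cong (*-congˡ (*-congˡ (arctan-1-power (suc p)))))
      (≃-trans (solve 4 (λ s r e t → :- ((s :* r) :* (con 2ℚ :* (e :* t))) := ((:- (con 2ℚ :* s)) :* e) :* (r :* t)) ≃-refl
        (fromℚ s) (fromℚ (recipℕ (suc p !))) (fromℚ (-1^ suc p)) (t̄1 ^ suc p))
        (*-cong (≃-pointwise λ _ → refl) (≃-sym (τ≃ (suc p))))))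

    -- The recurrence for I multiplied by s / (p + 1)!.
    scaled : ∀ s p X Y →
      X + fromℚ (fromℕ (suc p)) * Y ≃ 2ℝ * arctan 1ℝ ^ suc p →
      - ((fromℚ s * fromℚ (recipℕ (suc p !))) * X) ≃ (fromℚ s * fromℚ (recipℕ (p !))) * Y + boundary s p
    scaled s p X Y h = ≃-trans
      (solve 5 (λ s r X q Y → :- ((s :* r) :* X) := (s :* (q :* r)) :* Y :+ :- ((s :* r) :* (X :+ q :* Y))) ≃-refl
        (fromℚ s) (fromℚ (recipℕ (suc p !))) X (fromℚ (fromℕ (suc p))) Y)
      (+-cong (*-congʳ (*-congˡ (≃-trans (≃-sym (fromℚ-* (fromℕ (suc p)) (recipℕ (suc p !)))) (fromℚ-cong (recipℕ-! p)))))
        (≃-trans (-‿cong (*-congˡ h)) (≃-sym (boundary≃ s p))))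

  -- The recurrence at k + 1. Reversing s whenever the degree rises by two turns its sum of two
  -- moments into a difference, ready for summation.
  M-step : ∀ k s p → M (suc (suc k)) (ℚ.- s) (suc p) ≃ (M k s (suc p) + fromℚ (1/suc (suc k)) * M (suc k) s p) + boundary s p
  M-step k s p = ≃-trans (M-neg (suc (suc k)) s (suc p)) (≃-trans
    (-‿cong (*-congʳ (M-coefficient s (suc (suc k)) (suc p)))) (≃-trans
    (solve 6 (λ s r K i K2 i2 → :- (((s :* K2) :* r) :* i2) := ((s :* K) :* r) :* i :+ :- ((s :* r) :* (K :* i :+ K2 :* i2))) ≃-refl
      (fromℚ s) (fromℚ (recipℕ (suc p !))) (fromℚ (fromℕ (suc k))) (I k (suc p)) (fromℚ (fromℕ (suc (suc (suc k))))) (I (suc (suc k)) (suc p)))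
    (≃-trans (+-cong (*-congʳ (≃-sym (M-coefficient s k (suc p))))
      (≃-trans (scaled s p _ (I (suc k) p) (I-recurrence (suc k) p)) (+-congʳ (≃-sym (unweight (suc k) s p)))))
      (≃-sym (CommutativeRing.+-assoc ℝ-commutativeRing _ _ _)))))

  -- At k = 0 the coefficient of the lower moment is 0. Thus the odd degrees start without a
  -- constant A.
  M-first : ∀ s p → M 1 (ℚ.- s) (suc p) ≃ fromℚ (1/suc 0) * M 0 s p + boundary s p
  M-first s p = ≃-trans (M-neg 1 s (suc p)) (≃-trans
    (-‿cong (*-congʳ (M-coefficient s 1 (suc p)))) (≃-trans
    (solve 5 (λ s r i K2 i2 → :- (((s :* K2) :* r) :* i2) := :- ((s :* r) :* (con 0ℚ :* i :+ K2 :* i2))) ≃-refl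
      (fromℚ s) (fromℚ (recipℕ (suc p !))) (I 0 (suc p)) (fromℚ (fromℕ 2)) (I 1 (suc p)))
    (≃-trans (scaled s p _ (I 0 p) (I-recurrence 0 p)) (+-congʳ (≃-sym (unweight 0 s p))))))

  M-power : ∀ k s → M k s 0 ≃ fromℚ s
  M-power k s = ≃-trans (*-congʳ (M-coefficient s k 0)) (≃-trans
    (solve 3 (λ s k i → ((s :* k) :* con 1ℚ) :* i := s :* (k :* i)) ≃-refl (fromℚ s) (fromℚ (fromℕ (suc k))) (I k 0))
    (≃-trans (*-congˡ (I-power k)) (*-identityʳ _)))

  weighted : (ℕ → ℚ) → ℕ → (ℕ → ℝ) → ℝ
  weighted w n X = Σ< n (λ i → fromℚ (w i) * X i)

  M-cong : ∀ {k k′ s s′} → k ≡ k′ → s ≡ s′ → ∀ p → M k s p ≃ M k′ s′ p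
  M-cong refl refl p = ≃-refl

  alternation-suc : ∀ j → alternation (suc j) ≡ ℚ.- alternation j
  alternation-suc j = -1^-suc (suc j)

  D-suc : ∀ j p → D (suc j) (suc p) ≃ (D j (suc p) + fromℚ (wU j) * O j p) + boundary (alternation j) p
  D-suc j p = ≃-trans (M-cong (ℕₚ.*-suc 2 j) (alternation-suc j) (suc p)) (M-step (2 ℕ.* j) (alternation j) p)

  O-suc : ∀ j p → O (suc j) (suc p) ≃ (O j (suc p) + - (fromℚ (wV (suc j)) * D (suc j) p)) + boundary (alternation j) p
  O-suc j p = ≃-trans (M-cong (cong suc (ℕₚ.*-suc 2 j)) (alternation-suc j) (suc p))
    (≃-trans (M-step (suc (2 ℕ.* j)) (alternation j) p) (+-congʳ (+-congˡ (≃-trans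
      (*-cong (fromℚ-cong (cong 1/suc (≡.sym (ℕₚ.*-suc 2 j)))) flip)
      (solve 2 (λ a b → a :* (:- b) := :- (a :* b)) ≃-refl (fromℚ (wV (suc j))) (D (suc j) p))))))
    where
    flip : M (suc (suc (2 ℕ.* j))) (alternation j) p ≃ - D (suc j) p
    flip = ≃-trans (M-cong (≡.sym (ℕₚ.*-suc 2 j)) (≡.trans (ℚ-neg-neg (alternation j)) (cong ℚ.-_ (≡.sym (alternation-suc j)))) p)
      (M-neg (2 ℕ.* suc j) (alternation (suc j)) p)
      where
      ℚ-neg-neg : ∀ s → s ≡ ℚ.- (ℚ.- s)
      ℚ-neg-neg = Q.solve 1 (λ s → s Q.:= Q.:- (Q.:- s)) refl

  -- Summation of `D-suc` from degree 0, where the moment is A. The boundary factors -2(-1)^(i+1)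
  -- for i < j add up to 1 + (-1)^(j+1), which is 0 or 2.
  D-closed : ∀ p j → D j (suc p) ≃
    (- α (suc p) + fromℚ ((1ℚ ℚ.+ alternation j) ℚ.* -1^ suc p) * τ (suc p)) + weighted wU j (λ i → O i p)
  D-closed p zero = ≃-trans (*-cong (M-coefficient (ℚ.- 1ℚ) 0 (suc p)) (I-0 (suc p)))
    (≃-trans (solve 4 (λ r a s t → ((con (ℚ.- 1ℚ) :* con 1ℚ) :* r) :* a := (:- (r :* a) :+ (con 0ℚ :* s) :* t) :+ con 0ℚ) ≃-refl
      (fromℚ (recipℕ (suc p !))) (A (suc p)) (fromℚ (-1^ suc p)) (τ (suc p)))
      (+-congʳ (+-cong (-‿cong (≃-sym (α≃ (suc p)))) (*-congʳ (≃-sym (fromℚ-* 0ℚ (-1^ suc p)))))))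
  D-closed p (suc j) = ≃-trans (D-suc j p) (≃-trans (+-congʳ (+-congʳ (D-closed p j))) (≃-trans
    (solve 6 (λ a b t u x c → (((a :+ b :* t) :+ u) :+ x) :+ c :* t := (a :+ (b :+ c) :* t) :+ (u :+ x)) ≃-refl
      (- α (suc p)) (fromℚ ((1ℚ ℚ.+ alternation j) ℚ.* -1^ suc p)) (τ (suc p)) (weighted wU j (λ i → O i p)) (fromℚ (wU j) * O j p)
      (fromℚ ((ℚ.- (2ℚ ℚ.* alternation j)) ℚ.* -1^ suc p)))
    (+-cong (+-congˡ (*-congʳ (≃-trans (≃-sym (fromℚ-+ _ _)) (fromℚ-cong (≡.trans (merge (alternation j) (-1^ suc p))
      (cong (λ s → (1ℚ ℚ.+ s) ℚ.* -1^ suc p) (≡.sym (alternation-suc j))))))))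
      (≃-sym (Σ<-suc j (λ i → fromℚ (wU i) * O i p))))))
    where
    merge : ∀ e s → (1ℚ ℚ.+ e) ℚ.* s ℚ.+ (ℚ.- (2ℚ ℚ.* e)) ℚ.* s ≡ (1ℚ ℚ.+ ℚ.- e) ℚ.* s
    merge = Q.solve 2 (λ e s → (Q.con 1ℚ Q.:+ e) Q.:* s Q.:+ (Q.:- (Q.con 2ℚ Q.:* e)) Q.:* s Q.:= (Q.con 1ℚ Q.:+ Q.:- e) Q.:* s) refl

  -- Here the first step already brings a boundary term, so the totals are -2 and 0 in place of 0
  -- and 2.
  O-closed : ∀ p j → O j (suc p) ≃
    fromℚ ((alternation j ℚ.- 1ℚ) ℚ.* -1^ suc p) * τ (suc p) + - weighted wV (suc j) (λ i → D i p)
  O-closed p zero = ≃-trans (M-first 1ℚ p) (≃-trans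
    (+-congʳ (*-congˡ (≃-trans (M-cong {0} {0} {1ℚ} {ℚ.- alternation 0} refl refl p) (M-neg 0 (alternation 0) p))))
    (≃-trans (solve 3 (λ w d b → w :* (:- d) :+ b := b :+ :- (w :* d :+ con 0ℚ)) ≃-refl (fromℚ (1/suc 0)) (D 0 p) (boundary 1ℚ p))
      (+-congʳ ≃-refl)))
  O-closed p (suc j) = ≃-trans (O-suc j p) (≃-trans (+-congʳ (+-congʳ (O-closed p j))) (≃-trans
    (solve 5 (λ b t v x c → ((b :* t :+ :- v) :+ :- x) :+ c :* t := (b :+ c) :* t :+ :- (v :+ x)) ≃-refl
      (fromℚ ((alternation j ℚ.- 1ℚ) ℚ.* -1^ suc p)) (τ (suc p)) (weighted wV (suc j) (λ i → D i p)) (fromℚ (wV (suc j)) * D (suc j) p)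
      (fromℚ ((ℚ.- (2ℚ ℚ.* alternation j)) ℚ.* -1^ suc p)))
    (+-cong (*-congʳ (≃-trans (≃-sym (fromℚ-+ _ _)) (fromℚ-cong (≡.trans (merge (alternation j) (-1^ suc p))
      (cong (λ s → (s ℚ.- 1ℚ) ℚ.* -1^ suc p) (≡.sym (alternation-suc j)))))))
      (-‿cong (≃-sym (Σ<-suc (suc j) (λ i → fromℚ (wV i) * D i p)))))))
    where
    merge : ∀ e s → (e ℚ.- 1ℚ) ℚ.* s ℚ.+ (ℚ.- (2ℚ ℚ.* e)) ℚ.* s ≡ (ℚ.- e ℚ.- 1ℚ) ℚ.* s
    merge = Q.solve 2 (λ e s → (e Q.:- Q.con 1ℚ) Q.:* s Q.:+ (Q.:- (Q.con 2ℚ Q.:* e)) Q.:* s Q.:= (Q.:- e Q.:- Q.con 1ℚ) Q.:* s) refl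

open Moments

-- Weighted sums of linear combinations of constants

module Combinations where
  open ℝ-Solver

  combination : ℕ → (ℕ → ℕ → ℚ) → (ℕ → ℝ) → ℕ → ℝ
  combination n x c j = Σ< n (λ u → fromℚ (x u j) * c u)

  combination-cong : ∀ n x {c d} j → (∀ u → c u ≃ d u) → combination n x c j ≃ combination n x d j
  combination-cong n x j e = Σ<-cong n λ u → *-congˡ (e u)

  combination-neg : ∀ n (x : ℕ → ℕ → ℚ) c j → combination n (λ u i → ℚ.- x u i) c j ≃ - combination n x c j
  combination-neg zero    x c j = solve 0 (con 0ℚ := :- con 0ℚ) ≃-refl
  combination-neg (suc n) x c j = ≃-trans (+-cong (*-congʳ (≃-pointwise λ _ → refl)) (combination-neg n (λ u → x (suc u)) (λ u → c (suc u)) j))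
    (solve 3 (λ a b s → (:- a) :* b :+ :- s := :- (a :* b :+ s)) ≃-refl (fromℚ (x 0 j)) (c 0) (combination n (λ u → x (suc u)) (λ u → c (suc u)) j))

  weighted-cong : ∀ w n {X Y} → (∀ i → X i ≃ Y i) → weighted w n X ≃ weighted w n Y
  weighted-cong w n e = Σ<-cong n λ i → *-congˡ (e i)

  weighted-+ : ∀ w n X Y → weighted w n (λ i → X i + Y i) ≃ weighted w n X + weighted w n Y
  weighted-+ w n X Y = ≃-trans (Σ<-cong n λ i → distribˡ (fromℚ (w i)) (X i) (Y i)) (Σ<-+ n (λ i → fromℚ (w i) * X i) (λ i → fromℚ (w i) * Y i))

  weighted-neg : ∀ w n X → weighted w n (λ i → - X i) ≃ - weighted w n X
  weighted-neg w zero    X = solve 0 (con 0ℚ := :- con 0ℚ) ≃-refl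
  weighted-neg w (suc n) X = ≃-trans (+-congˡ (weighted-neg (λ i → w (suc i)) n λ i → X (suc i)))
    (solve 3 (λ a b s → a :* (:- b) :+ :- s := :- (a :* b :+ s)) ≃-refl (fromℚ (w 0)) (X 0) (weighted (λ i → w (suc i)) n λ i → X (suc i)))

  weighted-fromℚ-* : ∀ w n (y : ℕ → ℚ) c → weighted w n (λ i → fromℚ (y i) * c) ≃ fromℚ (weightedSum w n y) * c
  weighted-fromℚ-* w zero    y c = solve 1 (λ c → con 0ℚ := con 0ℚ :* c) ≃-refl c
  weighted-fromℚ-* w (suc n) y c = ≃-trans (+-congˡ (weighted-fromℚ-* (λ i → w (suc i)) n (λ i → y (suc i)) c)) (≃-trans
    (solve 4 (λ a b c s → a :* (b :* c) :+ s :* c := (a :* b :+ s) :* c) ≃-refl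
      (fromℚ (w 0)) (fromℚ (y 0)) c (fromℚ (weightedSum (λ i → w (suc i)) n λ i → y (suc i))))
    (*-congʳ (≃-pointwise λ _ → refl)))

  weighted-fromℚ : ∀ w n (y : ℕ → ℚ) → weighted w n (λ i → fromℚ (y i)) ≃ fromℚ (weightedSum w n y)
  weighted-fromℚ w n y = ≃-trans (weighted-cong w n λ i → ≃-sym (*-identityʳ (fromℚ (y i))))
    (≃-trans (weighted-fromℚ-* w n y 1ℝ) (*-identityʳ _))

  -- Interchange of the two sums: the summation acts on the rational coefficients only. These no
  -- longer depend on an index afterwards, so the final argument 0 is a dummy.
  weighted-combination : ∀ w N n x c → weighted w N (combination n x c) ≃ combination n (λ u _ → weightedSum w N (x u)) c 0
  weighted-combination w N zero    x c = ≃-trans (weighted-fromℚ w N (λ _ → 0ℚ)) (fromℚ-cong (vanish w N))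
    where
    vanish : ∀ w N → weightedSum w N (λ _ → 0ℚ) ≡ 0ℚ
    vanish w N = ≡.trans (weightedSum-scale w N 0ℚ (λ _ → 0ℚ)) (ℚₚ.*-zeroˡ (weightedSum w N (λ _ → 0ℚ)))
  weighted-combination w N (suc n) x c = ≃-trans (weighted-+ w N (λ i → fromℚ (x 0 i) * c 0) (combination n (λ u → x (suc u)) (λ u → c (suc u))))
    (+-cong (weighted-fromℚ-* w N (x 0) (c 0)) (weighted-combination w N n (λ u → x (suc u)) (λ u → c (suc u))))

  weighted-+₄ : ∀ w n A B C D → weighted w n (λ i → ((A i + B i) + C i) + D i) ≃
    ((weighted w n A + weighted w n B) + weighted w n C) + weighted w n D
  weighted-+₄ w n A B C D = ≃-trans (weighted-+ w n (λ i → (A i + B i) + C i) D)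
    (+-congʳ (≃-trans (weighted-+ w n (λ i → A i + B i) C) (+-congʳ (weighted-+ w n A B))))

open Combinations

-- Closed forms of the normalised moments

module ClosedForms where
  open ℝ-Solver
  private module Q = ℚ-Solver.+-*-Solver

  -- The explicit factors 1 and -1 are those of `even-linear` and `odd-linear`, so that both apply
  -- without rewriting.
  one plus minus : ℕ → ℚ
  one   j = 1ℚ
  plus  j = 1ℚ ℚ.+ 1ℚ ℚ.* alternation j
  minus j = 1ℚ ℚ.+ (ℚ.- 1ℚ) ℚ.* alternation j

  evenGap oddGap : ℕ → ℕ → ℕ
  evenGap m u = 2 ℕ.* m ℕ.∸ 2 ℕ.* u
  oddGap  m u = 2 ℕ.* m ℕ.∸ 2 ℕ.* u ℕ.∸ 1

  -- Two summations raise the exponent by two and the tower index by one; the constant attached to a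
  -- tower keeps its exponent 2m - 2u.
  evenGap-suc : ∀ m u → evenGap m u ≡ evenGap (suc m) (suc u)
  evenGap-suc m u = ≡.sym (cong₂ ℕ._∸_ (ℕₚ.*-suc 2 m) (ℕₚ.*-suc 2 u))

  oddGap-suc : ∀ m u → oddGap m u ≡ oddGap (suc m) (suc u)
  oddGap-suc m u = cong (ℕ._∸ 1) (evenGap-suc m u)

  evenGap-0 : ∀ m → suc (suc (2 ℕ.* m)) ≡ evenGap (suc m) 0
  evenGap-0 m = ≡.sym (ℕₚ.*-suc 2 m)

  oddGap-0 : ∀ m → suc (2 ℕ.* m) ≡ oddGap (suc m) 0
  oddGap-0 m = cong (ℕ._∸ 1) (evenGap-0 m)

  -- In the sums over `even plus` and `even minus` the term of index 0 is the leading term of the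
  -- theorem: an even tower of index 0 is its starting function 1 ± (-1)ⁿ.
  D-even-form D-odd-form O-even-form O-odd-form : ℕ → ℕ → ℝ
  D-even-form m j = ((fromℚ (TTower.even alternation m j)
    - combination m (TTower.even one) (λ u → α (evenGap m u)) j)
    + combination m (TTower.even plus) (λ v → τ (evenGap m v)) j)
    + combination m (STower.odd minus) (λ v → τ (oddGap m v)) j
  O-odd-form m j = ((- fromℚ (TTower.odd alternation m j)
    + combination m (TTower.odd one) (λ u → α (evenGap m u)) j)
    - combination m (TTower.odd plus) (λ v → τ (evenGap m v)) j)
    + combination (suc m) (STower.even minus) (λ v → τ (oddGap (suc m) v)) j
  D-odd-form m j = ((fromℚ (STower.odd alternation m j)
    - combination (suc m) (TTower.even one) (λ u → α (oddGap (suc m) u)) j)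
    - combination (suc m) (TTower.even plus) (λ v → τ (oddGap (suc m) v)) j)
    - combination m (STower.odd minus) (λ v → τ (evenGap m v)) j
  O-even-form m j = ((fromℚ (STower.even alternation m j)
    + combination m (TTower.odd one) (λ u → α (oddGap m u)) j)
    + combination m (TTower.odd plus) (λ v → τ (oddGap m v)) j)
    - combination m (STower.even minus) (λ v → τ (evenGap m v)) j

  -1^odd : ∀ m → -1^ suc (2 ℕ.* m) ≡ ℚ.- 1ℚ
  -1^odd m = cong ((ℚ.- 1ℚ) ℚ.*_) (-1^-2* m)

  -1^even : ∀ m → -1^ suc (suc (2 ℕ.* m)) ≡ 1ℚ
  -1^even m = cong ((ℚ.- 1ℚ) ℚ.*_) (-1^odd m)

  -- The parity of the exponent fixes the power of -1, and the boundary term becomes the new term of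
  -- index 0 in front of the shifted sum. The three companions below differ in parity and sign only.
  O-head-odd : ∀ m j → fromℚ ((alternation j ℚ.- 1ℚ) ℚ.* -1^ suc (2 ℕ.* m)) * τ (suc (2 ℕ.* m)) ≃ fromℚ (minus j) * τ (oddGap (suc m) 0)
  O-head-odd m j = *-cong (fromℚ-cong (≡.trans (cong ((alternation j ℚ.- 1ℚ) ℚ.*_) (-1^odd m))
    (Q.solve 1 (λ e → (e Q.:- Q.con 1ℚ) Q.:* Q.con (ℚ.- 1ℚ) Q.:= Q.con 1ℚ Q.:+ Q.con (ℚ.- 1ℚ) Q.:* e) refl (alternation j))))
    (≡⇒≃ (cong τ (oddGap-0 m)))

  O-head-even : ∀ m j → fromℚ ((alternation j ℚ.- 1ℚ) ℚ.* -1^ suc (suc (2 ℕ.* m))) * τ (suc (suc (2 ℕ.* m))) ≃ - (fromℚ (minus j) * τ (evenGap (suc m) 0))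
  O-head-even m j = ≃-trans (*-cong (≃-trans (fromℚ-cong (≡.trans (cong ((alternation j ℚ.- 1ℚ) ℚ.*_) (-1^even m))
    (Q.solve 1 (λ e → (e Q.:- Q.con 1ℚ) Q.:* Q.con 1ℚ Q.:= Q.:- (Q.con 1ℚ Q.:+ Q.con (ℚ.- 1ℚ) Q.:* e)) refl (alternation j))))
      (≃-pointwise {y = - fromℚ (minus j)} λ _ → refl))
    (≡⇒≃ (cong τ (evenGap-0 m)))) (solve 2 (λ a b → (:- a) :* b := :- (a :* b)) ≃-refl (fromℚ (minus j)) (τ (evenGap (suc m) 0)))

  D-head-odd : ∀ m j → fromℚ ((1ℚ ℚ.+ alternation j) ℚ.* -1^ suc (2 ℕ.* m)) * τ (suc (2 ℕ.* m)) ≃ - (fromℚ (plus j) * τ (oddGap (suc m) 0))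
  D-head-odd m j = ≃-trans (*-cong (≃-trans (fromℚ-cong (≡.trans (cong ((1ℚ ℚ.+ alternation j) ℚ.*_) (-1^odd m))
    (Q.solve 1 (λ e → (Q.con 1ℚ Q.:+ e) Q.:* Q.con (ℚ.- 1ℚ) Q.:= Q.:- (Q.con 1ℚ Q.:+ Q.con 1ℚ Q.:* e)) refl (alternation j))))
      (≃-pointwise {y = - fromℚ (plus j)} λ _ → refl))
    (≡⇒≃ (cong τ (oddGap-0 m)))) (solve 2 (λ a b → (:- a) :* b := :- (a :* b)) ≃-refl (fromℚ (plus j)) (τ (oddGap (suc m) 0)))

  D-head-even : ∀ m j → fromℚ ((1ℚ ℚ.+ alternation j) ℚ.* -1^ suc (suc (2 ℕ.* m))) * τ (suc (suc (2 ℕ.* m))) ≃ fromℚ (plus j) * τ (evenGap (suc m) 0)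
  D-head-even m j = *-cong (fromℚ-cong (≡.trans (cong ((1ℚ ℚ.+ alternation j) ℚ.*_) (-1^even m))
    (Q.solve 1 (λ e → (Q.con 1ℚ Q.:+ e) Q.:* Q.con 1ℚ Q.:= Q.con 1ℚ Q.:+ Q.con 1ℚ Q.:* e) refl (alternation j))))
    (≡⇒≃ (cong τ (evenGap-0 m)))


  α-gap : ∀ p m → p ≡ m → ∀ j → α p ≃ fromℚ (one j) * α m
  α-gap p m refl j = ≃-sym (*-identityˡ (α m))

  module TowerCombinations (wP : ℕ → ℚ) (nP : ℕ → ℕ) (wQ : ℕ → ℚ) (nQ : ℕ → ℕ) where
    open Tower wP nP wQ nQ

    P-even : ∀ n x c j → weighted wP (nP j) (combination n (even x) c) ≃ combination n (odd x) c j
    P-even n x c j = weighted-combination wP (nP j) n (even x) c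

    -- The minus sign is the one built into `even` at a successor.
    Q-odd : ∀ n x c j → weighted wQ (nQ j) (combination n (odd x) c) ≃ - combination n (λ u → even x (suc u)) c j
    Q-odd n x c j = ≃-trans (weighted-combination wQ (nQ j) n (odd x) c) (≃-trans
      (solve 1 (λ a → a := :- :- a) ≃-refl (combination n (λ u _ → weightedSum wQ (nQ j) (odd x u)) c 0))
      (-‿cong (≃-sym (combination-neg n (λ u _ → weightedSum wQ (nQ j) (odd x u)) c 0))))

    P-fromℚ-even : ∀ x v j → weighted wP (nP j) (λ i → fromℚ (even x v i)) ≃ fromℚ (odd x v j)
    P-fromℚ-even x v j = weighted-fromℚ wP (nP j) (even x v)

    Q-fromℚ-odd : ∀ x v j → weighted wQ (nQ j) (λ i → fromℚ (odd x v i)) ≃ - fromℚ (even x (suc v) j)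
    Q-fromℚ-odd x v j = ≃-trans (weighted-fromℚ wQ (nQ j) (odd x v)) (≃-trans
      (solve 1 (λ a → a := :- :- a) ≃-refl (fromℚ (weightedSum wQ (nQ j) (odd x v)))) (-‿cong (≃-pointwise λ _ → refl)))

  module TC = TowerCombinations wV suc wU (λ j → j)
  module SC = TowerCombinations wU (λ j → j) wV suc

  shift : ∀ n (x : ℕ → ℕ → ℚ) (c : ℕ → ℝ) {gap gap′ : ℕ → ℕ} j → (∀ u → gap u ≡ gap′ (suc u)) →
    combination n (λ u → x (suc u)) (λ u → c (gap u)) j ≃ combination n (λ u → x (suc u)) (λ u → c (gap′ (suc u))) j
  shift n x c j e = combination-cong n (λ u → x (suc u)) j λ u → ≡⇒≃ (cong c (e u))

  -- The summation with `wV` is the first one of the T-tower and the second one of the S-tower. It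
  -- therefore takes even T-towers to odd ones and, at the same time, odd S-towers to even ones of
  -- next index. In the steps for D the summation with `wU` does the same with T and S exchanged.
  O-odd-step : ∀ m → (∀ j → D j (2 ℕ.* m) ≃ D-even-form m j) → ∀ j → O j (suc (2 ℕ.* m)) ≃ O-odd-form m j
  O-odd-step m ih j = ≃-trans (O-closed (2 ℕ.* m) j) (≃-trans
    (+-cong (O-head-odd m j) (-‿cong (≃-trans (weighted-cong wV (suc j) ih) (≃-trans
      (weighted-+₄ wV (suc j) (λ i → fromℚ (TTower.even alternation m i)) (λ i → - C₁ i) C₂ C₃)
      (+-cong (+-cong (+-cong (TC.P-fromℚ-even alternation m j)
        (≃-trans (weighted-neg wV (suc j) C₁) (-‿cong (TC.P-even m one (λ u → α (evenGap m u)) j))))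
        (TC.P-even m plus (λ v → τ (evenGap m v)) j))
        (SC.Q-odd m minus (λ v → τ (oddGap m v)) j))))))
    (≃-trans (solve 5 (λ h a b c d → h :+ (:- (((a :+ (:- b)) :+ c) :+ (:- d))) := ((:- a :+ b) :- c) :+ (h :+ d)) ≃-refl
      (fromℚ (minus j) * τ (oddGap (suc m) 0)) (fromℚ (TTower.odd alternation m j))
      (combination m (TTower.odd one) (λ u → α (evenGap m u)) j)
      (combination m (TTower.odd plus) (λ v → τ (evenGap m v)) j)
      (combination m (λ v → STower.even minus (suc v)) (λ v → τ (oddGap m v)) j))
      (+-congˡ (+-congˡ (shift m (STower.even minus) τ {oddGap m} {oddGap (suc m)} j (oddGap-suc m))))))
    where
    C₁ C₂ C₃ : ℕ → ℝ
    C₁ = combination m (TTower.even one) (λ u → α (evenGap m u))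
    C₂ = combination m (TTower.even plus) (λ v → τ (evenGap m v))
    C₃ = combination m (STower.odd minus) (λ v → τ (oddGap m v))

  D-even-step : ∀ m → (∀ j → O j (suc (2 ℕ.* m)) ≃ O-odd-form m j) → ∀ j → D j (2 ℕ.* suc m) ≃ D-even-form (suc m) j
  D-even-step m ih j = ≃-trans (≡⇒≃ (cong (D j) (ℕₚ.*-suc 2 m))) (≃-trans (D-closed (suc (2 ℕ.* m)) j) (≃-trans
    (+-cong (+-cong (-‿cong (α-gap (suc (suc (2 ℕ.* m))) (evenGap (suc m) 0) (evenGap-0 m) j)) (D-head-even m j)) (≃-trans (weighted-cong wU j ih) (≃-trans
      (weighted-+₄ wU j (λ i → - fromℚ (TTower.odd alternation m i)) C₁ (λ i → - C₂ i) C₃)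
      (+-cong (+-cong (+-cong
        (≃-trans (weighted-neg wU j (λ i → fromℚ (TTower.odd alternation m i))) (-‿cong (TC.Q-fromℚ-odd alternation m j)))
        (TC.Q-odd m one (λ u → α (evenGap m u)) j))
        (≃-trans (weighted-neg wU j C₂) (-‿cong (TC.Q-odd m plus (λ v → τ (evenGap m v)) j))))
        (SC.P-even (suc m) minus (λ v → τ (oddGap (suc m) v)) j)))))
    (≃-trans (solve 6 (λ a h e b c d → (:- a :+ h) :+ (((:- :- e :+ (:- b)) :+ (:- :- c)) :+ d) := ((e :- (a :+ b)) :+ (h :+ c)) :+ d) ≃-refl
      (fromℚ (one j) * α (evenGap (suc m) 0)) (fromℚ (plus j) * τ (evenGap (suc m) 0)) (fromℚ (TTower.even alternation (suc m) j))
      (combination m (λ u → TTower.even one (suc u)) (λ u → α (evenGap m u)) j)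
      (combination m (λ v → TTower.even plus (suc v)) (λ v → τ (evenGap m v)) j)
      (combination (suc m) (STower.odd minus) (λ v → τ (oddGap (suc m) v)) j))
      (+-congʳ (+-cong (+-congˡ (-‿cong (+-congˡ (shift m (TTower.even one) α {evenGap m} {evenGap (suc m)} j (evenGap-suc m)))))
        (+-congˡ (shift m (TTower.even plus) τ {evenGap m} {evenGap (suc m)} j (evenGap-suc m))))))))
    where
    C₁ C₂ C₃ : ℕ → ℝ
    C₁ = combination m (TTower.odd one) (λ u → α (evenGap m u))
    C₂ = combination m (TTower.odd plus) (λ v → τ (evenGap m v))
    C₃ = combination (suc m) (STower.even minus) (λ v → τ (oddGap (suc m) v))

  D-odd-step : ∀ m → (∀ j → O j (2 ℕ.* m) ≃ O-even-form m j) → ∀ j → D j (suc (2 ℕ.* m)) ≃ D-odd-form m j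
  D-odd-step m ih j = ≃-trans (D-closed (2 ℕ.* m) j) (≃-trans
    (+-cong (+-cong (-‿cong (α-gap (suc (2 ℕ.* m)) (oddGap (suc m) 0) (oddGap-0 m) j)) (D-head-odd m j)) (≃-trans (weighted-cong wU j ih) (≃-trans
      (weighted-+₄ wU j (λ i → fromℚ (STower.even alternation m i)) C₁ C₂ (λ i → - C₃ i))
      (+-cong (+-cong (+-cong (SC.P-fromℚ-even alternation m j)
        (TC.Q-odd m one (λ u → α (oddGap m u)) j))
        (TC.Q-odd m plus (λ v → τ (oddGap m v)) j))
        (≃-trans (weighted-neg wU j C₃) (-‿cong (SC.P-even m minus (λ v → τ (evenGap m v)) j)))))))
    (≃-trans (solve 6 (λ a h e b c d → (:- a :+ (:- h)) :+ (((e :+ (:- b)) :+ (:- c)) :+ (:- d)) := ((e :- (a :+ b)) :- (h :+ c)) :- d) ≃-refl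
      (fromℚ (one j) * α (oddGap (suc m) 0)) (fromℚ (plus j) * τ (oddGap (suc m) 0)) (fromℚ (STower.odd alternation m j))
      (combination m (λ u → TTower.even one (suc u)) (λ u → α (oddGap m u)) j)
      (combination m (λ v → TTower.even plus (suc v)) (λ v → τ (oddGap m v)) j)
      (combination m (STower.odd minus) (λ v → τ (evenGap m v)) j))
      (+-congʳ (+-cong (+-congˡ (-‿cong (+-congˡ (shift m (TTower.even one) α {oddGap m} {oddGap (suc m)} j (oddGap-suc m)))))
        (-‿cong (+-congˡ (shift m (TTower.even plus) τ {oddGap m} {oddGap (suc m)} j (oddGap-suc m))))))))
    where
    C₁ C₂ C₃ : ℕ → ℝ
    C₁ = combination m (TTower.odd one) (λ u → α (oddGap m u))
    C₂ = combination m (TTower.odd plus) (λ v → τ (oddGap m v))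
    C₃ = combination m (STower.even minus) (λ v → τ (evenGap m v))

  O-even-step : ∀ m → (∀ j → D j (suc (2 ℕ.* m)) ≃ D-odd-form m j) → ∀ j → O j (2 ℕ.* suc m) ≃ O-even-form (suc m) j
  O-even-step m ih j = ≃-trans (≡⇒≃ (cong (O j) (ℕₚ.*-suc 2 m))) (≃-trans (O-closed (suc (2 ℕ.* m)) j) (≃-trans
    (+-cong (O-head-even m j) (-‿cong (≃-trans (weighted-cong wV (suc j) ih) (≃-trans
      (weighted-+₄ wV (suc j) (λ i → fromℚ (STower.odd alternation m i)) (λ i → - C₁ i) (λ i → - C₂ i) (λ i → - C₃ i))
      (+-cong (+-cong (+-cong (SC.Q-fromℚ-odd alternation m j)
        (≃-trans (weighted-neg wV (suc j) C₁) (-‿cong (TC.P-even (suc m) one (λ u → α (oddGap (suc m) u)) j))))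
        (≃-trans (weighted-neg wV (suc j) C₂) (-‿cong (TC.P-even (suc m) plus (λ v → τ (oddGap (suc m) v)) j))))
        (≃-trans (weighted-neg wV (suc j) C₃) (-‿cong (SC.Q-odd m minus (λ v → τ (evenGap m v)) j))))))))
    (≃-trans (solve 5 (λ h e b c d → :- h :+ (:- (((:- e :+ (:- b)) :+ (:- c)) :+ (:- :- d))) := ((e :+ b) :+ c) :- (h :+ d)) ≃-refl
      (fromℚ (minus j) * τ (evenGap (suc m) 0)) (fromℚ (STower.even alternation (suc m) j))
      (combination (suc m) (TTower.odd one) (λ u → α (oddGap (suc m) u)) j)
      (combination (suc m) (TTower.odd plus) (λ v → τ (oddGap (suc m) v)) j)
      (combination m (λ v → STower.even minus (suc v)) (λ v → τ (evenGap m v)) j))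
      (+-congˡ (-‿cong (+-congˡ (shift m (STower.even minus) τ {evenGap m} {evenGap (suc m)} j (evenGap-suc m))))))))
    where
    C₁ C₂ C₃ : ℕ → ℝ
    C₁ = combination (suc m) (TTower.even one) (λ u → α (oddGap (suc m) u))
    C₂ = combination (suc m) (TTower.even plus) (λ v → τ (oddGap (suc m) v))
    C₃ = combination m (STower.odd minus) (λ v → τ (evenGap m v))

  -- A step raises the exponent by one and exchanges even and odd degrees, so the parity of degree
  -- plus exponent is kept. This gives two independent chains: this one and that of `O-even` and
  -- `D-odd`, each starting from (-1)ⁿ at exponent 0.
  D-even : ∀ m j → D j (2 ℕ.* m) ≃ D-even-form m j
  O-odd  : ∀ m j → O j (suc (2 ℕ.* m)) ≃ O-odd-form m j
  D-even zero    j = ≃-trans (M-power (2 ℕ.* j) (alternation j))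
    (solve 1 (λ a → a := ((a :- con 0ℚ) :+ con 0ℚ) :+ con 0ℚ) ≃-refl (fromℚ (alternation j)))
  D-even (suc m) = D-even-step m (O-odd m)
  O-odd  m       = O-odd-step m (D-even m)

  O-even : ∀ m j → O j (2 ℕ.* m) ≃ O-even-form m j
  D-odd  : ∀ m j → D j (suc (2 ℕ.* m)) ≃ D-odd-form m j
  O-even zero    j = ≃-trans (M-power (suc (2 ℕ.* j)) (alternation j))
    (solve 1 (λ a → a := ((a :+ con 0ℚ) :+ con 0ℚ) :- con 0ℚ) ≃-refl (fromℚ (alternation j)))
  O-even (suc m) = O-even-step m (D-odd m)
  D-odd  m       = D-odd-step m (O-even m)

open ClosedForms

-- Matching the individual terms of the theorem

module Terms where
  open ℝ-Solver
  private module Q = ℚ-Solver.+-*-Solver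

  coefficient : ℕ → ℕ → ℕ → ℝ
  coefficient j p N = fromℚ ((-1^ suc j ℚ.* fromℕ (p !)) /ₙ N)

  !-inverse : ∀ p → fromℕ (p !) ℚ.* recipℕ (p !) ≡ 1ℚ
  !-inverse p = recipℕ-inverse (p !) {{p ℕₚ.!≢0}}

  2^-inverse : ∀ k → fromℕ (2 ℕ.^ k) ℚ.* recipℕ (2 ℕ.^ k) ≡ 1ℚ
  2^-inverse k = recipℕ-inverse (2 ℕ.^ k) {{ℕₚ.m^n≢0 2 k}}

  pad : ∀ x {y} → y ≡ 1ℚ → x ≡ x ℚ.* y
  pad x refl = ≡.sym (ℚₚ.*-identityʳ x)

  -- Undoes the normalisation, as the sign squares to 1. The three equations translate the truncated
  -- exponents and denominators of the theorem.
  I-M : ∀ j {k k′ p p′ N} → k ≡ k′ → p ≡ p′ → N ≡ suc k′ → I k p ≃ coefficient j p N * M k′ (alternation j) p′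
  I-M j {k} {_} {p} refl refl refl = ≃-sym (≃-trans (≃-sym (*-assoc _ _ _)) (≃-trans (*-congʳ (≃-trans (≃-sym (fromℚ-* _ _))
    (fromℚ-cong inverse))) (*-identityˡ (I k p))))
    where
    inverse : ((-1^ suc j ℚ.* fromℕ (p !)) /ₙ suc k) ℚ.* ((-1^ suc j ℚ.* fromℕ (suc k)) ℚ.* recipℕ (p !)) ≡ 1ℚ
    inverse = ≡.trans
      (Q.solve 5 (λ e f r N g → ((e Q.:* f) Q.:* r) Q.:* ((e Q.:* N) Q.:* g) Q.:= (e Q.:* e) Q.:* ((f Q.:* g) Q.:* (N Q.:* r))) refl
        (-1^ suc j) (fromℕ (p !)) (1/suc k) (fromℕ (suc k)) (recipℕ (p !)))
      (cong₂ ℚ._*_ (-1^n*-1^n (suc j)) (cong₂ ℚ._*_ (!-inverse p) (1/suc-inverse k)))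

  headTerm : ∀ j p N x y → -1^ suc j ℚ.* y ≡ x → fromℚ (x /ₙ N) * t̄1 ^ p ≃ coefficient j p N * (fromℚ y * τ p)
  headTerm j p N x y h = ≃-trans (*-congʳ (fromℚ-cong eq)) (≃-trans
    (*-congʳ (≃-pointwise {y = coefficient j p N * (fromℚ y * fromℚ (recipℕ (p !)))} λ _ → refl)) (≃-trans
    (solve 4 (λ c y r t → (c :* (y :* r)) :* t := c :* (y :* (r :* t))) ≃-refl (coefficient j p N) (fromℚ y) (fromℚ (recipℕ (p !))) (t̄1 ^ p))
    (*-congˡ (*-congˡ (≃-sym (τ≃ p))))))
    where
    eq : x /ₙ N ≡ ((-1^ suc j ℚ.* fromℕ (p !)) /ₙ N) ℚ.* (y ℚ.* recipℕ (p !))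
    eq = ≡.trans (≡.trans (/ₙ-recipℕ x N) (≡.trans (cong (ℚ._* recipℕ N) (≡.sym h)) (pad _ (!-inverse p))))
      (≡.trans (Q.solve 5 (λ e y N f g → ((e Q.:* y) Q.:* N) Q.:* (f Q.:* g) Q.:= ((e Q.:* f) Q.:* N) Q.:* (y Q.:* g)) refl
        (-1^ suc j) y (recipℕ N) (fromℕ (p !)) (recipℕ (p !)))
        (cong (ℚ._* (y ℚ.* recipℕ (p !))) (≡.sym (/ₙ-recipℕ (-1^ suc j ℚ.* fromℕ (p !)) N))))

  headPlus : ∀ j p N → fromℚ ((1ℚ ℚ.+ -1^ suc j) /ₙ N) * t̄1 ^ p ≃ coefficient j p N * (fromℚ (plus j) * τ p)
  headPlus j p N = headTerm j p N (1ℚ ℚ.+ -1^ suc j) (plus j) (≡.trans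
    (Q.solve 1 (λ e → e Q.:* (Q.con 1ℚ Q.:+ Q.con 1ℚ Q.:* e) Q.:= e Q.:* e Q.:+ e) refl (-1^ suc j))
    (cong (ℚ._+ -1^ suc j) (-1^n*-1^n (suc j))))

  headMinus : ∀ j p N → fromℚ ((1ℚ ℚ.- -1^ suc j) /ₙ N) * t̄1 ^ p ≃ - (coefficient j p N * (fromℚ (minus j) * τ p))
  headMinus j p N = ≃-trans (headTerm j p N (1ℚ ℚ.- -1^ suc j) (ℚ.- minus j) (≡.trans
    (Q.solve 1 (λ e → e Q.:* (Q.:- (Q.con 1ℚ Q.:+ Q.con (ℚ.- 1ℚ) Q.:* e)) Q.:= e Q.:* e Q.:- e) refl (-1^ suc j))
    (cong (ℚ._- -1^ suc j) (-1^n*-1^n (suc j)))))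
    (≃-trans (*-congˡ (*-congʳ (≃-pointwise {y = - fromℚ (minus j)} λ _ → refl)))
      (solve 3 (λ c y t → c :* ((:- y) :* t) := :- (c :* (y :* t))) ≃-refl (coefficient j p N) (fromℚ (minus j)) (τ p)))

  -- The scale s 2ᵏ inside the harmonic sum V cancels the sign (-1)ᵐ and the denominator 2ᵏ.
  lastTerm : ∀ j m p N k s V x → s ℚ.* -1^ m ≡ 1ℚ → V ≡ (s ℚ.* fromℕ (2 ℕ.^ k)) ℚ.* x →
    fromℚ ((-1^ (suc j ℕ.+ m) ℚ.* fromℕ (p !)) /ₙ (2 ℕ.^ k ℕ.* N) ℚ.* V) ≃ coefficient j p N * fromℚ x
  lastTerm j m p N k s V x hs hV = ≃-trans (fromℚ-cong eq) (fromℚ-* ((-1^ suc j ℚ.* fromℕ (p !)) /ₙ N) x)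
    where
    eq : (-1^ (suc j ℕ.+ m) ℚ.* fromℕ (p !)) /ₙ (2 ℕ.^ k ℕ.* N) ℚ.* V ≡ ((-1^ suc j ℚ.* fromℕ (p !)) /ₙ N) ℚ.* x
    eq = ≡.trans (cong₂ ℚ._*_ (≡.trans (/ₙ-recipℕ (-1^ (suc j ℕ.+ m) ℚ.* fromℕ (p !)) (2 ℕ.^ k ℕ.* N))
        (cong₂ ℚ._*_ (cong (ℚ._* fromℕ (p !)) (-1^-+ (suc j) m)) (recipℕ-* (2 ℕ.^ k) N))) hV)
      (≡.trans (Q.solve 8 (λ e t f g N s b x → (((e Q.:* t) Q.:* f) Q.:* (g Q.:* N)) Q.:* ((s Q.:* b) Q.:* x)
          Q.:= (((e Q.:* f) Q.:* N) Q.:* x) Q.:* ((s Q.:* t) Q.:* (b Q.:* g))) refl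
          (-1^ suc j) (-1^ m) (fromℕ (p !)) (recipℕ (2 ℕ.^ k)) (recipℕ N) s (fromℕ (2 ℕ.^ k)) x)
        (≡.trans (cong₂ (λ a b → (((-1^ suc j ℚ.* fromℕ (p !)) ℚ.* recipℕ N) ℚ.* x) ℚ.* (a ℚ.* b)) hs (2^-inverse k))
          (≡.trans (ℚₚ.*-identityʳ _) (cong (ℚ._* x) (≡.sym (/ₙ-recipℕ (-1^ suc j ℚ.* fromℕ (p !)) N))))))

  -- The theorem multiplies V by s/2ᵏ while V itself carries s 2ᵏ; since s² = 1, the bare tower
  -- value remains.
  αTerm : ∀ q k s V x → s ℚ.* s ≡ 1ℚ → V ≡ (s ℚ.* fromℕ (2 ℕ.^ k)) ℚ.* x →
    fromℚ ((s ℚ.* V) /ₙ (q ! ℕ.* 2 ℕ.^ k)) * A q ≃ fromℚ x * α q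
  αTerm q k s V x hs hV = ≃-trans (*-congʳ (fromℚ-cong eq)) (≃-trans (*-congʳ (fromℚ-* x (recipℕ (q !))))
    (≃-trans (*-assoc _ _ _) (*-congˡ (≃-sym (α≃ q)))))
    where
    eq : (s ℚ.* V) /ₙ (q ! ℕ.* 2 ℕ.^ k) ≡ x ℚ.* recipℕ (q !)
    eq = ≡.trans (/ₙ-recipℕ (s ℚ.* V) (q ! ℕ.* 2 ℕ.^ k)) (≡.trans
      (cong₂ ℚ._*_ (cong (s ℚ.*_) hV) (recipℕ-* (q !) (2 ℕ.^ k)))
      (≡.trans (Q.solve 5 (λ s b x f g → (s Q.:* ((s Q.:* b) Q.:* x)) Q.:* (f Q.:* g) Q.:= (x Q.:* f) Q.:* ((s Q.:* s) Q.:* (b Q.:* g))) refl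
          s (fromℕ (2 ℕ.^ k)) x (recipℕ (q !)) (recipℕ (2 ℕ.^ k)))
        (≡.trans (cong₂ (λ a b → (x ℚ.* recipℕ (q !)) ℚ.* (a ℚ.* b)) hs (2^-inverse k)) (ℚₚ.*-identityʳ _))))

  τTerm : ∀ q k s V x → s ℚ.* s ≡ 1ℚ → V ≡ (s ℚ.* fromℕ (2 ℕ.^ k)) ℚ.* x →
    (fromℚ (s /ₙ (2 ℕ.^ k ℕ.* q !)) * t̄1 ^ q) * fromℚ V ≃ fromℚ x * τ q
  τTerm q k s V x hs hV = ≃-trans
    (solve 3 (λ a t v → (a :* t) :* v := (a :* v) :* t) ≃-refl (fromℚ (s /ₙ (2 ℕ.^ k ℕ.* q !))) (t̄1 ^ q) (fromℚ V))
    (≃-trans (*-congʳ (≃-trans (≃-sym (fromℚ-* (s /ₙ (2 ℕ.^ k ℕ.* q !)) V)) (≃-trans (fromℚ-cong eq) (fromℚ-* x (recipℕ (q !))))))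
      (≃-trans (*-assoc _ _ _) (*-congˡ (≃-sym (τ≃ q)))))
    where
    eq : (s /ₙ (2 ℕ.^ k ℕ.* q !)) ℚ.* V ≡ x ℚ.* recipℕ (q !)
    eq = ≡.trans (cong₂ ℚ._*_ (≡.trans (/ₙ-recipℕ s (2 ℕ.^ k ℕ.* q !)) (cong (s ℚ.*_) (recipℕ-* (2 ℕ.^ k) (q !)))) hV)
      (≡.trans (Q.solve 5 (λ s b x f g → (s Q.:* (g Q.:* f)) Q.:* ((s Q.:* b) Q.:* x) Q.:= (x Q.:* f) Q.:* ((s Q.:* s) Q.:* (b Q.:* g))) refl
          s (fromℕ (2 ℕ.^ k)) x (recipℕ (q !)) (recipℕ (2 ℕ.^ k)))
        (≡.trans (cong₂ (λ a b → (x ℚ.* recipℕ (q !)) ℚ.* (a ℚ.* b)) hs (2^-inverse k)) (ℚₚ.*-identityʳ _)))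

  Σ-from-0 : ∀ m (f g : ℕ → ℝ) → (∀ u → f u ≃ g u) → Σ[ 0 ⋯ suc m ℕ.∸ 1 ] f ≃ Σ< (suc m) g
  Σ-from-0 m f g e = Σ<-cong (suc m) e

  -- Shift of the index. For m = 0 the range from 1 to 0 is empty on both sides.
  Σ-from-1 : ∀ m (f g : ℕ → ℝ) → (∀ u → f (suc u) ≃ g u) → Σ[ 1 ⋯ suc m ℕ.∸ 1 ] f ≃ Σ< m g
  Σ-from-1 m f g e = Σ<-cong m e

  Σα-from-0 : ∀ m (s : ℕ → ℚ) (k q : ℕ → ℕ) (V x : ℕ → ℚ) → (∀ u → s u ℚ.* s u ≡ 1ℚ) → (∀ u → V u ≡ (s u ℚ.* fromℕ (2 ℕ.^ k u)) ℚ.* x u) →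
    (Σ[ 0 ⋯ suc m ℕ.∸ 1 ] λ u → fromℚ ((s u ℚ.* V u) /ₙ (q u ! ℕ.* 2 ℕ.^ k u)) * A (q u)) ≃ Σ< (suc m) (λ u → fromℚ (x u) * α (q u))
  Σα-from-0 m s k q V x hs hV = Σ-from-0 m (λ u → fromℚ ((s u ℚ.* V u) /ₙ (q u ! ℕ.* 2 ℕ.^ k u)) * A (q u)) (λ u → fromℚ (x u) * α (q u))
    λ u → αTerm (q u) (k u) (s u) (V u) (x u) (hs u) (hV u)

  -- Serves the sums over the odd depths 2u - 1: after the shift the theorem has the sign (-1)^(u+1)
  -- where `oddScale u` has (-1)^u.
  Σα-from-1-neg : ∀ m (s : ℕ → ℚ) (k q : ℕ → ℕ) (V x : ℕ → ℚ) → (∀ u → s (suc u) ℚ.* s (suc u) ≡ 1ℚ) → (∀ u → V (suc u) ≡ (s (suc u) ℚ.* fromℕ (2 ℕ.^ k (suc u))) ℚ.* (ℚ.- x u)) →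
    (Σ[ 1 ⋯ suc m ℕ.∸ 1 ] λ u → fromℚ ((s u ℚ.* V u) /ₙ (q u ! ℕ.* 2 ℕ.^ k u)) * A (q u)) ≃ - Σ< m (λ u → fromℚ (x u) * α (q (suc u)))
  Σα-from-1-neg m s k q V x hs hV = ≃-trans
    (Σ-from-1 m (λ u → fromℚ ((s u ℚ.* V u) /ₙ (q u ! ℕ.* 2 ℕ.^ k u)) * A (q u)) (λ u → fromℚ (ℚ.- x u) * α (q (suc u)))
      λ u → αTerm (q (suc u)) (k (suc u)) (s (suc u)) (V (suc u)) (ℚ.- x u) (hs u) (hV u))
    (combination-neg m (λ u _ → x u) (λ u → α (q (suc u))) 0)

  Στ-from-0 : ∀ m (s : ℕ → ℚ) (k q : ℕ → ℕ) (V x : ℕ → ℚ) → (∀ v → s v ℚ.* s v ≡ 1ℚ) → (∀ v → V v ≡ (s v ℚ.* fromℕ (2 ℕ.^ k v)) ℚ.* x v) →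
    (Σ[ 0 ⋯ suc m ℕ.∸ 1 ] λ v → (fromℚ (s v /ₙ (2 ℕ.^ k v ℕ.* q v !)) * t̄1 ^ q v) * fromℚ (V v)) ≃ Σ< (suc m) (λ v → fromℚ (x v) * τ (q v))
  Στ-from-0 m s k q V x hs hV = Σ-from-0 m (λ v → (fromℚ (s v /ₙ (2 ℕ.^ k v ℕ.* q v !)) * t̄1 ^ q v) * fromℚ (V v)) (λ v → fromℚ (x v) * τ (q v))
    λ v → τTerm (q v) (k v) (s v) (V v) (x v) (hs v) (hV v)

  Στ-from-1 : ∀ m (s : ℕ → ℚ) (k q : ℕ → ℕ) (V x : ℕ → ℚ) → (∀ v → s (suc v) ℚ.* s (suc v) ≡ 1ℚ) → (∀ v → V (suc v) ≡ (s (suc v) ℚ.* fromℕ (2 ℕ.^ k (suc v))) ℚ.* x v) →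
    (Σ[ 1 ⋯ suc m ℕ.∸ 1 ] λ v → (fromℚ (s v /ₙ (2 ℕ.^ k v ℕ.* q v !)) * t̄1 ^ q v) * fromℚ (V v)) ≃ Σ< m (λ v → fromℚ (x v) * τ (q (suc v)))
  Στ-from-1 m s k q V x hs hV = Σ-from-1 m (λ v → (fromℚ (s v /ₙ (2 ℕ.^ k v ℕ.* q v !)) * t̄1 ^ q v) * fromℚ (V v)) (λ v → fromℚ (x v) * τ (q (suc v)))
    λ v → τTerm (q (suc v)) (k (suc v)) (s (suc v)) (V (suc v)) (x v) (hs v) (hV v)

  Στ-from-1-neg : ∀ m (s : ℕ → ℚ) (k q : ℕ → ℕ) (V x : ℕ → ℚ) → (∀ v → s (suc v) ℚ.* s (suc v) ≡ 1ℚ) → (∀ v → V (suc v) ≡ (s (suc v) ℚ.* fromℕ (2 ℕ.^ k (suc v))) ℚ.* (ℚ.- x v)) →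
    (Σ[ 1 ⋯ suc m ℕ.∸ 1 ] λ v → (fromℚ (s v /ₙ (2 ℕ.^ k v ℕ.* q v !)) * t̄1 ^ q v) * fromℚ (V v)) ≃ - Σ< m (λ v → fromℚ (x v) * τ (q (suc v)))
  Στ-from-1-neg m s k q V x hs hV = ≃-trans (Στ-from-1 m s k q V (λ v → ℚ.- x v) hs hV)
    (combination-neg m (λ v _ → x v) (λ v → τ (q (suc v))) 0)

open Terms

-- The harmonic sums of the theorem as scaled towers

module SumValues where
  open ℚ-Solver.+-*-Solver

  2*suc∸1 : ∀ v → 2 ℕ.* suc v ℕ.∸ 1 ≡ 2 ℕ.* v ℕ.+ 1
  2*suc∸1 v = ≡.trans (cong (ℕ._∸ 1) (ℕₚ.*-suc 2 v)) (ℕₚ.+-comm 1 (2 ℕ.* v))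

  2*suc∸2 : ∀ v → 2 ℕ.* suc v ℕ.∸ 2 ≡ 2 ℕ.* v
  2*suc∸2 v = cong (ℕ._∸ 2) (ℕₚ.*-suc 2 v)

  flip : ∀ (v k : ℕ) {V} x → V ≡ (-1^ v ℚ.* fromℕ (2 ℕ.^ k)) ℚ.* x → V ≡ (-1^ suc v ℚ.* fromℕ (2 ℕ.^ k)) ℚ.* (ℚ.- x)
  flip v k x h = ≡.trans h (solve 3 (λ s b x → (s :* b) :* x := ((con (ℚ.- 1ℚ) :* s) :* b) :* (:- x)) refl (-1^ v) (fromℕ (2 ℕ.^ k)) x)

  flip+1 : ∀ (v k : ℕ) {V} x → V ≡ (-1^ v ℚ.* fromℕ (2 ℕ.^ k)) ℚ.* x → V ≡ (-1^ (v ℕ.+ 1) ℚ.* fromℕ (2 ℕ.^ k)) ℚ.* (ℚ.- x)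
  flip+1 v k x h = ≡.trans (flip v k x h) (cong (λ e → (-1^ e ℚ.* fromℕ (2 ℕ.^ k)) ℚ.* (ℚ.- x)) (ℕₚ.+-comm 1 v))

  add : ∀ {V W} κ a b → V ≡ κ ℚ.* a → W ≡ κ ℚ.* b → V ℚ.+ W ≡ κ ℚ.* (a ℚ.+ 1ℚ ℚ.* b)
  add κ a b refl refl = solve 3 (λ k a b → k :* a :+ k :* b := k :* (a :+ con 1ℚ :* b)) refl κ a b

  subtract : ∀ {V W} κ a b → V ≡ κ ℚ.* a → W ≡ κ ℚ.* b → V ℚ.- W ≡ κ ℚ.* (a ℚ.+ (ℚ.- 1ℚ) ℚ.* b)
  subtract κ a b refl refl = solve 3 (λ k a b → k :* a :- k :* b := k :* (a :+ con (ℚ.- 1ℚ) :* b)) refl κ a b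

  T-even : ∀ j v → T (suc j) (ones (2 ℕ.* v)) ≡ evenScale v ℚ.* TTower.even one v j
  T-even j v = TValues.EvenValue.value (TValues.ones-even v) j

  T-odd : ∀ j v → T (suc j) (ones (2 ℕ.* v ℕ.+ 1)) ≡ oddScale v ℚ.* TTower.odd one v j
  T-odd j v = TValues.OddValue.value (TValues.ones-odd v) j

  T-even-alternation : ∀ j v → T (suc j) (ones,-1 (2 ℕ.* suc v ℕ.∸ 1)) ≡ evenScale (suc v) ℚ.* TTower.even alternation (suc v) j
  T-even-alternation j v = ≡.trans (cong (λ k → T (suc j) (ones,-1 k)) (2*suc∸1 v)) (TValues.EvenValue.value (TValues.ones,-1-even v) j)

  T-odd-alternation : ∀ j v → T (suc j) (ones,-1 (2 ℕ.* v)) ≡ oddScale v ℚ.* TTower.odd alternation v j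
  T-odd-alternation j v = TValues.OddValue.value (TValues.ones,-1-odd v) j

  -- Both sums have depth 2v + 2 and hence the same scale, so linearity merges their towers. Index 0
  -- is left out: there the tower stands for the leading term.
  T-even-plus : ∀ j v → T (suc j) (ones (2 ℕ.* suc v)) ℚ.+ T (suc j) (ones,-1 (2 ℕ.* suc v ℕ.∸ 1)) ≡ evenScale (suc v) ℚ.* TTower.even plus (suc v) j
  T-even-plus j v = ≡.trans
    (add (evenScale (suc v)) (TTower.even one (suc v) j) (TTower.even alternation (suc v) j) (T-even j (suc v)) (T-even-alternation j v))
    (cong (evenScale (suc v) ℚ.*_) (≡.sym (TTower.even-linear 1ℚ one alternation (suc v) j)))

  T-odd-plus : ∀ j v → T (suc j) (ones (2 ℕ.* v ℕ.+ 1)) ℚ.+ T (suc j) (ones,-1 (2 ℕ.* v)) ≡ oddScale v ℚ.* TTower.odd plus v j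
  T-odd-plus j v = ≡.trans
    (add (oddScale v) (TTower.odd one v j) (TTower.odd alternation v j) (T-odd j v) (T-odd-alternation j v))
    (cong (oddScale v ℚ.*_) (≡.sym (TTower.odd-linear 1ℚ one alternation v j)))

  S-even : ∀ j v → S (suc j) (ones (2 ℕ.* v)) ≡ evenScale v ℚ.* STower.even one v j
  S-even j v = SValues.EvenValue.value (SValues.ones-even v) j

  S-odd : ∀ j v → S (suc j) (ones (2 ℕ.* v ℕ.+ 1)) ≡ oddScale v ℚ.* STower.odd one v j
  S-odd j v = SValues.OddValue.value (SValues.ones-odd v) j

  S-even-alternation : ∀ j v → S (suc j) (ones,-1 (2 ℕ.* suc v ℕ.∸ 1)) ≡ evenScale (suc v) ℚ.* STower.even alternation (suc v) j
  S-even-alternation j v = ≡.trans (cong (λ k → S (suc j) (ones,-1 k)) (2*suc∸1 v)) (SValues.EvenValue.value (SValues.ones,-1-even v) j)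

  S-odd-alternation : ∀ j v → S (suc j) (ones,-1 (2 ℕ.* v)) ≡ oddScale v ℚ.* STower.odd alternation v j
  S-odd-alternation j v = SValues.OddValue.value (SValues.ones,-1-odd v) j

  S-even-minus : ∀ j v → S (suc j) (ones (2 ℕ.* suc v)) ℚ.- S (suc j) (ones,-1 (2 ℕ.* suc v ℕ.∸ 1)) ≡ evenScale (suc v) ℚ.* STower.even minus (suc v) j
  S-even-minus j v = ≡.trans
    (subtract (evenScale (suc v)) (STower.even one (suc v) j) (STower.even alternation (suc v) j) (S-even j (suc v)) (S-even-alternation j v))
    (cong (evenScale (suc v) ℚ.*_) (≡.sym (STower.even-linear (ℚ.- 1ℚ) one alternation (suc v) j)))

  S-odd-minus : ∀ j v → S (suc j) (ones (2 ℕ.* v ℕ.+ 1)) ℚ.- S (suc j) (ones,-1 (2 ℕ.* v)) ≡ oddScale v ℚ.* STower.odd minus v j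
  S-odd-minus j v = ≡.trans
    (subtract (oddScale v) (STower.odd one v j) (STower.odd alternation v j) (S-odd j v) (S-odd-alternation j v))
    (cong (oddScale v ℚ.*_) (≡.sym (STower.odd-linear (ℚ.- 1ℚ) one alternation v j)))

  -- With v + 1 for v the odd sums are indexed by 2v - 1 and 2v - 2, and the sign changes.
  oddFlip : ∀ (F : ℕ → ℕ → ℚ) v x → F (2 ℕ.* v ℕ.+ 1) (2 ℕ.* v) ≡ oddScale v ℚ.* x →
    F (2 ℕ.* suc v ℕ.∸ 1) (2 ℕ.* suc v ℕ.∸ 2) ≡ (-1^ suc v ℚ.* fromℕ (2 ℕ.^ (2 ℕ.* suc v ℕ.∸ 1))) ℚ.* (ℚ.- x)
  oddFlip F v x h = flip v (2 ℕ.* suc v ℕ.∸ 1) x (≡.trans (cong₂ F (2*suc∸1 v) (2*suc∸2 v))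
    (≡.trans h (cong (λ k → (-1^ v ℚ.* fromℕ (2 ℕ.^ k)) ℚ.* x) (≡.sym (2*suc∸1 v)))))

open SumValues

-- Assembly of the four formulas

module Assembly where
  open ℝ-Solver

  assemble : ∀ {L c z h y a b d X Y P Q R} → L ≃ c * z → z ≃ (((h + y) + a) + b) + d →
    X ≃ c * h → Y ≃ c * y → P ≃ c * a → Q ≃ c * b → R ≃ c * d → L ≃ (((X + Y) + P) + Q) + R
  assemble {c = c} {h = h} {y} {a} {b} {d} L≃ z≃ X≃ Y≃ P≃ Q≃ R≃ = ≃-trans L≃ (≃-trans (*-congˡ z≃) (≃-trans
    (solve 6 (λ c h y a b d → c :* ((((h :+ y) :+ a) :+ b) :+ d) := (((c :* h :+ c :* y) :+ c :* a) :+ c :* b) :+ c :* d) ≃-refl c h y a b d)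
    (≃-sym (+-cong (+-cong (+-cong (+-cong X≃ Y≃) P≃) Q≃) R≃))))

  -c*x : ∀ c x → - (c * x) ≃ c * (- x)
  -c*x = solve 2 (λ c x → :- (c :* x) := c :* (:- x)) ≃-refl

  negate : ∀ {c x y} → x ≃ y → - (c * x) ≃ c * (- y)
  negate {c} {x} {y} e = ≃-trans (-c*x c x) (*-congˡ (-‿cong e))

  fromℚ-neg-neg : ∀ x → - fromℚ (ℚ.- x) ≃ fromℚ x
  fromℚ-neg-neg x = ≃-trans (-‿cong (≃-pointwise {y = - fromℚ x} λ _ → refl)) (solve 1 (λ a → :- :- a := a) ≃-refl (fromℚ x))

  double-negate : ∀ {c x y} → x ≃ - y → - (c * x) ≃ c * y
  double-negate {c} {x} {y} e = ≃-trans (-‿cong (*-congˡ e)) (solve 2 (λ c y → :- (c :* (:- y)) := c :* y) ≃-refl c y)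

  unshift : ∀ n (x : ℕ → ℕ → ℚ) (c : ℕ → ℝ) {gap gap′ : ℕ → ℕ} j → (∀ u → gap u ≡ gap′ (suc u)) →
    - combination n x (λ u → c (gap′ (suc u))) j ≃ - combination n x (λ u → c (gap u)) j
  unshift n x c j e = -‿cong (combination-cong n x j λ u → ≡⇒≃ (cong c (≡.sym (e u))))

open Assembly

theorem4p5 : ∀ (n m : ℕ) → .{{_ : ℕ.NonZero n}} → .{{_ : ℕ.NonZero m}} →
    (∫ 0ℝ 1ℝ (λ x → x ^ (2 ℕ.* n ℕ.∸ 2) * arctan x ^ (2 ℕ.* m))
    (x^arctan^-uniformlyContinuous (2 ℕ.* n ℕ.∸ 2) (2 ℕ.* m)) ≃
    fromℚ ((1ℚ ℚ.+ -1^ n) /ₙ (2 ℕ.* n ℕ.∸ 1)) * t̄1 ^ (2 ℕ.* m)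
    + fromℚ ((-1^ (n ℕ.+ m) ℚ.* fromℕ ((2 ℕ.* m) !)) /ₙ (2 ℕ.^ (2 ℕ.* m) ℕ.* (2 ℕ.* n ℕ.∸ 1))
    ℚ.* T n (ones,-1 (2 ℕ.* m ℕ.∸ 1)))
    - fromℚ ((-1^ n ℚ.* fromℕ ((2 ℕ.* m) !)) /ₙ (2 ℕ.* n ℕ.∸ 1))
    * (Σ[ 0 ⋯ m ℕ.∸ 1 ] λ u →
    fromℚ ((-1^ u ℚ.* T n (ones (2 ℕ.* u))) /ₙ ((2 ℕ.* m ℕ.∸ 2 ℕ.* u) ! ℕ.* 2 ℕ.^ (2 ℕ.* u)))
    * A (2 ℕ.* m ℕ.∸ 2 ℕ.* u))
    + fromℚ ((-1^ n ℚ.* fromℕ ((2 ℕ.* m) !)) /ₙ (2 ℕ.* n ℕ.∸ 1))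
    * (Σ[ 1 ⋯ m ℕ.∸ 1 ] λ v →
    (fromℚ (-1^ v /ₙ (2 ℕ.^ (2 ℕ.* v) ℕ.* (2 ℕ.* m ℕ.∸ 2 ℕ.* v) !)) * t̄1 ^ (2 ℕ.* m ℕ.∸ 2 ℕ.* v))
    * fromℚ (T n (ones (2 ℕ.* v)) ℚ.+ T n (ones,-1 (2 ℕ.* v ℕ.∸ 1))))
    + fromℚ ((-1^ n ℚ.* fromℕ ((2 ℕ.* m) !)) /ₙ (2 ℕ.* n ℕ.∸ 1))
    * (Σ[ 0 ⋯ m ℕ.∸ 1 ] λ v →
    (fromℚ (-1^ v /ₙ (2 ℕ.^ (2 ℕ.* v ℕ.+ 1) ℕ.* (2 ℕ.* m ℕ.∸ 2 ℕ.* v ℕ.∸ 1) !)) * t̄1 ^ (2 ℕ.* m ℕ.∸ 2 ℕ.* v ℕ.∸ 1))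
    * fromℚ (S n (ones (2 ℕ.* v ℕ.+ 1)) ℚ.- S n (ones,-1 (2 ℕ.* v)))))
    ×
    (∫ 0ℝ 1ℝ (λ x → x ^ (2 ℕ.* n ℕ.∸ 2) * arctan x ^ (2 ℕ.* m ℕ.∸ 1))
    (x^arctan^-uniformlyContinuous (2 ℕ.* n ℕ.∸ 2) (2 ℕ.* m ℕ.∸ 1)) ≃
    - (fromℚ ((1ℚ ℚ.+ -1^ n) /ₙ (2 ℕ.* n ℕ.∸ 1)) * t̄1 ^ (2 ℕ.* m ℕ.∸ 1))
    - fromℚ ((-1^ (n ℕ.+ m) ℚ.* fromℕ ((2 ℕ.* m ℕ.∸ 1) !)) /ₙ (2 ℕ.^ (2 ℕ.* m ℕ.∸ 1) ℕ.* (2 ℕ.* n ℕ.∸ 1))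
    ℚ.* S n (ones,-1 (2 ℕ.* m ℕ.∸ 2)))
    - fromℚ ((-1^ n ℚ.* fromℕ ((2 ℕ.* m ℕ.∸ 1) !)) /ₙ (2 ℕ.* n ℕ.∸ 1))
    * (Σ[ 0 ⋯ m ℕ.∸ 1 ] λ u →
    fromℚ ((-1^ u ℚ.* T n (ones (2 ℕ.* u))) /ₙ ((2 ℕ.* m ℕ.∸ 2 ℕ.* u ℕ.∸ 1) ! ℕ.* 2 ℕ.^ (2 ℕ.* u)))
    * A (2 ℕ.* m ℕ.∸ 2 ℕ.* u ℕ.∸ 1))
    + fromℚ ((-1^ n ℚ.* fromℕ ((2 ℕ.* m ℕ.∸ 1) !)) /ₙ (2 ℕ.* n ℕ.∸ 1))
    * (Σ[ 1 ⋯ m ℕ.∸ 1 ] λ v →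
    (fromℚ (-1^ (v ℕ.+ 1) /ₙ (2 ℕ.^ (2 ℕ.* v) ℕ.* (2 ℕ.* m ℕ.∸ 2 ℕ.* v ℕ.∸ 1) !)) * t̄1 ^ (2 ℕ.* m ℕ.∸ 2 ℕ.* v ℕ.∸ 1))
    * fromℚ (T n (ones (2 ℕ.* v)) ℚ.+ T n (ones,-1 (2 ℕ.* v ℕ.∸ 1))))
    + fromℚ ((-1^ n ℚ.* fromℕ ((2 ℕ.* m ℕ.∸ 1) !)) /ₙ (2 ℕ.* n ℕ.∸ 1))
    * (Σ[ 1 ⋯ m ℕ.∸ 1 ] λ v →
    (fromℚ (-1^ v /ₙ (2 ℕ.^ (2 ℕ.* v ℕ.∸ 1) ℕ.* (2 ℕ.* m ℕ.∸ 2 ℕ.* v) !)) * t̄1 ^ (2 ℕ.* m ℕ.∸ 2 ℕ.* v))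
    * fromℚ (S n (ones (2 ℕ.* v ℕ.∸ 1)) ℚ.- S n (ones,-1 (2 ℕ.* v ℕ.∸ 2)))))
    ×
    (∫ 0ℝ 1ℝ (λ x → x ^ (2 ℕ.* n ℕ.∸ 1) * arctan x ^ (2 ℕ.* m))
    (x^arctan^-uniformlyContinuous (2 ℕ.* n ℕ.∸ 1) (2 ℕ.* m)) ≃
    fromℚ ((1ℚ ℚ.- -1^ n) /ₙ (2 ℕ.* n)) * t̄1 ^ (2 ℕ.* m)
    + fromℚ ((-1^ (n ℕ.+ m) ℚ.* fromℕ ((2 ℕ.* m) !)) /ₙ (2 ℕ.^ (2 ℕ.* m) ℕ.* (2 ℕ.* n))
    ℚ.* S n (ones,-1 (2 ℕ.* m ℕ.∸ 1)))
    + fromℚ ((-1^ n ℚ.* fromℕ ((2 ℕ.* m) !)) /ₙ (2 ℕ.* n))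
    * (Σ[ 0 ⋯ m ℕ.∸ 1 ] λ u →
    fromℚ ((-1^ u ℚ.* T n (ones (2 ℕ.* u ℕ.+ 1))) /ₙ ((2 ℕ.* m ℕ.∸ 2 ℕ.* u ℕ.∸ 1) ! ℕ.* 2 ℕ.^ (2 ℕ.* u ℕ.+ 1)))
    * A (2 ℕ.* m ℕ.∸ 2 ℕ.* u ℕ.∸ 1))
    + fromℚ ((-1^ n ℚ.* fromℕ ((2 ℕ.* m) !)) /ₙ (2 ℕ.* n))
    * (Σ[ 0 ⋯ m ℕ.∸ 1 ] λ v →
    (fromℚ (-1^ v /ₙ (2 ℕ.^ (2 ℕ.* v ℕ.+ 1) ℕ.* (2 ℕ.* m ℕ.∸ 2 ℕ.* v ℕ.∸ 1) !)) * t̄1 ^ (2 ℕ.* m ℕ.∸ 2 ℕ.* v ℕ.∸ 1))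
    * fromℚ (T n (ones (2 ℕ.* v ℕ.+ 1)) ℚ.+ T n (ones,-1 (2 ℕ.* v))))
    + fromℚ ((-1^ n ℚ.* fromℕ ((2 ℕ.* m) !)) /ₙ (2 ℕ.* n))
    * (Σ[ 1 ⋯ m ℕ.∸ 1 ] λ v →
    (fromℚ (-1^ (v ℕ.+ 1) /ₙ (2 ℕ.^ (2 ℕ.* v) ℕ.* (2 ℕ.* m ℕ.∸ 2 ℕ.* v) !)) * t̄1 ^ (2 ℕ.* m ℕ.∸ 2 ℕ.* v))
    * fromℚ (S n (ones (2 ℕ.* v)) ℚ.- S n (ones,-1 (2 ℕ.* v ℕ.∸ 1)))))
    ×
    (∫ 0ℝ 1ℝ (λ x → x ^ (2 ℕ.* n ℕ.∸ 1) * arctan x ^ (2 ℕ.* m ℕ.∸ 1))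
    (x^arctan^-uniformlyContinuous (2 ℕ.* n ℕ.∸ 1) (2 ℕ.* m ℕ.∸ 1)) ≃
    - (fromℚ ((1ℚ ℚ.- -1^ n) /ₙ (2 ℕ.* n)) * t̄1 ^ (2 ℕ.* m ℕ.∸ 1))
    + fromℚ ((-1^ (n ℕ.+ m) ℚ.* fromℕ ((2 ℕ.* m ℕ.∸ 1) !)) /ₙ (2 ℕ.^ (2 ℕ.* m ℕ.∸ 1) ℕ.* (2 ℕ.* n))
    ℚ.* T n (ones,-1 (2 ℕ.* m ℕ.∸ 2)))
    - fromℚ ((-1^ n ℚ.* fromℕ ((2 ℕ.* m ℕ.∸ 1) !)) /ₙ (2 ℕ.* n))
    * (Σ[ 1 ⋯ m ℕ.∸ 1 ] λ u →
    fromℚ ((-1^ u ℚ.* T n (ones (2 ℕ.* u ℕ.∸ 1))) /ₙ ((2 ℕ.* m ℕ.∸ 2 ℕ.* u) ! ℕ.* 2 ℕ.^ (2 ℕ.* u ℕ.∸ 1)))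
    * A (2 ℕ.* m ℕ.∸ 2 ℕ.* u))
    + fromℚ ((-1^ n ℚ.* fromℕ ((2 ℕ.* m ℕ.∸ 1) !)) /ₙ (2 ℕ.* n))
    * (Σ[ 1 ⋯ m ℕ.∸ 1 ] λ v →
    (fromℚ (-1^ v /ₙ (2 ℕ.^ (2 ℕ.* v ℕ.∸ 1) ℕ.* (2 ℕ.* m ℕ.∸ 2 ℕ.* v) !)) * t̄1 ^ (2 ℕ.* m ℕ.∸ 2 ℕ.* v))
    * fromℚ (T n (ones (2 ℕ.* v ℕ.∸ 1)) ℚ.+ T n (ones,-1 (2 ℕ.* v ℕ.∸ 2))))
    + fromℚ ((-1^ n ℚ.* fromℕ ((2 ℕ.* m ℕ.∸ 1) !)) /ₙ (2 ℕ.* n))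
    * (Σ[ 1 ⋯ m ℕ.∸ 1 ] λ v →
    (fromℚ (-1^ v /ₙ (2 ℕ.^ (2 ℕ.* v) ℕ.* (2 ℕ.* m ℕ.∸ 2 ℕ.* v ℕ.∸ 1) !)) * t̄1 ^ (2 ℕ.* m ℕ.∸ 2 ℕ.* v ℕ.∸ 1))
    * fromℚ (S n (ones (2 ℕ.* v)) ℚ.- S n (ones,-1 (2 ℕ.* v ℕ.∸ 1)))))
theorem4p5 zero    m    {{n≢0}}      = ⊥-elim (ℕ.≢-nonZero⁻¹ 0 {{n≢0}} refl)
theorem4p5 (suc j) zero {{_}} {{m≢0}} = ⊥-elim (ℕ.≢-nonZero⁻¹ 0 {{m≢0}} refl)
theorem4p5 (suc j) (suc m) =
  ( ≃-trans (∫≃I (x^arctan^-uniformlyContinuous (2 ℕ.* suc j ℕ.∸ 2) (2 ℕ.* suc m)) (2 ℕ.* suc j ℕ.∸ 2) (2 ℕ.* suc m) (λ _ → ≃-refl))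
      (assemble (I-M j (2*suc∸2 j) refl k+1)
        -- The term of index 0 in the `plus` sum is split off as the leading term; what remains is
        -- the sum from v = 1.
        (≃-trans (D-even (suc m) j) (solve 5 (λ y a h b d → ((y :- a) :+ (h :+ b)) :+ d := (((h :+ y) :+ (:- a)) :+ b) :+ d) ≃-refl
          (fromℚ (TTower.even alternation (suc m) j))
          (combination (suc m) (TTower.even one) (λ u → α (evenGap (suc m) u)) j)
          (fromℚ (plus j) * τ (evenGap (suc m) 0))
          (combination m (λ v → TTower.even plus (suc v)) (λ v → τ (evenGap (suc m) (suc v))) j)
          (combination (suc m) (STower.odd minus) (λ v → τ (oddGap (suc m) v)) j)))
        (headPlus j (2 ℕ.* suc m) (2 ℕ.* suc j ℕ.∸ 1))
        (lastTerm j (suc m) (2 ℕ.* suc m) (2 ℕ.* suc j ℕ.∸ 1) (2 ℕ.* suc m) (-1^ suc m) _ _ (-1^n*-1^n (suc m)) (T-even-alternation j m))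
        (negate (Σα-from-0 m (λ u → -1^ u) (λ u → 2 ℕ.* u) (λ u → 2 ℕ.* suc m ℕ.∸ 2 ℕ.* u) (λ u → T (suc j) (ones (2 ℕ.* u)))
          (λ u → TTower.even one u j) -1^n*-1^n (T-even j)))
        (*-congˡ (Στ-from-1 m (λ v → -1^ v) (λ v → 2 ℕ.* v) (λ v → 2 ℕ.* suc m ℕ.∸ 2 ℕ.* v)
          (λ v → T (suc j) (ones (2 ℕ.* v)) ℚ.+ T (suc j) (ones,-1 (2 ℕ.* v ℕ.∸ 1)))
          (λ v → TTower.even plus (suc v) j) (λ v → -1^n*-1^n (suc v)) (T-even-plus j)))
        (*-congˡ (Στ-from-0 m (λ v → -1^ v) (λ v → 2 ℕ.* v ℕ.+ 1) (λ v → 2 ℕ.* suc m ℕ.∸ 2 ℕ.* v ℕ.∸ 1)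
          (λ v → S (suc j) (ones (2 ℕ.* v ℕ.+ 1)) ℚ.- S (suc j) (ones,-1 (2 ℕ.* v)))
          (λ v → STower.odd minus v j) -1^n*-1^n (S-odd-minus j))))
  , ≃-trans (∫≃I (x^arctan^-uniformlyContinuous (2 ℕ.* suc j ℕ.∸ 2) (2 ℕ.* suc m ℕ.∸ 1)) (2 ℕ.* suc j ℕ.∸ 2) (2 ℕ.* suc m ℕ.∸ 1) (λ _ → ≃-refl))
      (assemble (I-M j (2*suc∸2 j) p+1 k+1)
        -- The exponent 2(m+1) - 1 is 2m + 1, hence the closed form at m.
        (≃-trans (D-odd m j) (solve 5 (λ y a h b d → ((y :- a) :- (h :+ b)) :- d := ((((:- h) :+ y) :+ (:- a)) :+ (:- b)) :+ (:- d)) ≃-refl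
          (fromℚ (STower.odd alternation m j))
          (combination (suc m) (TTower.even one) (λ u → α (oddGap (suc m) u)) j)
          (fromℚ (plus j) * τ (oddGap (suc m) 0))
          (combination m (λ v → TTower.even plus (suc v)) (λ v → τ (oddGap (suc m) (suc v))) j)
          (combination m (STower.odd minus) (λ v → τ (evenGap m v)) j)))
        (≃-trans (-‿cong (headPlus j (2 ℕ.* suc m ℕ.∸ 1) (2 ℕ.* suc j ℕ.∸ 1))) (-c*x _ _))
        (≃-trans (-‿cong (lastTerm j (suc m) (2 ℕ.* suc m ℕ.∸ 1) (2 ℕ.* suc j ℕ.∸ 1) (2 ℕ.* suc m ℕ.∸ 1) (-1^ suc m) _ _ (-1^n*-1^n (suc m))
          (oddFlip (λ _ b → S (suc j) (ones,-1 b)) m (STower.odd alternation m j) (S-odd-alternation j m))))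
          -- The odd tower of index m has the scale sign (-1)ᵐ, opposite to the (-1)^(m+1) of the
          -- theorem; the resulting minus cancels the one in front of the term.
          (≃-trans (-c*x _ _) (*-congˡ (fromℚ-neg-neg (STower.odd alternation m j)))))
        (negate (Σα-from-0 m (λ u → -1^ u) (λ u → 2 ℕ.* u) (λ u → 2 ℕ.* suc m ℕ.∸ 2 ℕ.* u ℕ.∸ 1) (λ u → T (suc j) (ones (2 ℕ.* u)))
          (λ u → TTower.even one u j) -1^n*-1^n (T-even j)))
        (*-congˡ (Στ-from-1-neg m (λ v → -1^ (v ℕ.+ 1)) (λ v → 2 ℕ.* v) (λ v → 2 ℕ.* suc m ℕ.∸ 2 ℕ.* v ℕ.∸ 1)
          (λ v → T (suc j) (ones (2 ℕ.* v)) ℚ.+ T (suc j) (ones,-1 (2 ℕ.* v ℕ.∸ 1)))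
          (λ v → TTower.even plus (suc v) j) (λ v → -1^n*-1^n (suc v ℕ.+ 1))
          (λ v → flip+1 (suc v) (2 ℕ.* suc v) (TTower.even plus (suc v) j) (T-even-plus j v))))
        (*-congˡ (≃-trans (Στ-from-1-neg m (λ v → -1^ v) (λ v → 2 ℕ.* v ℕ.∸ 1) (λ v → 2 ℕ.* suc m ℕ.∸ 2 ℕ.* v)
          (λ v → S (suc j) (ones (2 ℕ.* v ℕ.∸ 1)) ℚ.- S (suc j) (ones,-1 (2 ℕ.* v ℕ.∸ 2)))
          (λ v → STower.odd minus v j) (λ v → -1^n*-1^n (suc v))
          (λ v → oddFlip (λ a b → S (suc j) (ones a) ℚ.- S (suc j) (ones,-1 b)) v (STower.odd minus v j) (S-odd-minus j v)))
          (unshift m (STower.odd minus) τ {evenGap m} {evenGap (suc m)} j (evenGap-suc m)))))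
  , ≃-trans (∫≃I (x^arctan^-uniformlyContinuous (2 ℕ.* suc j ℕ.∸ 1) (2 ℕ.* suc m)) (2 ℕ.* suc j ℕ.∸ 1) (2 ℕ.* suc m) (λ _ → ≃-refl))
      (assemble (I-M j k+1 refl (ℕₚ.*-suc 2 j))
        (≃-trans (O-even (suc m) j) (solve 5 (λ y a b h d → ((y :+ a) :+ b) :- (h :+ d) := ((((:- h) :+ y) :+ a) :+ b) :+ (:- d)) ≃-refl
          (fromℚ (STower.even alternation (suc m) j))
          (combination (suc m) (TTower.odd one) (λ u → α (oddGap (suc m) u)) j)
          (combination (suc m) (TTower.odd plus) (λ v → τ (oddGap (suc m) v)) j)
          (fromℚ (minus j) * τ (evenGap (suc m) 0))
          (combination m (λ v → STower.even minus (suc v)) (λ v → τ (evenGap (suc m) (suc v))) j)))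
        (≃-trans (headMinus j (2 ℕ.* suc m) (2 ℕ.* suc j)) (-c*x _ _))
        (lastTerm j (suc m) (2 ℕ.* suc m) (2 ℕ.* suc j) (2 ℕ.* suc m) (-1^ suc m) _ _ (-1^n*-1^n (suc m)) (S-even-alternation j m))
        (*-congˡ (Σα-from-0 m (λ u → -1^ u) (λ u → 2 ℕ.* u ℕ.+ 1) (λ u → 2 ℕ.* suc m ℕ.∸ 2 ℕ.* u ℕ.∸ 1) (λ u → T (suc j) (ones (2 ℕ.* u ℕ.+ 1)))
          (λ u → TTower.odd one u j) -1^n*-1^n (T-odd j)))
        (*-congˡ (Στ-from-0 m (λ v → -1^ v) (λ v → 2 ℕ.* v ℕ.+ 1) (λ v → 2 ℕ.* suc m ℕ.∸ 2 ℕ.* v ℕ.∸ 1)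
          (λ v → T (suc j) (ones (2 ℕ.* v ℕ.+ 1)) ℚ.+ T (suc j) (ones,-1 (2 ℕ.* v)))
          (λ v → TTower.odd plus v j) -1^n*-1^n (T-odd-plus j)))
        (*-congˡ (Στ-from-1-neg m (λ v → -1^ (v ℕ.+ 1)) (λ v → 2 ℕ.* v) (λ v → 2 ℕ.* suc m ℕ.∸ 2 ℕ.* v)
          (λ v → S (suc j) (ones (2 ℕ.* v)) ℚ.- S (suc j) (ones,-1 (2 ℕ.* v ℕ.∸ 1)))
          (λ v → STower.even minus (suc v) j) (λ v → -1^n*-1^n (suc v ℕ.+ 1))
          (λ v → flip+1 (suc v) (2 ℕ.* suc v) (STower.even minus (suc v) j) (S-even-minus j v)))))
  , ≃-trans (∫≃I (x^arctan^-uniformlyContinuous (2 ℕ.* suc j ℕ.∸ 1) (2 ℕ.* suc m ℕ.∸ 1)) (2 ℕ.* suc j ℕ.∸ 1) (2 ℕ.* suc m ℕ.∸ 1) (λ _ → ≃-refl))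
      (assemble (I-M j k+1 p+1 (ℕₚ.*-suc 2 j))
        (≃-trans (O-odd m j) (solve 5 (λ y a b h d → ((:- y :+ a) :- b) :+ (h :+ d) := (((h :+ (:- y)) :+ a) :+ (:- b)) :+ d) ≃-refl
          (fromℚ (TTower.odd alternation m j))
          (combination m (TTower.odd one) (λ u → α (evenGap m u)) j)
          (combination m (TTower.odd plus) (λ v → τ (evenGap m v)) j)
          (fromℚ (minus j) * τ (oddGap (suc m) 0))
          (combination m (λ v → STower.even minus (suc v)) (λ v → τ (oddGap (suc m) (suc v))) j)))
        -- The minus sign of `headMinus` cancels the one in front of the leading term.
        (≃-trans (-‿cong (headMinus j (2 ℕ.* suc m ℕ.∸ 1) (2 ℕ.* suc j))) (solve 1 (λ a → :- :- a := a) ≃-refl _))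
        (≃-trans (lastTerm j (suc m) (2 ℕ.* suc m ℕ.∸ 1) (2 ℕ.* suc j) (2 ℕ.* suc m ℕ.∸ 1) (-1^ suc m) _ _ (-1^n*-1^n (suc m))
          (oddFlip (λ _ b → T (suc j) (ones,-1 b)) m (TTower.odd alternation m j) (T-odd-alternation j m)))
          (*-congˡ (≃-pointwise {y = - fromℚ (TTower.odd alternation m j)} λ _ → refl)))
        (double-negate (≃-trans (Σα-from-1-neg m (λ u → -1^ u) (λ u → 2 ℕ.* u ℕ.∸ 1) (λ u → 2 ℕ.* suc m ℕ.∸ 2 ℕ.* u)
          (λ u → T (suc j) (ones (2 ℕ.* u ℕ.∸ 1))) (λ u → TTower.odd one u j) (λ u → -1^n*-1^n (suc u))
          (λ u → oddFlip (λ a _ → T (suc j) (ones a)) u (TTower.odd one u j) (T-odd j u)))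
          (unshift m (TTower.odd one) α {evenGap m} {evenGap (suc m)} j (evenGap-suc m))))
        (*-congˡ (≃-trans (Στ-from-1-neg m (λ v → -1^ v) (λ v → 2 ℕ.* v ℕ.∸ 1) (λ v → 2 ℕ.* suc m ℕ.∸ 2 ℕ.* v)
          (λ v → T (suc j) (ones (2 ℕ.* v ℕ.∸ 1)) ℚ.+ T (suc j) (ones,-1 (2 ℕ.* v ℕ.∸ 2)))
          (λ v → TTower.odd plus v j) (λ v → -1^n*-1^n (suc v))
          (λ v → oddFlip (λ a b → T (suc j) (ones a) ℚ.+ T (suc j) (ones,-1 b)) v (TTower.odd plus v j) (T-odd-plus j v)))
          (unshift m (TTower.odd plus) τ {evenGap m} {evenGap (suc m)} j (evenGap-suc m))))
        (*-congˡ (Στ-from-1 m (λ v → -1^ v) (λ v → 2 ℕ.* v) (λ v → 2 ℕ.* suc m ℕ.∸ 2 ℕ.* v ℕ.∸ 1)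
          (λ v → S (suc j) (ones (2 ℕ.* v)) ℚ.- S (suc j) (ones,-1 (2 ℕ.* v ℕ.∸ 1)))
          (λ v → STower.even minus (suc v) j) (λ v → -1^n*-1^n (suc v)) (S-even-minus j))))
  )
  where
  open ℝ-Solver
  k+1 : 2 ℕ.* suc j ℕ.∸ 1 ≡ suc (2 ℕ.* j)
  k+1 = cong (ℕ._∸ 1) (ℕₚ.*-suc 2 j)
  p+1 : 2 ℕ.* suc m ℕ.∸ 1 ≡ suc (2 ℕ.* m)
  p+1 = cong (ℕ._∸ 1) (ℕₚ.*-suc 2 m)
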